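{- Let $\mathcal{O}$ be an oriented matroid of rank $r$ with ground set $E$ and $f\ne g\in E$. Let $I=[e_1,\dots,e_k]$, $k\le r$, be an ordered set of independent elements of $E$. Let $l\le k$ be the smallest index with $f\in\mathrm{cl}(\{e_1,\dots,e_l\})$ ($l=k+1$ if none), and $m\le k$ the smallest index with $g\in\mathrm{cl}(\{e_1,\dots,e_m\})$ ($m=k+1$ if none). Assume (i) $(\mathcal{O},g,f)$ is a Euclidean oriented matroid program; (ii) $(\mathcal{O},e_1,f),\dots,(\mathcal{O},e_k,f)$ are Euclidean oriented matroid programs; (iii) $(\mathcal{O},e_1,g),\dots,(\mathcal{O},e_k,g)$ are Euclidean oriented matroid programs; (iv) if $\min(l,m)<k+1$ or if $f$ or $g$ is not in general position, then with $n=\min(\max(l,m),k-1)$ the programs $(\mathcal{O}/\{e_1,\dots,e_{i-1}\},e_i,e_j)$ are Euclidean for all $1\le i\le n$ and $i<j\le k$. Let $\mathcal{O}'=\mathcal{O}\cup p$ be the lexicographic extension $\mathcal{O}[e_1^+,\dots,e_k^+]$. Then $(\mathcal{O}',g,f)$ is a Euclidean oriented matroid program.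
   Context: Oriented matroids are given by covectors in $\{+,-,0\}^E$; cocircuits are minimal nonzero covectors; $z(X)=\{e:X_e=0\}$, $\mathrm{sep}(X,Y)=\{e:X_e=-Y_e\ne0\}$, conformal means $\mathrm{sep}=\emptyset$. Cocircuits $X\ne\pm Y$ are comodular if $z(X\circ Y)$ is a flat of rank $r-2$; elimination of $e\in\mathrm{sep}(X,Y)$ yields the unique cocircuit $Z$ with $Z_e=0$, $\mathrm{supp}(Z)\subseteq\mathrm{supp}(X\circ Y)\setminus\{e\}$. An oriented matroid program $(\mathcal{O},g,f)$: distinct $g,f$, $g$ not a loop, $f$ not a coloop. For comodular cocircuits $X,Y$ with $X_g=Y_g\ne0$ and $Z$ the elimination of $g$ between $-X$ and $Y$: $X\to Y$, $X\leftarrow Y$, undirected according as $Z_f=+,-,0$. $G_f$: vertices cocircuits with $g=+$, edges conformal comodular pairs, directed so; the program is Euclidean if $G_f$ has no directed cycle (closed sequence of distinct vertices, each edge forward or undirected, at least one forward). An element $f$ is in general position if $f\notin\mathrm{cl}(S)$ for all $S\subseteq E\setminus\{f\}$ of rank $<r$. $\mathcal{O}[e_1^+,\dots,e_k^+]=\mathcal{O}\cup p$ is the single-element extension by $p$ with localization $\sigma(Y)=Y_{e_i}$ for cocircuits $Y$, $i$ least with $Y_{e_i}\ne0$, and $\sigma(Y)=0$ if none. -}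

module Defs where

open import Data.Nat using (ℕ; zero; suc; _+_; _≤_; _<_)
open import Data.Fin using (Fin; zero; suc; toℕ)
open import Data.Vec using (Vec; []; _∷_; lookup; replicate; tabulate)
open import Data.Bool using (Bool; true; false)
open import Data.Product using (Σ; _×_; _,_)
open import Data.Sum using (_⊎_)
open import Data.Empty using (⊥)
open import Relation.Nullary using (¬_)
open import Relation.Binary.PropositionalEquality using (_≡_; _≢_)
open import Data.Fin.Subset using (Subset; _∈_; _⊆_; _∪_; _∩_; _─_; _-_; ⁅_⁆; ∣_∣)
  renaming (⊥ to ∅; ⊤ to Full)

-- Signs and sign vectors.  The ground set of an oriented matroid on n
-- elements is (a subset E of) Fin n; sign vectors are Vec Sign n.

data Sign : Set where
  pos neg zer : Sign

-_ : Sign → Sign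
- pos = neg
- neg = pos
- zer = zer

SignVec : ℕ → Set
SignVec n = Vec Sign n

private
  variable
    n : ℕ

negV : SignVec n → SignVec n
negV []       = []
negV (s ∷ X) = (- s) ∷ negV X

_∘ₛ_ : Sign → Sign → Sign
zer ∘ₛ t = t
pos ∘ₛ t = pos
neg ∘ₛ t = neg

_∘_ : SignVec n → SignVec n → SignVec n
[]       ∘ []       = []
(s ∷ X) ∘ (t ∷ Y) = (s ∘ₛ t) ∷ (X ∘ Y)

zeroV : SignVec n
zeroV = replicate _ zer

isZer : Sign → Bool
isZer zer = true
isZer pos = false
isZer neg = false

zset : SignVec n → Subset n
zset X = tabulate (λ e → isZer (lookup X e))

Sep : SignVec n → SignVec n → Fin n → Set
Sep X Y e = (lookup X e ≢ zer) × (lookup X e ≡ - lookup Y e)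

Conformal : SignVec n → SignVec n → Set
Conformal X Y = ∀ e → ¬ Sep X Y e

VanishOn : SignVec n → Subset n → Set
VanishOn X S = ∀ e → e ∈ S → lookup X e ≡ zer

CovSet : ℕ → Set₁
CovSet n = SignVec n → Set

record IsOM {n : ℕ} (C : CovSet n) : Set where
  field
    zero∈ : C zeroV
    neg∈  : ∀ X → C X → C (negV X)
    comp∈ : ∀ X Y → C X → C Y → C (X ∘ Y)
    elim  : ∀ X Y e → C X → C Y → Sep X Y e →
            Σ (SignVec n) λ Z → C Z × (lookup Z e ≡ zer) ×
              (∀ h → ¬ Sep X Y h → lookup Z h ≡ lookup (X ∘ Y) h)

-- Matroid notions, relative to a covector set C and a ground set E ⊆ Fin n
-- (elements outside E are zero in every covector; E is used so that
-- contractions O/A can be taken with ground set E ─ A).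

module _ {n : ℕ} (C : CovSet n) (E : Subset n) where

  Cl : Subset n → Fin n → Set
  Cl S e = e ∈ E × (∀ X → C X → VanishOn X S → lookup X e ≡ zer)

  Independent : Subset n → Set
  Independent I = I ⊆ E × (∀ e → e ∈ I → ¬ Cl (I - e) e)

  HasRank : Subset n → ℕ → Set
  HasRank S k = Σ (Subset n) λ I → I ⊆ S × Independent I × ∣ I ∣ ≡ k ×
                  (∀ J → J ⊆ S → Independent J → ∣ J ∣ ≤ k)

  Loop : Fin n → Set
  Loop e = Cl ∅ e

  Coloop : Fin n → Set
  Coloop e = e ∈ E × ¬ Cl (E - e) e

  GeneralPosition : Fin n → Set
  GeneralPosition f = ∀ S k r → S ⊆ (E - f) → HasRank S k → HasRank E r → k < r → ¬ Cl S f

  Nonzero : SignVec n → Set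
  Nonzero X = Σ (Fin n) λ e → lookup X e ≢ zer

  Cocircuit : SignVec n → Set
  Cocircuit X = C X × Nonzero X ×
    (∀ Y → C Y → Nonzero Y → (∀ e → lookup X e ≡ zer → lookup Y e ≡ zer) →
       ∀ e → lookup Y e ≡ zer → lookup X e ≡ zer)

  Comodular : SignVec n → SignVec n → Set
  Comodular X Y = Cocircuit X × Cocircuit Y × X ≢ Y × X ≢ negV Y ×
    Σ ℕ λ k → HasRank E (k + 2) × HasRank (zset (X ∘ Y) ∩ E) k

  Elimination : SignVec n → SignVec n → Fin n → SignVec n → Set
  Elimination X Y e Z = Cocircuit Z × lookup Z e ≡ zer ×
    (∀ h → lookup Z h ≢ zer → (lookup Z h ≡ lookup X h) ⊎ (lookup Z h ≡ lookup Y h))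

  module _ (g f : Fin n) where

    Vertex : SignVec n → Set
    Vertex X = Cocircuit X × lookup X g ≡ pos

    EdgeLabel : SignVec n → SignVec n → Sign → Set
    EdgeLabel X Y s = Vertex X × Vertex Y × Conformal X Y × Comodular X Y ×
      Σ (SignVec n) λ Z → Elimination (negV X) Y g Z × lookup Z f ≡ s

    Forward : SignVec n → SignVec n → Set
    Forward X Y = EdgeLabel X Y pos

    ForwardOrUndirected : SignVec n → SignVec n → Set
    ForwardOrUndirected X Y = EdgeLabel X Y pos ⊎ EdgeLabel X Y zer

  IsProgram : Fin n → Fin n → Set
  IsProgram g f = g ≢ f × g ∈ E × f ∈ E × ¬ Loop g × ¬ Coloop f

next : ∀ {t} → Fin (suc t) → Fin (suc t)
next {zero} zero = zero
next {suc t} zero = suc zero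
next {suc t} (suc i) with next {t} i
... | zero  = zero
... | suc j = suc (suc j)

module _ {n : ℕ} (C : CovSet n) (E : Subset n) (g f : Fin n) where

  DirectedCycle : Set
  DirectedCycle = Σ ℕ λ t → Σ (Fin (suc t) → SignVec n) λ cyc →
    (∀ i j → cyc i ≡ cyc j → i ≡ j) ×
    (∀ i → ForwardOrUndirected C E g f (cyc i) (cyc (next i))) ×
    Σ (Fin (suc t)) λ i → Forward C E g f (cyc i) (cyc (next i))

  EuclideanProgram : Set
  EuclideanProgram = IsProgram C E g f × ¬ DirectedCycle

-- Contraction O/A: ground set E ─ A, covectors of O vanishing on A.

contract : CovSet n → Subset n → CovSet n
contract C A X = C X × VanishOn X A

-- Ordered sets e_1,…,e_k as functions Fin k → Fin n (0-based indices).

prefix : ∀ {k} → (Fin k → Fin n) → ℕ → Subset n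
prefix {k = zero}  es j       = ∅
prefix {k = suc k} es zero    = ∅
prefix {k = suc k} es (suc j) = ⁅ es zero ⁆ ∪ prefix (λ i → es (suc i)) j

setOf : ∀ {k} → (Fin k → Fin n) → Subset n
setOf {k = k} es = prefix es k

-- l is the smallest index (1-based) with x ∈ cl{e_1,…,e_l}, l = k+1 if none
IsFirstClosureIndex : CovSet n → ∀ {k} → (Fin k → Fin n) → Fin n → ℕ → Set
IsFirstClosureIndex {n} C {k} es x l =
  1 ≤ l × l ≤ suc k × (l ≤ k → Cl C Full (prefix es l) x) ×
  (∀ j → 1 ≤ j → j < l → ¬ Cl C Full (prefix es j) x)

lexSign : ∀ {k} → (Fin k → Fin n) → SignVec n → Sign
lexSign {k = zero}  es Y = zer
lexSign {k = suc k} es Y with lookup Y (es zero)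
... | zer = lexSign (λ i → es (suc i)) Y
... | pos = pos
... | neg = neg

-- O' (on Fin (suc n), new element p = zero, old e ↦ suc e) is the
-- single-element extension of O with localization σ:
-- O' is an oriented matroid, O' ∖ p = O, and for every cocircuit Y of O the
-- sign of p in O' over Y is exactly σ(Y).
IsSingleElementExtension : CovSet n → CovSet (suc n) → (SignVec n → Sign) → Set
IsSingleElementExtension C C' σ =
  IsOM C' ×
  (∀ X → (C X → Σ Sign λ s → C' (s ∷ X)) × (Σ Sign (λ s → C' (s ∷ X)) → C X)) ×
  (∀ Y → Cocircuit C Full Y → C' (σ Y ∷ Y) × (∀ s → C' (s ∷ Y) → s ≡ σ Y))

{-# OPTIONS --safe #-}

-- If O were realizable, p would be e₁ + δ e₂ + δ² e₃ + ⋯ with δ infinitesimal.  A vertex W of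
-- the extension is either a cocircuit of O, or it lies on p and on a line ℓ of O, next to the
-- cocircuit Y in which ℓ meets the first e_i that does not vanish at W.  In the second case
--     (f/g)(W) = (f/g)(Y) - (p/g)(Y) · (f/p)(G)    with G = ℓ ∩ g.
-- An acyclic program (x, y) has a potential that behaves like y/x on all cocircuits of O: the
-- number of vertices from which a given one can be reached.  Exchanging x and y reverses this
-- order within each sign class, so there are also potentials for e_t/g and e_t/f.  Along a
-- directed cycle of the extension the following are monotone, hence constant, one after the
-- other: the sign of f, the potential of f/g at Y, the sign of the correction term, the
-- potentials of e_1/g, e_2/g, … at Y, and the potentials of e_1/f, e_2/f, … at G.  Once all of
-- them are constant no edge is directed.  If g vanishes at Y, then f and g change roles; if both
-- vanish there, then f/g is constant on ℓ and Y is replaced by another point of ℓ.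
--
-- Two adjacent vertices on p span a rank 3 contraction, and there the comparisons are sign
-- identities between brackets [x y z] in which p is expanded lexicographically.  Since the
-- conclusion is negative, membership in the covector set may be assumed to be decidable.
module Submission where

open import Defs
open import Data.Nat using (ℕ; zero; suc; _+_; _≤_; _<_; z≤n; s≤s; _⊓_; _⊔_; _∸_)
open import Data.Nat.Properties
open import Data.Bool using (true)
open import Data.Fin using (Fin; zero; suc; toℕ; fromℕ; inject₁) renaming (_<_ to _<ᶠ_; _≟_ to _≟ᶠ_)
open import Data.Fin.Properties using (all?; any?) renaming (suc-injective to sucᶠ-injective; <-cmp to <ᶠ-cmp; <-trans to <ᶠ-trans)
open import Data.Fin.Induction using (<-weakInduction; >-weakInduction)
open import Data.Fin.Subset using (Subset; inside; outside; _∈_; _∉_; _⊆_; _∪_; _∩_; _─_; _-_; ⁅_⁆; ∣_∣) renaming (⊤ to Full; ⊥ to ∅)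
open import Data.Fin.Subset.Properties
open import Data.Vec using (Vec; []; _∷_; lookup; map; tabulate; tail; here; there)
open import Data.Vec.Properties using (lookup-map; lookup-replicate; lookup∘tabulate; []=⇒lookup; lookup⇒[]=; ≡-dec)
open import Data.Maybe using (Maybe; just; nothing)
open import Data.Maybe.Properties using (just-injective)
open import Data.Product using (Σ; ∃; _×_; _,_; proj₁; proj₂)
open import Data.Sum using (_⊎_; inj₁; inj₂)
open import Data.Unit using (⊤; tt)
open import Data.Empty using (⊥; ⊥-elim)
open import Relation.Nullary using (¬_; Dec; yes; no; does; contradiction)
open import Relation.Nullary.Decidable using (map′; _→-dec_; _×-dec_; _⊎-dec_; ¬?; True; toWitness; decidable-stable; dec-true; ¬¬-excluded-middle)
open import Relation.Binary.Definitions using (DecidableEquality; tri<; tri≈; tri>)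
open import Relation.Binary.Construct.Closure.ReflexiveTransitive using (Star; _◅_; _◅◅_) renaming (ε to nil)
open import Relation.Binary.PropositionalEquality

-- Signs

-- A potential compares two cocircuits only if they lie on a common line of O, so every comparison
-- along an edge has to exhibit such a line. For adjacent vertices W, W' on p: if both lie next to
-- the same e_i, then Y and Y' are on e_i; if W' vanishes at the e_i of W, then Y and the point
-- belonging to W' are again on e_i; the points G and G' are both on g, or both on f. If W' is off
-- p, the line of W also carries W'.
--
-- The expansion of p enters through one rule: a bracket [x y p] with x, y old has the sign of the
-- first nonzero [x y e_t]. If the potentials of e_u/g agree for all u < t, the corresponding
-- brackets with e_u vanish, so the bracket with p can only reflect index t or a later one. This
-- dictates the induction on the index.
--
-- An acyclic program (e_t, g) controls g/e_t, while the rule calls for e_t/g; this is the purpose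
-- of exchanging the two elements.
--
-- If g vanishes at Y and f does not, the level of W is infinite, with the sign ε of f; hence the
-- sign of f has to be constant along the cycle before levels can be compared.

infixl 7 _·_
_·_ : Sign → Sign → Sign
pos · t = t
neg · t = - t
zer · t = zer

infix 4 _≟ₛ_
_≟ₛ_ : DecidableEquality Sign
pos ≟ₛ pos = yes refl
pos ≟ₛ neg = no λ ()
pos ≟ₛ zer = no λ ()
neg ≟ₛ pos = no λ ()
neg ≟ₛ neg = yes refl
neg ≟ₛ zer = no λ ()
zer ≟ₛ pos = no λ ()
zer ≟ₛ neg = no λ ()
zer ≟ₛ zer = yes refl

-- c is a possible sign of x + y when x and y have signs a and b.
Sum : Sign → Sign → Sign → Set
Sum a b c = (a ≡ zer → c ≡ b) × (b ≡ zer → c ≡ a) × (a ≡ b → c ≡ a)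

-- Sign identities decided by enumeration

data Tm (N : ℕ) : Set where
  var : Fin N → Tm N
  con : Sign → Tm N
  _⊗_ : Tm N → Tm N → Tm N
  ⊝_  : Tm N → Tm N

infixr 4 _⇛_
infixr 5 _⋏_
infix  6 _≐_ _≠_
infixl 8 _⊗_
infix  9 ⊝_

data Fm (N : ℕ) : Set where
  _≐_ : Tm N → Tm N → Fm N
  _⇛_ : Fm N → Fm N → Fm N
  _⋏_ : Fm N → Fm N → Fm N
  ff  : Fm N

_≠_ : ∀ {N} → Tm N → Tm N → Fm N
t ≠ u = t ≐ u ⇛ ff

𝟎 𝟏 : ∀ {N} → Tm N
𝟎 = con zer
𝟏 = con pos

sum : ∀ {N} → Tm N → Tm N → Tm N → Fm N
sum a b c = (a ≐ 𝟎 ⇛ c ≐ b) ⋏ (b ≐ 𝟎 ⇛ c ≐ a) ⋏ (a ≐ b ⇛ c ≐ a)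

⟦_⟧t : ∀ {N} → Tm N → Vec Sign N → Sign
⟦ var i ⟧t ρ = lookup ρ i
⟦ con s ⟧t ρ = s
⟦ t ⊗ u ⟧t ρ = ⟦ t ⟧t ρ · ⟦ u ⟧t ρ
⟦ ⊝ t ⟧t   ρ = - ⟦ t ⟧t ρ

⟦_⟧ : ∀ {N} → Fm N → Vec Sign N → Set
⟦ t ≐ u ⟧ ρ = ⟦ t ⟧t ρ ≡ ⟦ u ⟧t ρ
⟦ φ ⇛ ψ ⟧ ρ = ⟦ φ ⟧ ρ → ⟦ ψ ⟧ ρ
⟦ φ ⋏ ψ ⟧ ρ = ⟦ φ ⟧ ρ × ⟦ ψ ⟧ ρ
⟦ ff ⟧    ρ = ⊥

⟦_⟧? : ∀ {N} (φ : Fm N) ρ → Dec (⟦ φ ⟧ ρ)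
⟦ t ≐ u ⟧? ρ = ⟦ t ⟧t ρ ≟ₛ ⟦ u ⟧t ρ
⟦ φ ⇛ ψ ⟧? ρ = ⟦ φ ⟧? ρ →-dec ⟦ ψ ⟧? ρ
⟦ φ ⋏ ψ ⟧? ρ = ⟦ φ ⟧? ρ ×-dec ⟦ ψ ⟧? ρ
⟦ ff ⟧?    ρ = no λ ()

AllSigns : ∀ N → (Vec Sign N → Set) → Set
AllSigns zero    P = P []
AllSigns (suc N) P = ∀ s → AllSigns N (λ ρ → P (s ∷ ρ))

allSigns? : ∀ N {P} → (∀ ρ → Dec (P ρ)) → Dec (AllSigns N P)
allSigns? zero    P? = P? []
allSigns? (suc N) P? =
  map′ (λ { (a , b , c) pos → a ; (a , b , c) neg → b ; (a , b , c) zer → c })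
       (λ h → h pos , h neg , h zer)
       (allSigns? N (λ ρ → P? (pos ∷ ρ)) ×-dec
        allSigns? N (λ ρ → P? (neg ∷ ρ)) ×-dec
        allSigns? N (λ ρ → P? (zer ∷ ρ)))

-- Formulas as functions of their variables, so that a statement handed to `prove` reads as a lambda
-- term; `close` feeds in the numbered variables.
Open : ℕ → ℕ → Set
Open M zero    = Fm M
Open M (suc k) = Tm M → Open M k

close : ∀ {M} k → (Fin k → Fin M) → Open M k → Fm M
close zero    ι φ = φ
close (suc k) ι φ = close k (λ i → ι (suc i)) (φ (var (ι zero)))

-- Decided by running through all 3 ^ N assignments.
prove : ∀ N (φ : Open N N) → let ψ = close N (λ i → i) φ in
        {_ : True (allSigns? N ⟦ ψ ⟧?)} → AllSigns N ⟦ ψ ⟧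
prove N φ {t} = toWitness t

pos≢ : ∀ {s} → s ≡ pos → s ≢ zer
pos≢ refl ()

nz· : ∀ {u a} → u ≢ zer → a ≢ zer → u · a ≢ zer
nz· {u} {a} = prove 2 (λ s a → s ≠ 𝟎 ⇛ a ≠ 𝟎 ⇛ s ⊗ a ≠ 𝟎) u a

neg-neg : ∀ s → - (- s) ≡ s
neg-neg = prove 1 (λ s → ⊝ (⊝ s) ≐ s)

·-zeroʳ : ∀ s → s · zer ≡ zer
·-zeroʳ = prove 1 (λ s → s ⊗ 𝟎 ≐ 𝟎)

·-zero : ∀ u {a} → a ≡ zer → u · a ≡ zer
·-zero u refl = ·-zeroʳ u

square : ∀ {s} → s ≢ zer → s · s ≡ pos
square {s} = prove 1 (λ s → s ≠ 𝟎 ⇛ s ⊗ s ≐ 𝟏) s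

self-opposite : ∀ {s} → s ≡ - s → s ≡ zer
self-opposite {s} = prove 1 (λ s → s ≐ ⊝ s ⇛ s ≐ 𝟎) s

∘ₛ-zeroˡ : ∀ a b → a ∘ₛ b ≡ zer → a ≡ zer
∘ₛ-zeroˡ zer b _ = refl

∘ₛ-zeroʳ : ∀ a b → a ∘ₛ b ≡ zer → b ≡ zer
∘ₛ-zeroʳ zer b q = q

-- Covectors and rank

infix 25 _‼_
_‼_ : ∀ {n} → SignVec n → Fin n → Sign
X ‼ e = lookup X e

ext : ∀ {n} {X Y : SignVec n} → (∀ e → X ‼ e ≡ Y ‼ e) → X ≡ Y
ext {X = []}    {[]}    h = refl
ext {X = x ∷ X} {y ∷ Y} h = cong₂ _∷_ (h zero) (ext (λ e → h (suc e)))

neg-‼ : ∀ {n} (X : SignVec n) e → negV X ‼ e ≡ - (X ‼ e)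
neg-‼ (x ∷ X) zero    = refl
neg-‼ (x ∷ X) (suc e) = neg-‼ X e

∘-‼ : ∀ {n} (X Y : SignVec n) e → (X ∘ Y) ‼ e ≡ X ‼ e ∘ₛ Y ‼ e
∘-‼ (x ∷ X) (y ∷ Y) zero    = refl
∘-‼ (x ∷ X) (y ∷ Y) (suc e) = ∘-‼ X Y e

scale : ∀ {n} → Sign → SignVec n → SignVec n
scale u = map (u ·_)

scale-‼ : ∀ {n} u (X : SignVec n) e → scale u X ‼ e ≡ u · X ‼ e
scale-‼ u X e = lookup-map e (u ·_) X

∈zset : ∀ {n} (X : SignVec n) {e} → X ‼ e ≡ zer → e ∈ zset X
∈zset X {e} p = lookup⇒[]= e (zset X) (trans (lookup∘tabulate _ e) (cong isZer p))

isZer⇒ : ∀ {s} → isZer s ≡ inside → s ≡ zer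
isZer⇒ {zer} p = refl

zset∈ : ∀ {n} (X : SignVec n) {e} → e ∈ zset X → X ‼ e ≡ zer
zset∈ X {e} p = isZer⇒ (trans (sym (lookup∘tabulate _ e)) ([]=⇒lookup p))

-- Finite search over sign vectors, and subsets

abstract
  anyV? : ∀ {n} {P : SignVec n → Set} → (∀ X → Dec (P X)) → Dec (∃ P)
  anyV? {zero}  P? = map′ (λ p → [] , p) (λ { ([] , p) → p }) (P? [])
  anyV? {suc n} {P} P? =
    map′ (λ { (inj₁ (X , p)) → pos ∷ X , p ; (inj₂ (inj₁ (X , p))) → neg ∷ X , p ; (inj₂ (inj₂ (X , p))) → zer ∷ X , p })
         (λ { (pos ∷ X , p) → inj₁ (X , p) ; (neg ∷ X , p) → inj₂ (inj₁ (X , p)) ; (zer ∷ X , p) → inj₂ (inj₂ (X , p)) })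
         (anyV? (λ X → P? (pos ∷ X)) ⊎-dec anyV? (λ X → P? (neg ∷ X)) ⊎-dec anyV? (λ X → P? (zer ∷ X)))

-- Double negation commutes with a finite product. This allows classical decisions about covectors
-- and reachability on the way to a negative conclusion.
¬¬-∀V : ∀ {n} {P : SignVec n → Set} → (∀ X → ¬ ¬ P X) → ¬ ¬ (∀ X → P X)
¬¬-∀V {zero}  h k = h [] (λ p → k λ { [] → p })
¬¬-∀V {suc n} h k =
  ¬¬-∀V (λ X → h (pos ∷ X)) λ a → ¬¬-∀V (λ X → h (neg ∷ X)) λ b → ¬¬-∀V (λ X → h (zer ∷ X)) λ c →
  k λ { (pos ∷ X) → a X ; (neg ∷ X) → b X ; (zer ∷ X) → c X }

¬¬-∀F : ∀ {n} {P : Fin n → Set} → (∀ i → ¬ ¬ P i) → ¬ ¬ (∀ i → P i)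
¬¬-∀F {zero}  h k = k λ ()
¬¬-∀F {suc n} h k = h zero λ a → ¬¬-∀F (λ i → h (suc i)) λ b → k λ { zero → a ; (suc i) → b i }

infixl 6 _⊕_
_⊕_ : ∀ {n} → Subset n → Fin n → Subset n
S ⊕ e = S ∪ ⁅ e ⁆

card-remove : ∀ {n} (p : Subset n) x → x ∈ p → ∣ p ∣ ≡ suc ∣ p - x ∣
card-remove (inside ∷ p) zero    here       = cong (λ q → suc ∣ q ∣) (sym (p─⊥≡p p))
card-remove (inside ∷ p)  (suc x) (there m) = cong suc (card-remove p x m)
card-remove (outside ∷ p) (suc x) (there m) = card-remove p x m

card-add : ∀ {n} (p : Subset n) x → x ∉ p → ∣ p ⊕ x ∣ ≡ suc ∣ p ∣
card-add (inside ∷ p)  zero    h = ⊥-elim (h here)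
card-add (outside ∷ p) zero    h = cong (λ q → suc ∣ q ∣) (∪-identityʳ p)
card-add (inside ∷ p)  (suc x) h = cong suc (card-add p x (λ m → h (there m)))
card-add (outside ∷ p) (suc x) h = card-add p x (λ m → h (there m))

x∉p-x : ∀ {n} (p : Subset n) {x} → ¬ (x ∈ p - x)
x∉p-x (s ∷ p) {suc x} (there m) = x∉p-x p m

card-nonempty : ∀ {n} (p : Subset n) {m} → ∣ p ∣ ≡ suc m → ∃ λ x → x ∈ p
card-nonempty (inside ∷ p)  h = zero , here
card-nonempty (outside ∷ p) h = let x , m = card-nonempty p h in suc x , there m

record Van {n} (X : SignVec n) (S : Subset n) : Set where
  constructor van
  field at : VanishOn X S
open Van public

Van? : ∀ {n} (X : SignVec n) S → Dec (Van X S)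
Van? X S = map′ van at (all? λ e → (e ∈? S) →-dec (X ‼ e ≟ₛ zer))

van-⊕ : ∀ {n} {X : SignVec n} {S e} → Van X S → X ‼ e ≡ zer → Van X (S ⊕ e)
van-⊕ {X = X} {S} {e} v z = van λ h m → go h (x∈p∪q⁻ S ⁅ e ⁆ m)
  where
  go : ∀ h → h ∈ S ⊎ h ∈ ⁅ e ⁆ → X ‼ h ≡ zer
  go h (inj₁ a) = at v h a
  go h (inj₂ b) = subst (λ i → X ‼ i ≡ zer) (sym (x∈⁅y⁆⇒x≡y e b)) z

van-⊕ˡ : ∀ {n} {X : SignVec n} {S e} → Van X (S ⊕ e) → Van X S
van-⊕ˡ v = van λ h m → at v h (x∈p∪q⁺ (inj₁ m))

van-⊕ʳ : ∀ {n} {X : SignVec n} {S e} → Van X (S ⊕ e) → X ‼ e ≡ zer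
van-⊕ʳ v = at v _ (x∈p∪q⁺ (inj₂ (x∈⁅x⁆ _)))

van-scale : ∀ {n} u {X : SignVec n} {S} → Van X S → Van (scale u X) S
van-scale u {X} v = van λ h m → trans (scale-‼ u X h) (·-zero u (at v h m))

van-zset : ∀ {n} (X : SignVec n) → Van X (zset X)
van-zset X = van λ e m → zset∈ X m

nonzero? : ∀ {n} (X : SignVec n) → Dec (∃ λ e → X ‼ e ≢ zer)
nonzero? X = any? λ e → ¬? (X ‼ e ≟ₛ zer)

¬nonzero⇒ : ∀ {n} {X : SignVec n} → ¬ (∃ λ e → X ‼ e ≢ zer) → ∀ e → X ‼ e ≡ zer
¬nonzero⇒ {X = X} h e = decidable-stable (X ‼ e ≟ₛ zer) (λ p → h (e , p))

∘ₛ-sum : ∀ a b → Sum a b (a ∘ₛ b)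
∘ₛ-sum pos b = (λ ()) , (λ _ → refl) , λ _ → refl
∘ₛ-sum neg b = (λ ()) , (λ _ → refl) , λ _ → refl
∘ₛ-sum zer b = (λ _ → refl) , (λ p → p) , sym

-- Elimination, closure and rank

module OM {n : ℕ} (C : CovSet n) (om : IsOM C) (C? : ∀ X → Dec (C X)) where
  open IsOM om

  C-scale : ∀ u {X} → C X → C (scale u X)
  C-scale pos {X} c = subst C (sym (ext {X = scale pos X} (scale-‼ pos X))) c
  C-scale neg {X} c = subst C (sym (ext {X = scale neg X} (λ e → trans (scale-‼ neg X e) (sym (neg-‼ X e))))) (neg∈ X c)
  C-scale zer {X} c = subst C (sym (ext {X = scale zer X} {zeroV} (λ e → trans (scale-‼ zer X e) (sym (lookup-replicate e zer))))) zero∈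

  abstract
    -- Elimination written as addition. If both vectors vanish at e, `A ∘ B` serves; where A and B
    -- are opposite, elimination gives no information and `Sum` asks for none.
    add : ∀ A B e → C A → C B → A ‼ e ≡ - (B ‼ e) →
          ∃ λ Z → C Z × Z ‼ e ≡ zer × (∀ h → Sum (A ‼ h) (B ‼ h) (Z ‼ h))
    add A B e cA cB q with A ‼ e ≟ₛ zer
    ... | yes z = A ∘ B , comp∈ A B cA cB ,
                  trans (∘-‼ A B e) (trans (cong₂ _∘ₛ_ z (prove 2 (λ a b → a ≐ ⊝ b ⇛ a ≐ 𝟎 ⇛ b ≐ 𝟎) _ _ q z)) refl) ,
                  λ h → subst (Sum _ _) (sym (∘-‼ A B h)) (∘ₛ-sum _ _)
    ... | no nz with elim A B e cA cB (nz , q)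
    ... | Z , cZ , z , Zh = Z , cZ , z , go
      where
      go : ∀ h → Sum (A ‼ h) (B ‼ h) (Z ‼ h)
      go h with A ‼ h ≟ₛ zer | A ‼ h ≟ₛ - (B ‼ h)
      ... | yes a | _ = subst (Sum _ _) (sym (trans (Zh h (λ s → proj₁ s a)) (∘-‼ A B h))) (∘ₛ-sum _ _)
      ... | no a | no b = subst (Sum _ _) (sym (trans (Zh h (λ s → b (proj₂ s))) (∘-‼ A B h))) (∘ₛ-sum _ _)
      ... | no a | yes b = prove 3 (λ a b c → a ≠ 𝟎 ⇛ a ≐ ⊝ b ⇛ sum a b c) _ _ _ a b

    -- the sign pattern of A(e) B - B(e) A
    det : ∀ A B e {S} → C A → C B → Van A S → Van B S →
          ∃ λ Z → C Z × Van Z S × Z ‼ e ≡ zer × (∀ h → Sum (- (B ‼ e) · A ‼ h) (A ‼ e · B ‼ h) (Z ‼ h))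
    det A B e cA cB vA vB =
      let u = - (B ‼ e); v = A ‼ e
          Z , cZ , z , s = add (scale u A) (scale v B) e (C-scale u cA) (C-scale v cB)
                             (subst₂ (λ x y → x ≡ - y) (sym (scale-‼ u A e)) (sym (scale-‼ v B e))
                               (prove 2 (λ a b → ⊝ b ⊗ a ≐ ⊝ (a ⊗ b)) (A ‼ e) (B ‼ e)))
          s' = λ h → subst₂ (λ x y → Sum x y (Z ‼ h)) (scale-‼ u A h) (scale-‼ v B h) (s h)
      in Z , cZ ,
         van (λ h m → prove 5 (λ u v a b c → sum (u ⊗ a) (v ⊗ b) c ⇛ a ≐ 𝟎 ⇛ b ≐ 𝟎 ⇛ c ≐ 𝟎)
                        u v (A ‼ h) (B ‼ h) (Z ‼ h) (s' h) (at vA h m) (at vB h m)) ,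
         z , s'

  InCl : Subset n → Fin n → Set
  InCl S e = ∀ X → C X → Van X S → X ‼ e ≡ zer

  abstract
    witness? : ∀ S e → Dec (∃ λ X → C X × Van X S × X ‼ e ≢ zer)
    witness? S e = anyV? λ X → C? X ×-dec Van? X S ×-dec ¬? (X ‼ e ≟ₛ zer)

    cl? : ∀ S e → Dec (InCl S e)
    cl? S e with witness? S e
    ... | yes (X , c , v , h) = no λ f → h (f X c v)
    ... | no k = yes λ X c v → decidable-stable (X ‼ e ≟ₛ zer) (λ h → k (X , c , v , h))

    ∉cl⇒ : ∀ {S e} → ¬ InCl S e → ∃ λ X → C X × Van X S × X ‼ e ≢ zer
    ∉cl⇒ {S} {e} h = decidable-stable (witness? S e)
      (λ k → h λ X c v → decidable-stable (X ‼ e ≟ₛ zer) (λ q → k (X , c , v , q)))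

  ⇒∉cl : ∀ {X S e} → C X → Van X S → X ‼ e ≢ zer → ¬ InCl S e
  ⇒∉cl c v h f = h (f _ c v)

  -- R d S: the contraction by S has rank at most d.
  R : ℕ → Subset n → Set
  R zero    S = ∀ X → C X → Van X S → ∀ e → X ‼ e ≡ zer
  R (suc d) S = ∀ e → ¬ InCl S e → R d (S ⊕ e)

  abstract
    R? : ∀ d S → Dec (R d S)
    R? zero S = map′ (λ h X c v e → h e X c v) (λ h e X c v → h X c v e) (all? λ e → cl? S e)
    R? (suc d) S = all? λ e → ¬? (cl? S e) →-dec R? d (S ⊕ e)

  R-mono : ∀ d {S S'} → (∀ X → C X → Van X S' → Van X S) → R d S → R d S'
  R-mono zero    f r X c v = r X c (f X c v)
  R-mono (suc d) f r e h =
    R-mono d (λ X c v → van-⊕ (f X c (van-⊕ˡ v)) (van-⊕ʳ v)) (r e (λ k → h (λ X c v → k X c (f X c v))))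

  R-suc : ∀ d {S} → R d S → R (suc d) S
  R-suc zero    r e h = ⊥-elim (h (λ X c v → r X c v e))
  R-suc (suc d) r e h = R-suc d (r e h)

  abstract
    -- Eliminating e from X and a Y with Y x nonzero gives a vector with value X e · Y x at x, as X
    -- x = 0. It vanishes at e, hence at x, so X e = 0.
    exch : ∀ {S e x} → InCl (S ⊕ e) x → ¬ InCl S x → InCl (S ⊕ x) e
    exch {S} {e} {x} f h X c v with ∉cl⇒ h
    ... | Y , cY , vY , y with det X Y e c cY (van-⊕ˡ v) vY
    ... | Z , cZ , vZ , z , s =
      prove 5 (λ xe xx ye yx zx → yx ≠ 𝟎 ⇛ xx ≐ 𝟎 ⇛ zx ≐ 𝟎 ⇛ sum (⊝ ye ⊗ xx) (xe ⊗ yx) zx ⇛ xe ≐ 𝟎)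
        (X ‼ e) (X ‼ x) (Y ‼ e) (Y ‼ x) (Z ‼ x) y (van-⊕ʳ v) (f Z cZ (van-⊕ vZ z)) (s x)

    -- One element outside the closure suffices to bound the rank. Any other x is either
    -- interchangeable with e over S, or e stays outside the closure of S ⊕ x and the induction
    -- applies there.
    R-lower : ∀ d {S e} → ¬ InCl S e → R d (S ⊕ e) → R (suc d) S
    R-lower d {S} {e} h r x hx with cl? (S ⊕ e) x
    ... | yes k = R-mono d (λ X c v → van-⊕ (van-⊕ˡ v) (exch k hx X c v)) r
    ... | no k with d
    ... | zero  = ⊥-elim (k (λ X c v → r X c v x))
    ... | suc d = R-lower d (λ q → k (exch q h))
                    (R-mono d (λ X c v → van-⊕ (van-⊕ (van-⊕ˡ (van-⊕ˡ v)) (van-⊕ʳ v)) (van-⊕ʳ (van-⊕ˡ v))) (r x k))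

    -- `det X X' e` vanishes on S and at e, so in rank 1 it is zero, which is proportionality. The
    -- factor is zero if X' is.
    uniq : ∀ {S X X' e} → R 1 S → C X → C X' → Van X S → Van X' S → X ‼ e ≢ zer →
           ∃ λ v → ∀ h → X' ‼ h ≡ v · X ‼ h
    uniq {S} {X} {X'} {e} r c c' v v' q with det X X' e c c' v v'
    ... | Z , cZ , vZ , z , s = X' ‼ e · X ‼ e , λ h →
      prove 5 (λ xe xh ye yh zh → xe ≠ 𝟎 ⇛ zh ≐ 𝟎 ⇛ sum (⊝ ye ⊗ xh) (xe ⊗ yh) zh ⇛ yh ≐ ye ⊗ xe ⊗ xh)
        (X ‼ e) (X ‼ h) (X' ‼ e) (X' ‼ h) (Z ‼ h) q (r e (⇒∉cl c v q) Z cZ (van-⊕ vZ z) h) (s h)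

    uniq-nz : ∀ {S X X' e e'} → R 1 S → C X → C X' → Van X S → Van X' S → X ‼ e ≢ zer → X' ‼ e' ≢ zer →
              ∃ λ v → v ≢ zer × ∀ h → X' ‼ h ≡ v · X ‼ h
    uniq-nz {e' = e'} r c c' v v' q q' with uniq r c c' v v' q
    ... | w , p = w , (λ z → q' (trans (p e') (cong (_· _) z))) , p

  Coc : SignVec n → Set
  Coc X = Cocircuit C Full X

  abstract
    -- Together with `R-coc` this replaces minimality of the support by rank 1 of a contraction, the
    -- form in which cocircuits are used throughout.
    coc-R : ∀ {X} → Coc X → R 1 (zset X)
    coc-R {X} (c , _ , m) e h Y cY v with nonzero? Y
    ... | no k = ¬nonzero⇒ {X = Y} k
    ... | yes nz = ⊥-elim (h (λ W cW w → at w e (∈zset X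
                     (m Y cY nz (λ i z → at v i (x∈p∪q⁺ (inj₁ (∈zset X z)))) e (van-⊕ʳ v)))))

    R-coc : ∀ {X S} → C X → (∃ λ e → X ‼ e ≢ zer) → Van X S → R 1 S → Coc X
    R-coc {X} {S} c nz v r = c , nz , λ Y cY (e , y) z i q →
      let w , w≢ , p = uniq-nz r c cY v (van λ h m → z h (at v h m)) (proj₂ nz) y
      in prove 3 (λ w x y → w ≠ 𝟎 ⇛ y ≐ w ⊗ x ⇛ y ≐ 𝟎 ⇛ x ≐ 𝟎) w _ _ w≢ (p i) q

  -- Comparison with the rank of independent sets

  Indep : Subset n → Set
  Indep = Independent C Full

  card-empty : ∀ (I : Subset n) → ∣ I ∣ ≡ 0 → ∀ {X : SignVec n} → Van X I
  card-empty I q = van λ e m → contradiction (trans (sym (card-remove I e m)) q) λ ()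

  van-split : ∀ {I e} {X : SignVec n} → Van X ((I - e) ⊕ e) → Van X I
  van-split {I} {e} v = van λ h m → go h m (h ≟ᶠ e)
    where
    go : ∀ h → h ∈ I → Dec (h ≡ e) → _
    go h m (yes refl) = van-⊕ʳ v
    go h m (no k)     = at (van-⊕ˡ v) h (x∈p∧x≢y⇒x∈p-y m k)

  van-⊆ : ∀ {I J} {X : SignVec n} → J ⊆ I → Van X I → Van X J
  van-⊆ s v = van λ h m → at v h (s m)

  van-join : ∀ {I e} {X : SignVec n} → e ∈ I → Van X I → Van X ((I - e) ⊕ e)
  van-join {I} {e} m v = van-⊕ (van-⊆ (p─q⊆p I ⁅ e ⁆) v) (at v e m)

  indep-∉ : ∀ {I e} → Indep I → e ∈ I → ¬ InCl (I - e) e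
  indep-∉ (_ , h) m k = h _ m (∈⊤ , λ X c v → k X c (van v))

  indep-⊆ : ∀ {I J} → J ⊆ I → Indep I → Indep J
  indep-⊆ {I} {J} s (a , h) = (λ m → a (s m)) , λ e m (t , k) →
    h e (s m) (t , λ X c v → k X c (λ x q → v x
      (x∈p∧x≢y⇒x∈p-y (s (p─q⊆p J ⁅ e ⁆ q)) (λ { refl → x∉p-x J q }))))

  indep-remove : ∀ {I} e → Indep I → Indep (I - e)
  indep-remove {I} e = indep-⊆ (p─q⊆p I ⁅ e ⁆)

  indep-add : ∀ {I e} → Indep I → ¬ InCl I e → Indep (I ⊕ e)
  indep-add {I} {e} (a , h) k = (λ _ → ∈⊤) , go
    where
    go : ∀ x → x ∈ I ⊕ e → ¬ Cl C Full ((I ⊕ e) - x) x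
    go x m (_ , q) with x ≟ᶠ e
    ... | yes refl = k λ X c v → q X c λ y y∈ → case y y∈ (y ≟ᶠ x) v
      where
      case : ∀ y → y ∈ (I ⊕ x) - x → Dec (y ≡ x) → ∀ {X : SignVec n} → Van X I → X ‼ y ≡ zer
      case y y∈ (yes refl) v = ⊥-elim (x∉p-x (I ⊕ x) y∈)
      case y y∈ (no ne) v with x∈p∪q⁻ I ⁅ x ⁆ (p─q⊆p (I ⊕ x) ⁅ x ⁆ y∈)
      ... | inj₁ r = at v y r
      ... | inj₂ r = ⊥-elim (ne (x∈⁅y⁆⇒x≡y x r))
    ... | no ne with x∈p∪q⁻ I ⁅ e ⁆ m
    ... | inj₂ r = ne (x∈⁅y⁆⇒x≡y e r)
    ... | inj₁ r = k (λ X c v → exch (λ Y cY w → q Y cY (λ y y∈ → at (van-⊆ sub w) y y∈)) (indep-∉ (a , h) r) X c (van-join r v))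
      where
      sub : (I ⊕ e) - x ⊆ (I - x) ⊕ e
      sub {y} y∈ with x∈p∪q⁻ I ⁅ e ⁆ (p─q⊆p (I ⊕ e) ⁅ x ⁆ y∈)
      ... | inj₂ t = x∈p∪q⁺ (inj₂ t)
      ... | inj₁ t = x∈p∪q⁺ (inj₁ (x∈p∧x≢y⇒x∈p-y t (λ { refl → x∉p-x (I ⊕ e) y∈ })))

  -- `R` is only an upper bound, so what passes to I is the remainder of the given bound after m
  -- elements; that the bound is at least m is part of the result.
  R-indep : ∀ m I → ∣ I ∣ ≡ m → Indep I → ∀ {d} → R d ∅ → ∃ λ d' → d ≡ m + d' × R d' I
  R-indep zero    I q i {d} r = d , refl , R-mono d (λ X c v → van λ e m → ⊥-elim (∉⊥ m)) r
  R-indep (suc m) I q i {d₀} r =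
    let e , e∈ = card-nonempty I q
        d' , eq , r' = R-indep m (I - e) (suc-injective (trans (sym (card-remove I e e∈)) q)) (indep-remove e i) r
    in go e e∈ d' eq r'
    where
    go : ∀ e → e ∈ I → ∀ d' → d₀ ≡ m + d' → R d' (I - e) → ∃ λ d' → d₀ ≡ suc m + d' × R d' I
    go e e∈ zero    eq r' = ⊥-elim (indep-∉ i e∈ (λ X c v → r' X c v e))
    go e e∈ (suc d) eq r' = d , trans eq (+-suc m d) ,
      R-mono d (λ X c v → van-join e∈ v) (r' e (indep-∉ i e∈))

  indep-R : ∀ m I → ∣ I ∣ ≡ m → Indep I → ∀ d → R d I → R (m + d) ∅
  indep-R zero    I q i d r = R-mono d (λ X c v → card-empty I q) r
  indep-R (suc m) I q i d r =
    let e , e∈ = card-nonempty I q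
    in subst (λ k → R k ∅) (+-suc m d)
         (indep-R m (I - e) (suc-injective (trans (sym (card-remove I e e∈)) q)) (indep-remove e i) (suc d)
           (R-lower d (indep-∉ i e∈) (R-mono d (λ X c v → van-split v) r)))

  ∉I : ∀ {I e} → ¬ InCl I e → e ∉ I
  ∉I k m = k λ X c v → at v _ m

  basis-R : ∀ {k} → HasRank C Full Full k → R k ∅
  basis-R {k} (I , _ , i , q , mx) = subst (λ k → R k ∅) (trans (+-identityʳ _) q)
    (indep-R _ I refl i 0 λ X c v e → decidable-stable (X ‼ e ≟ₛ zer) λ x →
      let b = ⇒∉cl c v x in
      <-irrefl refl (≤-trans (≤-reflexive (sym (trans (card-add I e (∉I b)) (cong suc q)))) (mx (I ⊕ e) ⊆⊤ (indep-add i b))))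

  comodular-R : ∀ {X Y} → Comodular C Full X Y → R 2 (zset (X ∘ Y))
  comodular-R {X} {Y} (_ , _ , _ , _ , k , b , (J , J⊆ , j , q , _)) =
    let d , eq , r = R-indep k J q j (basis-R b)
    in R-mono 2 (λ Z c v → van-⊆ (λ m → proj₁ (x∈p∩q⁻ _ _ (J⊆ m))) v)
         (subst (λ k → R k J) (sym (+-cancelˡ-≡ k 2 d eq)) r)

  grow : ∀ F fuel I → Indep I → I ⊆ F → n ≤ ∣ I ∣ + fuel →
         ∃ λ J → J ⊆ F × Indep J × (∀ e → e ∈ F → InCl J e)
  grow F fuel I i s le with any? (λ e → (e ∈? F) ×-dec ¬? (cl? I e))
  ... | no k = I , s , i , λ e m → decidable-stable (cl? I e) (λ q → k (e , m , q))
  grow F zero I i s le | yes (e , m , q) = ⊥-elim (<-irrefl refl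
    (≤-trans (≤-reflexive (sym (card-add I e (∉I q)))) (≤-trans (∣p∣≤n (I ⊕ e)) (≤-trans le (≤-reflexive (+-identityʳ _))))))
  grow F (suc fuel) I i s le | yes (e , m , q) =
    grow F fuel (I ⊕ e) (indep-add i q) sub (≤-trans le (≤-reflexive (trans (+-suc ∣ I ∣ fuel) (cong (_+ fuel) (sym (card-add I e (∉I q)))))))
    where
    sub : I ⊕ e ⊆ F
    sub y with x∈p∪q⁻ I ⁅ e ⁆ y
    ... | inj₁ t = s t
    ... | inj₂ t = subst (_∈ F) (sym (x∈⁅y⁆⇒x≡y e t)) m

  -- `R 2` bounds the corank of z(X ∘ Y) by 2 from above. The element α bounds it from below, since
  -- in rank 1 the two cocircuits would be proportional, and it excludes X = Y and X = -Y.
  R-comodular : ∀ {X Y r α} → HasRank C Full Full r → Coc X → Coc Y → X ‼ α ≡ zer → Y ‼ α ≢ zer →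
                R 2 (zset (X ∘ Y)) → Comodular C Full X Y
  R-comodular {X} {Y} {r} {α} b cX cY x y r2 =
    cX , cY , (λ { refl → y x }) , (λ { refl → y (prove 1 (λ s → ⊝ s ≐ 𝟎 ⇛ s ≐ 𝟎) (Y ‼ α) (trans (sym (neg-‼ Y α)) x)) }) ,
    ∣ I ∣ , subst (HasRank C Full Full) r≡ b , (I , I⊆ , i , refl , max)
    where
    F = zset (X ∘ Y)
    F' = F ∩ Full
    ind∅ : Indep ∅
    ind∅ = (λ m → ⊥-elim (∉⊥ m)) , λ e m → ⊥-elim (∉⊥ m)
    G = grow F' n ∅ ind∅ (λ m → ⊥-elim (∉⊥ m)) (m≤n+m n _)
    I = proj₁ G
    I⊆ = proj₁ (proj₂ G)
    i = proj₁ (proj₂ (proj₂ G))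
    vI : ∀ Z → C Z → Van Z I → Van Z F
    vI Z c v = van λ e m → proj₂ (proj₂ (proj₂ G)) e (x∈p∩q⁺ (m , ∈⊤)) Z c v
    vF : ∀ {J} → J ⊆ F' → ∀ Z → C Z → Van Z F → Van Z J
    vF s Z c v = van λ e m → at v e (proj₁ (x∈p∩q⁻ _ _ (s m)))
    vX : Van X F
    vX = van λ e m → ∘ₛ-zeroˡ (X ‼ e) (Y ‼ e) (trans (sym (∘-‼ X Y e)) (zset∈ (X ∘ Y) m))
    vY : Van Y F
    vY = van λ e m → ∘ₛ-zeroʳ (X ‼ e) (Y ‼ e) (trans (sym (∘-‼ X Y e)) (zset∈ (X ∘ Y) m))
    ¬R1 : ¬ R 1 F
    ¬R1 r1 = let w , w≢ , p = uniq-nz r1 (proj₁ cX) (proj₁ cY) vX vY (proj₂ (proj₁ (proj₂ cX))) y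
             in y (trans (p α) (·-zero w x))
    2≤ : ∀ d → R d F → 2 ≤ d
    2≤ zero q = ⊥-elim (¬R1 (R-suc 0 q))
    2≤ (suc zero) q = ⊥-elim (¬R1 q)
    2≤ (suc (suc d)) q = s≤s (s≤s z≤n)
    total : R (∣ I ∣ + 2) ∅
    total = indep-R _ I refl i 2 (R-mono 2 vI r2)
    max : ∀ J → J ⊆ F' → Indep J → ∣ J ∣ ≤ ∣ I ∣
    max J s j = let d , eq , q = R-indep _ J refl j total
                in +-cancelʳ-≤ 2 _ _ (≤-trans (+-monoʳ-≤ ∣ J ∣ (2≤ d (R-mono d (vF s) q))) (≤-reflexive (sym eq)))
    r≡ : r ≡ ∣ I ∣ + 2
    r≡ = ≤-antisym
      (let B , _ , bi , bq , _ = b ; d , eq , q = R-indep r B bq bi total in ≤-trans (m≤m+n r d) (≤-reflexive (sym eq)))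
      (let d , eq , q = R-indep _ I refl i (basis-R b)
       in ≤-trans (+-monoʳ-≤ ∣ I ∣ (2≤ d (R-mono d (vF I⊆) q))) (≤-reflexive (sym eq)))

  -- A nonzero covector that is not a cocircuit has a nonzero covector with strictly larger zero set
  -- below it; m bounds the number of such descents.
  below : ∀ m X → C X → (∃ λ e → X ‼ e ≢ zer) → n ≤ ∣ zset X ∣ + m → ∃ Coc
  below m X c nz le with anyV? (λ Y → C? Y ×-dec nonzero? Y ×-dec Van? Y (zset X) ×-dec any? (λ e → (Y ‼ e ≟ₛ zer) ×-dec ¬? (X ‼ e ≟ₛ zer)))
  ... | no k = X , c , nz , λ Y cY nY z e y → decidable-stable (X ‼ e ≟ₛ zer)
               (λ x → k (Y , cY , nY , van (λ i m → z i (zset∈ X m)) , e , y , x))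
  ... | yes (Y , cY , nY , v , e , y , x) with m | p⊂q⇒∣p∣<∣q∣ {p = zset X} {zset Y} ((λ m → ∈zset Y (at v _ m)) , e , ∈zset Y y , λ m → x (zset∈ X m))
  ... | zero  | lt = ⊥-elim (<-irrefl refl (≤-trans lt (≤-trans (∣p∣≤n (zset Y)) (≤-trans le (≤-reflexive (+-identityʳ _))))))
  ... | suc m | lt = below m Y cY nY (≤-trans le (≤-trans (≤-reflexive (+-suc _ m)) (+-monoˡ-≤ m lt)))

  cocircuit-exists : ∀ {X} → C X → (∃ λ e → X ‼ e ≢ zer) → ∃ Coc
  cocircuit-exists {X} c nz = below n X c nz (m≤n+m n _)

-- Potentials of acyclic programs

next-inject₁ : ∀ {t} (j : Fin t) → next (inject₁ j) ≡ suc j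
next-inject₁ {suc t} zero = refl
next-inject₁ {suc t} (suc j) rewrite next-inject₁ {t} j = refl

next-fromℕ : ∀ t → next (fromℕ t) ≡ zero
next-fromℕ zero = refl
next-fromℕ (suc t) rewrite next-fromℕ t = refl

last-or-inject₁ : ∀ {t} (i : Fin (suc t)) → i ≡ fromℕ t ⊎ ∃ λ j → i ≡ inject₁ j
last-or-inject₁ {zero} zero = inj₁ refl
last-or-inject₁ {suc t} zero = inj₂ (zero , refl)
last-or-inject₁ {suc t} (suc i) with last-or-inject₁ i
... | inj₁ p = inj₁ (cong suc p)
... | inj₂ (j , p) = inj₂ (suc j , cong suc p)

-- The source of all constancy along a directed cycle: going round, each place is reached from every
-- other, so the relation holds in both directions.
cycle-const : ∀ {A : Set} {_⊑_ : A → A → Set} → (∀ {a} → a ⊑ a) → (∀ {a b c} → a ⊑ b → b ⊑ c → a ⊑ c) →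
              ∀ {t} (q : Fin (suc t) → A) → (∀ i → q i ⊑ q (next i)) → ∀ i j → q i ⊑ q j
cycle-const {_⊑_ = _⊑_} rfl trs {t} q h i j = trs (hi i) (trs top (lo j))
  where
  step : ∀ k → q (inject₁ k) ⊑ q (suc k)
  step k = subst (λ z → q (inject₁ k) ⊑ q z) (next-inject₁ k) (h (inject₁ k))
  top : q (fromℕ t) ⊑ q zero
  top = subst (λ z → q (fromℕ t) ⊑ q z) (next-fromℕ t) (h (fromℕ t))
  lo : ∀ i → q zero ⊑ q i
  lo = <-weakInduction (λ i → q zero ⊑ q i) rfl (λ k p → trs p (step k))
  hi : ∀ i → q i ⊑ q (fromℕ t)
  hi = >-weakInduction (λ i → q i ⊑ q (fromℕ t)) rfl (λ k p → trs (step k) p)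

module _ {A : Set} (_≟_ : ∀ (a b : A) → Dec (a ≡ b)) {E : A → A → Set} where

  Injective : ∀ {m} → Vec A m → Set
  Injective vs = ∀ i j → lookup vs i ≡ lookup vs j → i ≡ j

  data Path (c : A) : A → ∀ {m} → Vec A (suc m) → Set where
    stop : Path c c (c ∷ [])
    _then_ : ∀ {a b m} {vs : Vec A (suc m)} → E a b → Path c b vs → Path c a (a ∷ vs)

  SimplePath : A → A → Set
  SimplePath a c = ∃ λ m → Σ (Vec A (suc m)) λ vs → Path c a vs × Injective vs

  suffix : ∀ {a c m} {vs : Vec A (suc m)} → Path c a vs → Injective vs → ∀ i → SimplePath (lookup vs i) c
  suffix stop      inj zero    = _ , _ , stop , inj
  suffix (e then p)   inj zero    = _ , _ , e then p , inj
  suffix (e then p)   inj (suc i) = suffix p (λ k l q → sucᶠ-injective (inj (suc k) (suc l) q)) i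

  -- A directed cycle must have distinct vertices. If the start of a walk recurs, the suffix
  -- beginning at the recurrence replaces the walk.
  simplify : ∀ {a c} → Star E a c → SimplePath a c
  simplify nil = _ , _ , stop , λ { zero zero _ → refl }
  simplify {a} (e ◅ s) with simplify s
  ... | m , vs , p , inj with any? (λ i → lookup vs i ≟ a)
  ... | yes (i , refl) = suffix p inj i
  ... | no k = _ , a ∷ vs , e then p , λ { zero zero _ → refl ; zero (suc j) q → ⊥-elim (k (j , sym q))
                                      ; (suc i) zero q → ⊥-elim (k (i , q)) ; (suc i) (suc j) q → cong suc (inj i j q) }

  path-first : ∀ {a c m} {vs : Vec A (suc m)} → Path c a vs → lookup vs zero ≡ a
  path-first stop    = refl
  path-first (e then p) = refl

  path-last : ∀ {a c m} {vs : Vec A (suc m)} → Path c a vs → lookup vs (fromℕ m) ≡ c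
  path-last stop    = refl
  path-last (e then p) = path-last p

  path-edge : ∀ {a c m} {vs : Vec A (suc m)} → Path c a vs → ∀ j → E (lookup vs (inject₁ j)) (lookup vs (suc j))
  path-edge (e then p) zero    = subst (E _) (sym (path-first p)) e
  path-edge (e then p) (suc j) = path-edge p j

countV : ∀ {n} {P : SignVec n → Set} → (∀ X → Dec (P X)) → ℕ
countV {zero}  P? with P? []
... | yes _ = 1
... | no _  = 0
countV {suc n} P? = countV (λ X → P? (pos ∷ X)) + (countV (λ X → P? (neg ∷ X)) + countV (λ X → P? (zer ∷ X)))

countV-mono : ∀ {n} {P Q : SignVec n → Set} (P? : ∀ X → Dec (P X)) (Q? : ∀ X → Dec (Q X)) →
              (∀ X → P X → Q X) → countV P? ≤ countV Q?
countV-mono {zero} P? Q? h with P? [] | Q? []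
... | yes p | yes q = ≤-refl
... | yes p | no q = ⊥-elim (q (h [] p))
... | no p | _ = z≤n
countV-mono {suc n} P? Q? h = +-mono-≤ (countV-mono _ _ (λ X → h (pos ∷ X)))
  (+-mono-≤ (countV-mono _ _ (λ X → h (neg ∷ X))) (countV-mono _ _ (λ X → h (zer ∷ X))))

countV-strict : ∀ {n} {P Q : SignVec n → Set} (P? : ∀ X → Dec (P X)) (Q? : ∀ X → Dec (Q X)) →
                (∀ X → P X → Q X) → ∀ Z → Q Z → ¬ P Z → countV P? < countV Q?
countV-strict {zero} P? Q? h [] q p with P? [] | Q? []
... | yes p' | _ = ⊥-elim (p p')
... | no _ | yes _ = s≤s z≤n
... | no _ | no q' = ⊥-elim (q' q)
countV-strict {suc n} P? Q? h (pos ∷ Z) q p = +-mono-<-≤ (countV-strict _ _ (λ X → h (pos ∷ X)) Z q p)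
  (+-mono-≤ (countV-mono _ _ (λ X → h (neg ∷ X))) (countV-mono _ _ (λ X → h (zer ∷ X))))
countV-strict {suc n} P? Q? h (neg ∷ Z) q p = +-mono-≤-< (countV-mono _ _ (λ X → h (pos ∷ X)))
  (+-mono-<-≤ (countV-strict _ _ (λ X → h (neg ∷ X)) Z q p) (countV-mono _ _ (λ X → h (zer ∷ X))))
countV-strict {suc n} P? Q? h (zer ∷ Z) q p = +-mono-≤-< (countV-mono _ _ (λ X → h (pos ∷ X)))
  (+-mono-≤-< (countV-mono _ _ (λ X → h (neg ∷ X))) (countV-strict _ _ (λ X → h (zer ∷ X)) Z q p))

-- D is the sign of b - a.
Cmp : Sign → ℕ → ℕ → Set
Cmp D a b = (D ≡ pos → a < b) × (D ≡ zer → a ≡ b) × (D ≡ neg → b < a)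

cmp-pos : ∀ {D a b} → D ≡ pos → a < b → Cmp D a b
cmp-pos refl l = (λ _ → l) , (λ ()) , λ ()

cmp-neg : ∀ {D a b} → D ≡ neg → b < a → Cmp D a b
cmp-neg refl l = (λ ()) , (λ ()) , λ _ → l

cmp-zer : ∀ {D a b} → D ≡ zer → a ≡ b → Cmp D a b
cmp-zer refl l = (λ ()) , (λ _ → l) , λ ()

cmp-≡ : ∀ {D a b} → Cmp D a b → a ≡ b → D ≡ zer
cmp-≡ {pos} (h , _ , _) refl = ⊥-elim (<-irrefl refl (h refl))
cmp-≡ {neg} (_ , _ , h) refl = ⊥-elim (<-irrefl refl (h refl))
cmp-≡ {zer} _ _ = refl

separators : ∀ {n} → SignVec n → SignVec n → Subset n
separators X Y = tabulate λ e → does (¬? (X ‼ e ≟ₛ zer) ×-dec (X ‼ e ≟ₛ - (Y ‼ e)))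

∈separators : ∀ {n} (X Y : SignVec n) {e} → Sep X Y e → e ∈ separators X Y
∈separators X Y {e} s = lookup⇒[]= e _ (trans (lookup∘tabulate _ e) (dec-true (¬? (X ‼ e ≟ₛ zer) ×-dec (X ‼ e ≟ₛ - (Y ‼ e))) s))

separators∈ : ∀ {n} (X Y : SignVec n) {e} → e ∈ separators X Y → Sep X Y e
separators∈ X Y {e} m = holds (¬? (X ‼ e ≟ₛ zer) ×-dec (X ‼ e ≟ₛ - (Y ‼ e))) (trans (sym (lookup∘tabulate _ e)) ([]=⇒lookup m))
  where
  holds : ∀ {P : Set} (d : Dec P) → does d ≡ true → P
  holds (yes p) _ = p

-- Steps on lines of O

module Potential {n : ℕ} (C : CovSet n) (om : IsOM C) (C? : ∀ X → Dec (C X)) where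
  open OM C om C?

  -- T points from X to X' on their common line, at infinity with respect to x.
  record Step (x : Fin n) (X X' T : SignVec n) : Set where
    field
      S      : Subset n
      r2     : R 2 S
      cX     : Coc X
      cX'    : Coc X'
      cT     : C T
      vX     : Van X S
      vX'    : Van X' S
      vT     : Van T S
      α      : Fin n
      Xα     : X ‼ α ≡ zer
      X'α    : X' ‼ α ≢ zer
      Tα     : T ‼ α ≡ X' ‼ α
      Xx     : X ‼ x ≡ pos
      X'x    : X' ‼ x ≡ pos
      Tx     : T ‼ x ≡ zer

  -- `T ‼ y` is the sign of (y/x)(X') - (y/x)(X). Only pairs on a common line are constrained.
  IsPotential : Fin n → Fin n → (SignVec n → ℕ) → Set
  IsPotential x y φ = ∀ X X' T → Step x X X' T → Cmp (T ‼ y) (φ X) (φ X')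

  HasPotential : Fin n → Fin n → Set
  HasPotential x y = ∃ λ φ → IsPotential x y φ × ∃ λ N → ∀ X → φ X ≤ N

  module _ {x : Fin n} where

    -- T and `det X X' x` are both points of the line at x, hence proportional; their common value
    -- at α makes the factor positive.
    step-sum : ∀ {X X' T} → Step x X X' T → ∀ h → Sum (- (X ‼ h)) (X' ‼ h) (T ‼ h)
    step-sum {X} {X'} {T} st h =
      let open Step st
          Z , cZ , vZ , zx , s = det X X' x (proj₁ cX) (proj₁ cX') vX vX'
          T≢ = λ z → X'α (trans (sym Tα) z)
          w , p = uniq (r2 x (⇒∉cl (proj₁ cX) vX (pos≢ Xx))) cT cZ
                    (van-⊕ vT Tx) (van-⊕ vZ zx) T≢
          s' = λ h → subst₂ (λ a b → Sum (- b · X ‼ h) (a · X' ‼ h) (Z ‼ h)) Xx X'x (s h)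
          w≡ = prove 5 (λ xα x'α tα zα w → xα ≐ 𝟎 ⇛ x'α ≠ 𝟎 ⇛ tα ≐ x'α ⇛ zα ≐ w ⊗ tα ⇛ sum (⊝ xα) x'α zα ⇛ w ≐ 𝟏)
                 (X ‼ α) (X' ‼ α) (T ‼ α) (Z ‼ α) w Xα X'α Tα (p α) (s' α)
      in subst (Sum _ _) (trans (p h) (cong (_· T ‼ h) w≡)) (s' h)

    step-coc : ∀ {X X' T} → Step x X X' T → Coc T
    step-coc {T = T} st = let open Step st in
      R-coc cT (α , λ z → X'α (trans (sym Tα) z)) (van-⊕ vT Tx)
        (r2 x (⇒∉cl (proj₁ cX) vX (pos≢ Xx)))

    -- The reverse step needs an element at which X' vanishes and X does not. Without one the two
    -- cocircuits would be proportional, against α.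
    step-flip : ∀ {X X' T} → Step x X X' T → Step x X' X (scale neg T)
    step-flip {X} {X'} {T} st with any? (λ h → (X' ‼ h ≟ₛ zer) ×-dec ¬? (X ‼ h ≟ₛ zer))
    ... | no k = ⊥-elim (Step.X'α st (prove 3 (λ xα x'α w → xα ≐ w ⊗ x'α ⇛ xα ≐ 𝟎 ⇛ w ≠ 𝟎 ⇛ x'α ≐ 𝟎) (X ‼ α) (X' ‼ α) w (p α) Xα w≢))
      where
      open Step st
      W = uniq-nz (coc-R cX') (proj₁ cX') (proj₁ cX) (van-zset X')
            (van λ h m → decidable-stable (X ‼ h ≟ₛ zer) (λ q → k (h , zset∈ X' m , q))) X'α (pos≢ Xx)
      w = proj₁ W
      w≢ = proj₁ (proj₂ W)
      p = proj₂ (proj₂ W)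
    ... | yes (β , x'β , xβ) = record
      { S = S ; r2 = r2 ; cX = cX' ; cX' = cX ; cT = C-scale neg cT ; vX = vX' ; vX' = vX
      ; vT = van-scale neg vT
      ; α = β ; Xα = x'β ; X'α = xβ
      ; Tα = trans (scale-‼ neg T β) (prove 3 (λ a b c → sum (⊝ a) b c ⇛ b ≐ 𝟎 ⇛ ⊝ c ≐ a) (X ‼ β) (X' ‼ β) (T ‼ β) (step-sum st β) x'β)
      ; Xx = X'x ; X'x = Xx ; Tx = trans (scale-‼ neg T x) (cong -_ Tx) }
      where open Step st

    step-edge : ∀ {r X X' T} y → HasRank C Full Full r → Step x X X' T → Conformal X X' → EdgeLabel C Full x y X X' (T ‼ y)
    step-edge {r} {X} {X'} {T} y b st cf =
      (cX , Xx) , (cX' , X'x) , cf ,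
      R-comodular b cX cX' Xα X'α (R-mono 2 (λ Z c v → van λ e m → at v e (∈zset (X ∘ X') (trans (∘-‼ X X' e) (cong₂ _∘ₛ_ (at vX e m) (at vX' e m))))) r2) ,
      T , (step-coc st , Tx , λ h nz → pick h nz) , refl
      where
      open Step st
      pick : ∀ h → T ‼ h ≢ zer → T ‼ h ≡ negV X ‼ h ⊎ T ‼ h ≡ X' ‼ h
      pick h nz with T ‼ h ≟ₛ X' ‼ h
      ... | yes p = inj₂ p
      ... | no p = inj₁ (trans (prove 3 (λ a b c → sum (⊝ a) b c ⇛ c ≠ 𝟎 ⇛ c ≠ b ⇛ c ≐ ⊝ a) (X ‼ h) (X' ‼ h) (T ‼ h) (step-sum st h) nz p) (sym (neg-‼ X h)))

    -- A step decomposes into edges of the graph by eliminating separators of its ends.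
    step-induction : ∀ {r s} y → HasRank C Full Full r → (Q : SignVec n → SignVec n → Set) →
      (∀ {X Y Z} → Q X Y → Q Y Z → Q X Z) →
      (∀ X X' → EdgeLabel C Full x y X X' s → EdgeLabel C Full x y X' X (- s) → Q X X') →
      ∀ X X' T → Step x X X' T → T ‼ y ≡ s → Q X X'
    step-induction {r} {s} y b Q Qt Qe X X' T st Ty = go (suc n) X X' T st Ty (s≤s (∣p∣≤n (separators X X')))
      where
      go : ∀ fuel X X' T → Step x X X' T → T ‼ y ≡ s → ∣ separators X X' ∣ < fuel → Q X X'
      go zero X X' T st Ty ()
      go (suc fuel) X X' T st Ty (s≤s le)
        with any? (λ e → ¬? (X ‼ e ≟ₛ zer) ×-dec (X ‼ e ≟ₛ - (X' ‼ e)))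
      ... | no k = Qe X X' (subst (EdgeLabel C Full x y X X') Ty (step-edge y b st (λ e q → k (e , q))))
                     (subst (EdgeLabel C Full x y X' X) (trans (scale-‼ neg T y) (cong -_ Ty))
                       (step-edge y b (step-flip st) (λ e q → k (e , prove 2 (λ a b → (b ≠ 𝟎) ⋏ (b ≐ ⊝ a) ⇛ (a ≠ 𝟎) ⋏ (a ≐ ⊝ b)) (X ‼ e) (X' ‼ e) q))))
      ... | yes (e , nz , op) = Qt (go fuel X M T left Ty (≤-trans (p⊂q⇒∣p∣<∣q∣ sub₁) le))
                                   (go fuel M X' T right Ty (≤-trans (p⊂q⇒∣p∣<∣q∣ sub₂) le))
        where
        open Step st
        -- The point M of the line at e lies between X and X'. It has fewer separators with each of
        -- them, and T remains the direction of both halves.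
        A = add X X' e (proj₁ cX) (proj₁ cX') op
        M = proj₁ A
        cM = proj₁ (proj₂ A)
        Me = proj₁ (proj₂ (proj₂ A))
        Ms = proj₂ (proj₂ (proj₂ A))
        vM : Van M S
        vM = van λ h m → trans (proj₁ (Ms h) (at vX h m)) (at vX' h m)
        Mx : M ‼ x ≡ pos
        Mx = prove 3 (λ a b c → sum a b c ⇛ a ≐ 𝟏 ⇛ b ≐ 𝟏 ⇛ c ≐ 𝟏) (X ‼ x) (X' ‼ x) (M ‼ x) (Ms x) Xx X'x
        Mα : M ‼ α ≡ X' ‼ α
        Mα = proj₁ (Ms α) Xα
        rM : Coc M
        rM = R-coc cM (x , pos≢ Mx) (van-⊕ vM Me) (r2 e (⇒∉cl (proj₁ cX) vX nz))
        -- If T vanished at e it would be proportional to M, but T is zero at x while M is positive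
        -- there.
        Te : T ‼ e ≡ X' ‼ e
        Te with T ‼ e ≟ₛ zer
        ... | no tz = prove 3 (λ a b c → sum (⊝ a) b c ⇛ a ≐ ⊝ b ⇛ c ≐ b) (X ‼ e) (X' ‼ e) (T ‼ e) (step-sum st e) op
        ... | yes tz = let w , w≢ , p = uniq-nz (r2 e (⇒∉cl (proj₁ cX) vX nz)) cT cM (van-⊕ vT tz) (van-⊕ vM Me) (λ z → X'α (trans (sym Tα) z)) (pos≢ Mx)
                       in ⊥-elim (prove 3 (λ w t m → m ≐ w ⊗ t ⇛ t ≐ 𝟎 ⇛ m ≐ 𝟏 ⇛ ff) w (T ‼ x) (M ‼ x) (p x) Tx Mx)
        left : Step x X M T
        left = record { S = S ; r2 = r2 ; cX = cX ; cX' = rM ; cT = cT ; vX = vX ; vX' = vM ; vT = vT ; α = α ; Xα = Xα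
                      ; X'α = λ z → X'α (trans (sym Mα) z) ; Tα = trans Tα (sym Mα) ; Xx = Xx ; X'x = Mx ; Tx = Tx }
        right : Step x M X' T
        right = record { S = S ; r2 = r2 ; cX = rM ; cX' = cX' ; cT = cT ; vX = vM ; vX' = vX' ; vT = vT ; α = e ; Xα = Me
                       ; X'α = λ z → nz (trans op (cong -_ z)) ; Tα = Te ; Xx = Mx ; X'x = X'x ; Tx = Tx }
        inXX' : e ∈ separators X X'
        inXX' = ∈separators X X' (nz , op)
        sub₁ : (separators X M ⊆ separators X X') × ∃ λ h → h ∈ separators X X' × ¬ h ∈ separators X M
        sub₁ = (λ {h} m → ∈separators X X' (prove 3 (λ a b c → sum a b c ⇛ (a ≠ 𝟎) ⋏ (a ≐ ⊝ c) ⇛ (a ≠ 𝟎) ⋏ (a ≐ ⊝ b)) (X ‼ h) (X' ‼ h) (M ‼ h) (Ms h) (separators∈ X M m))) ,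
               e , inXX' , λ m → nz (trans (proj₂ (separators∈ X M m)) (cong -_ Me))
        sub₂ : (separators M X' ⊆ separators X X') × ∃ λ h → h ∈ separators X X' × ¬ h ∈ separators M X'
        sub₂ = (λ {h} m → ∈separators X X' (prove 3 (λ a b c → sum a b c ⇛ (c ≠ 𝟎) ⋏ (c ≐ ⊝ b) ⇛ (a ≠ 𝟎) ⋏ (a ≐ ⊝ b)) (X ‼ h) (X' ‼ h) (M ‼ h) (Ms h) (separators∈ M X' m))) ,
               e , inXX' , λ m → proj₁ (separators∈ M X' m) Me

  module _ {r : ℕ} (b : HasRank C Full Full r) {x y : Fin n} where

    Weak : SignVec n → SignVec n → Set
    Weak = ForwardOrUndirected C Full x y

    cycle-of : ∀ {X X'} → Star Weak X' X → Forward C Full x y X X' → DirectedCycle C Full x y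
    cycle-of {X} {X'} s fw with simplify (≡-dec _≟ₛ_) s
    ... | m , vs , p , inj = m , lookup vs , inj , edge , fromℕ m , back
      where
      back : Forward C Full x y (lookup vs (fromℕ m)) (lookup vs (next (fromℕ m)))
      back = subst₂ (Forward C Full x y) (sym (path-last _ p)) (sym (trans (cong (lookup vs) (next-fromℕ m)) (path-first _ p))) fw
      edge : ∀ i → Weak (lookup vs i) (lookup vs (next i))
      edge i with last-or-inject₁ i
      ... | inj₁ refl = inj₁ back
      ... | inj₂ (j , refl) = subst (λ z → Weak (lookup vs (inject₁ j)) (lookup vs z)) (sym (next-inject₁ j)) (path-edge _ p j)

    euclidean⇒potential : ¬ DirectedCycle C Full x y → ¬ ¬ HasPotential x y
    euclidean⇒potential ac k =
      ¬¬-∀V (λ X → ¬¬-∀V (λ Z → ¬¬-excluded-middle {A = Star Weak Z X})) λ reach? →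
      k ((λ X → countV (reach? X)) ,
         (λ X X' T st →
           (λ q → step-induction y b (λ X X' → countV (reach? X) < countV (reach? X')) <-trans
             -- Whatever reaches X reaches X' over the forward edge, whereas X' itself cannot reach
             -- X without closing a directed cycle.
             (λ X X' e _ → countV-strict (reach? X) (reach? X') (λ Z s → s ◅◅ (inj₁ e ◅ nil)) X' nil (λ s → ac (cycle-of s e))) X X' T st q) ,
           (λ q → step-induction y b (λ X X' → countV (reach? X) ≡ countV (reach? X')) trans
             (λ X X' e e' → ≤-antisym (countV-mono (reach? X) (reach? X') (λ Z s → s ◅◅ _◅_ {T = Weak} (inj₂ e) nil)) (countV-mono (reach? X') (reach? X) (λ Z s → s ◅◅ _◅_ {T = Weak} (inj₂ e') nil))) X X' T st q) ,
           (λ q → step-induction y b (λ X X' → countV (reach? X) < countV (reach? X')) <-trans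
             (λ X X' e _ → countV-strict (reach? X) (reach? X') (λ Z s → s ◅◅ (inj₁ e ◅ nil)) X' nil (λ s → ac (cycle-of s e))) X' X (scale neg T) (step-flip st) (trans (scale-‼ neg T y) (cong -_ q)))) ,
         -- The number of all sign vectors bounds every count; `potential-swap` reverses the order
         -- by subtracting from it.
         countV {n} {λ _ → ⊤} (λ _ → yes tt) , λ X → countV-mono {Q = λ _ → ⊤} (reach? X) (λ _ → yes tt) (λ _ _ → tt))

  -- Exchanging the two elements of a program reverses the order of slopes within each sign class.
  potential-swap : ∀ {x y} → HasPotential x y → HasPotential y x
  potential-swap {x} {y} (φ , isφ , N , bd) = (λ X → ψ (X ‼ x) X) , (λ X X' T st → go X X' T st (X ‼ x) (X' ‼ x) refl refl) ,
    suc (suc N) + N , λ X → bound (X ‼ x) X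
    where
    -- The sign classes of x occupy disjoint ranges: at most N for `neg`, N + 1 for `zer`, at least
    -- N + 2 for `pos`. Within a nonzero class the order of φ is reversed.
    ψ : Sign → SignVec n → ℕ
    ψ zer X = suc N
    ψ pos X = suc (suc N) + (N ∸ φ (scale pos X))
    ψ neg X = N ∸ φ (scale neg X)
    bound : ∀ s X → ψ s X ≤ suc (suc N) + N
    bound pos X = +-monoʳ-≤ (suc (suc N)) (m∸n≤m N (φ (scale pos X)))
    bound neg X = ≤-trans (m∸n≤m N (φ (scale neg X))) (m≤n+m N (suc (suc N)))
    bound zer X = ≤-trans (n≤1+n _) (m≤m+n (suc (suc N)) N)
    low : ∀ X → ψ neg X < suc N
    low X = s≤s (m∸n≤m N (φ (scale neg X)))
    high : ∀ X → suc N < ψ pos X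
    high X = m≤m+n (suc (suc N)) _
    same : ∀ X X' T σ → Step y X X' T → X ‼ x ≡ σ → X' ‼ x ≡ σ → σ ≢ zer →
           Cmp (T ‼ x) (N ∸ φ (scale σ X)) (N ∸ φ (scale σ X'))
    same X X' T σ st p p' σ≢ = flip (isφ (scale σ X) (scale σ X') Z st')
      where
      open Step st
      D = det X X' x (proj₁ cX) (proj₁ cX') vX vX'
      Z = proj₁ D
      cZ = proj₁ (proj₂ D)
      vZ = proj₁ (proj₂ (proj₂ D))
      Zx = proj₁ (proj₂ (proj₂ (proj₂ D)))
      Zs : ∀ h → Sum (- σ · X ‼ h) (σ · X' ‼ h) (Z ‼ h)
      Zs h = subst₂ (λ a b → Sum (- b · X ‼ h) (a · X' ‼ h) (Z ‼ h)) p p' (proj₂ (proj₂ (proj₂ (proj₂ D))) h)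
      Zα : Z ‼ α ≡ σ · X' ‼ α
      Zα = prove 4 (λ σ a b z → sum (⊝ σ ⊗ a) (σ ⊗ b) z ⇛ a ≐ 𝟎 ⇛ z ≐ σ ⊗ b) σ (X ‼ α) (X' ‼ α) (Z ‼ α) (Zs α) Xα
      cocσ : ∀ {A e} → Coc A → A ‼ e ≢ zer → Coc (scale σ A)
      cocσ {A} {e} c q = R-coc (C-scale σ (proj₁ c)) (e , λ z → nz· σ≢ q (trans (sym (scale-‼ σ A e)) z))
        (van-scale σ (van-zset A)) (coc-R c)
      st' : Step x (scale σ X) (scale σ X') Z
      st' = record { S = S ; r2 = r2 ; cX = cocσ cX (pos≢ Xx) ; cX' = cocσ cX' X'α ; cT = cZ ; vX = van-scale σ vX ; vX' = van-scale σ vX' ; vT = vZ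
                   ; α = α ; Xα = trans (scale-‼ σ X α) (·-zero σ Xα)
                   ; X'α = λ z → nz· σ≢ X'α (trans (sym (scale-‼ σ X' α)) z) ; Tα = trans Zα (sym (scale-‼ σ X' α))
                   ; Xx = trans (scale-‼ σ X x) (prove 2 (λ s a → s ≠ 𝟎 ⇛ a ≐ s ⇛ s ⊗ a ≐ 𝟏) σ (X ‼ x) σ≢ p)
                   ; X'x = trans (scale-‼ σ X' x) (prove 2 (λ s a → s ≠ 𝟎 ⇛ a ≐ s ⇛ s ⊗ a ≐ 𝟏) σ (X' ‼ x) σ≢ p') ; Tx = Zx }
      -- U vanishes at α, so it is a multiple of X. Its values at y, where T vanishes, and at x,
      -- where Z vanishes, give Z y = - T x.
      U = det T Z α cT cZ vT vZ
      Us = proj₂ (proj₂ (proj₂ (proj₂ U)))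
      W = uniq {e = y} (r2 α (⇒∉cl (proj₁ cX') vX' X'α)) (proj₁ cX) (proj₁ (proj₂ U)) (van-⊕ vX Xα)
            (van-⊕ (proj₁ (proj₂ (proj₂ U))) (proj₁ (proj₂ (proj₂ (proj₂ U))))) (pos≢ Xx)
      w = proj₁ W
      at-y : X' ‼ α · Z ‼ y ≡ w
      at-y = prove 7 (λ q ta za ty zy u w → sum (⊝ za ⊗ ty) (ta ⊗ zy) u ⇛ ty ≐ 𝟎 ⇛ ta ≐ q ⇛ u ≐ w ⇛ q ⊗ zy ≐ w)
               (X' ‼ α) (T ‼ α) (Z ‼ α) (T ‼ y) (Z ‼ y) (proj₁ U ‼ y) w (Us y) Tx Tα
               (trans (proj₂ W y) (trans (cong (w ·_) Xx) (prove 1 (λ w → w ⊗ 𝟏 ≐ w) w)))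
      at-x : - (X' ‼ α) · T ‼ x ≡ w
      at-x = prove 8 (λ q s ta za tx zx u w → sum (⊝ za ⊗ tx) (ta ⊗ zx) u ⇛ zx ≐ 𝟎 ⇛ za ≐ s ⊗ q ⇛ u ≐ w ⊗ s ⇛ s ≠ 𝟎 ⇛ ⊝ q ⊗ tx ≐ w)
               (X' ‼ α) σ (T ‼ α) (Z ‼ α) (T ‼ x) (Z ‼ x) (proj₁ U ‼ x) w (Us x) Zx Zα
               (trans (proj₂ W x) (cong (w ·_) p)) σ≢
      opp : Z ‼ y ≡ - (T ‼ x)
      opp = prove 4 (λ q t z w → q ≠ 𝟎 ⇛ q ⊗ z ≐ w ⇛ ⊝ q ⊗ t ≐ w ⇛ z ≐ ⊝ t) (X' ‼ α) (T ‼ x) (Z ‼ y) w X'α at-y at-x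
      flip : Cmp (Z ‼ y) (φ (scale σ X)) (φ (scale σ X')) → Cmp (T ‼ x) (N ∸ φ (scale σ X)) (N ∸ φ (scale σ X'))
      flip (a , b , c) =
        (λ q → ∸-monoʳ-< (c (trans opp (cong -_ q))) (bd _)) ,
        (λ q → cong (N ∸_) (b (trans opp (cong -_ q)))) ,
        (λ q → ∸-monoʳ-< (a (trans opp (cong -_ q))) (bd _))
    shift : ∀ {D a b} → Cmp D a b → Cmp D (suc (suc N) + a) (suc (suc N) + b)
    shift (a , b , c) = (λ q → +-monoʳ-< (suc (suc N)) (a q)) , (λ q → cong (suc (suc N) +_) (b q)) , λ q → +-monoʳ-< (suc (suc N)) (c q)
    go : ∀ X X' T → Step y X X' T → ∀ s s' → X ‼ x ≡ s → X' ‼ x ≡ s' → Cmp (T ‼ x) (ψ s X) (ψ s' X')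
    go X X' T st s s' p p' with subst₂ (λ a b → Sum (- a) b (T ‼ x)) p p' (step-sum st x)
    go X X' T st pos pos p p' | _ = shift (same X X' T pos st p p' λ ())
    go X X' T st neg neg p p' | _ = same X X' T neg st p p' λ ()
    go X X' T st pos neg p p' | _ , _ , q = cmp-neg (q refl) (<-trans (low X') (high X))
    go X X' T st pos zer p p' | _ , q , _ = cmp-neg (q refl) (high X)
    go X X' T st neg pos p p' | _ , _ , q = cmp-pos (q refl) (<-trans (low X) (high X'))
    go X X' T st neg zer p p' | _ , q , _ = cmp-pos (q refl) (low X)
    go X X' T st zer pos p p' | q , _ , _ = cmp-pos (q refl) (high X')
    go X X' T st zer neg p p' | q , _ , _ = cmp-neg (q refl) (low X')
    go X X' T st zer zer p p' | q , _ , _ = cmp-zer (q refl) refl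

-- Chirotopes of contractions of rank 2 and 3

module Chirotope {n : ℕ} (C : CovSet n) (om : IsOM C) (C? : ∀ X → Dec (C X)) where
  open OM C om C?

  abstract
    parallel : ∀ {S x₀ x} → InCl (S ⊕ x₀) x → ¬ InCl S x₀ → ∃ λ μ → ∀ X → C X → Van X S → X ‼ x ≡ μ · X ‼ x₀
    parallel {S} {x₀} {x} k h with ∉cl⇒ h
    ... | K , cK , vK , q = K ‼ x · K ‼ x₀ , λ X c v →
      let Z , cZ , vZ , z , s = det K X x₀ cK c vK v
      in prove 5 (λ k0 kx a0 ax z → k0 ≠ 𝟎 ⇛ z ≐ 𝟎 ⇛ sum (⊝ a0 ⊗ kx) (k0 ⊗ ax) z ⇛ ax ≐ kx ⊗ k0 ⊗ a0)
           (K ‼ x₀) (K ‼ x) (X ‼ x₀) (X ‼ x) (Z ‼ x) q (k Z cZ (van-⊕ vZ z)) (s x)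

  -- A rank 2 chirotope given by its rows: T x is the oriented point of the line at x, and the
  -- bracket [x y] is `T x ‼ y`.
  record Line (S : Subset n) : Set where
    field
      T    : Fin n → SignVec n
      cT   : ∀ x → C (T x)
      vT   : ∀ x → Van (T x) S
      anti : ∀ x y → T x ‼ y ≡ - (T y ‼ x)
      nz   : ∀ x → ¬ InCl S x → ∃ λ y → T x ‼ y ≢ zer

  ¬R0⇒ : ∀ {S} → ¬ R 0 S → ∃ λ X → C X × Van X S × ∃ λ e → X ‼ e ≢ zer
  ¬R0⇒ {S} k = decidable-stable (anyV? λ X → C? X ×-dec Van? X S ×-dec nonzero? X)
    (λ h → k λ X c v e → decidable-stable (X ‼ e ≟ₛ zer) (λ q → h (X , c , v , e , q)))

  ¬R1⇒ : ∀ {S} → ¬ R 1 S → ∃ λ e → ¬ InCl S e × ¬ R 0 (S ⊕ e)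
  ¬R1⇒ {S} k = decidable-stable (any? λ e → ¬? (cl? S e) ×-dec ¬? (R? 0 (S ⊕ e)))
    (λ h → k λ e q → decidable-stable (R? 0 (S ⊕ e)) (λ p → h (e , q , p)))

  -- T x has the signs of A(x) B - B(x) A. Since elimination leaves some of these signs open,
  -- antisymmetry needs an argument when A x and A y are nonzero: eliminating α from T x and T y
  -- yields a multiple of A, which is read at x and at y.
  line′ : ∀ {S} → R 2 S → ¬ R 1 S → Line S
  line′ {S} r2 k with ¬R1⇒ k
  ... | α , α∉ , k' with ∉cl⇒ α∉ | ¬R0⇒ k'
  ... | B , cB , vB , Bα | A , cA , vA⊕ , β , Aβ = record
    { T = T ; cT = λ x → proj₁ (proj₂ (D x)) ; vT = vT ; anti = anti ; nz = nz }
    where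
    vA = van-⊕ˡ vA⊕
    Aα = van-⊕ʳ vA⊕
    D = λ x → det A B x cA cB vA vB
    T = λ x → proj₁ (D x)
    cT = λ x → proj₁ (proj₂ (D x))
    vT = λ x → proj₁ (proj₂ (proj₂ (D x)))
    Ts = λ x → proj₂ (proj₂ (proj₂ (proj₂ (D x))))
    Tα : ∀ x → T x ‼ α ≡ A ‼ x · B ‼ α
    Tα x = prove 5 (λ ax bx aα bα t → sum (⊝ bx ⊗ aα) (ax ⊗ bα) t ⇛ aα ≐ 𝟎 ⇛ t ≐ ax ⊗ bα)
             (A ‼ x) (B ‼ x) (A ‼ α) (B ‼ α) (T x ‼ α) (Ts x α) Aα
    anti : ∀ x y → T x ‼ y ≡ - (T y ‼ x)
    anti x y with A ‼ x ≟ₛ zer | A ‼ y ≟ₛ zer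
    ... | yes a | _ = prove 6 (λ ax bx ay by s t → sum (⊝ bx ⊗ ay) (ax ⊗ by) s ⇛ sum (⊝ by ⊗ ax) (ay ⊗ bx) t ⇛ ax ≐ 𝟎 ⇛ s ≐ ⊝ t)
                        (A ‼ x) (B ‼ x) (A ‼ y) (B ‼ y) (T x ‼ y) (T y ‼ x) (Ts x y) (Ts y x) a
    ... | no _ | yes a = prove 6 (λ ax bx ay by s t → sum (⊝ bx ⊗ ay) (ax ⊗ by) s ⇛ sum (⊝ by ⊗ ax) (ay ⊗ bx) t ⇛ ay ≐ 𝟎 ⇛ s ≐ ⊝ t)
                        (A ‼ x) (B ‼ x) (A ‼ y) (B ‼ y) (T x ‼ y) (T y ‼ x) (Ts x y) (Ts y x) a
    ... | no ax | no ay =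
      let U , cU , vU , Uα , Us = det (T x) (T y) α (cT x) (cT y) (vT x) (vT y)
          w , p = uniq (r2 α α∉) cA cU vA⊕ (van-⊕ vU Uα) Aβ
          atx : (A ‼ x · B ‼ α) · T y ‼ x ≡ w · A ‼ x
          atx = prove 6 (λ tα t'α txx t'x u r → sum (⊝ t'α ⊗ txx) (tα ⊗ t'x) u ⇛ txx ≐ 𝟎 ⇛ u ≐ r ⇛ tα ⊗ t'x ≐ r)
                 (A ‼ x · B ‼ α) (A ‼ y · B ‼ α) (T x ‼ x) (T y ‼ x) (U ‼ x) (w · A ‼ x)
                 (subst₂ (λ a b → Sum (- b · T x ‼ x) (a · T y ‼ x) (U ‼ x)) (Tα x) (Tα y) (Us x)) (proj₁ (proj₂ (proj₂ (proj₂ (D x))))) (p x)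
          aty : - (A ‼ y · B ‼ α) · T x ‼ y ≡ w · A ‼ y
          aty = prove 6 (λ tα t'α txy t'y u r → sum (⊝ t'α ⊗ txy) (tα ⊗ t'y) u ⇛ t'y ≐ 𝟎 ⇛ u ≐ r ⇛ ⊝ t'α ⊗ txy ≐ r)
                 (A ‼ x · B ‼ α) (A ‼ y · B ‼ α) (T x ‼ y) (T y ‼ y) (U ‼ y) (w · A ‼ y)
                 (subst₂ (λ a b → Sum (- b · T x ‼ y) (a · T y ‼ y) (U ‼ y)) (Tα x) (Tα y) (Us y)) (proj₁ (proj₂ (proj₂ (proj₂ (D y))))) (p y)
      in prove 6 (λ ax ay b s t w → ax ≠ 𝟎 ⇛ ay ≠ 𝟎 ⇛ b ≠ 𝟎 ⇛ (ax ⊗ b) ⊗ t ≐ w ⊗ ax ⇛ ⊝ (ay ⊗ b) ⊗ s ≐ w ⊗ ay ⇛ s ≐ ⊝ t)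
           (A ‼ x) (A ‼ y) (B ‼ α) (T x ‼ y) (T y ‼ x) w ax ay Bα atx aty
    nz : ∀ x → ¬ InCl S x → ∃ λ y → T x ‼ y ≢ zer
    nz x h with A ‼ x ≟ₛ zer | B ‼ x ≟ₛ zer
    ... | no a | _ = α , λ z → prove 2 (λ a b → a ≠ 𝟎 ⇛ b ≠ 𝟎 ⇛ a ⊗ b ≐ 𝟎 ⇛ ff) (A ‼ x) (B ‼ α) a Bα (trans (sym (Tα x)) z)
    ... | yes a | no b = β , λ z → prove 5 (λ ax bx aβ bβ t → sum (⊝ bx ⊗ aβ) (ax ⊗ bβ) t ⇛ ax ≐ 𝟎 ⇛ bx ≠ 𝟎 ⇛ aβ ≠ 𝟎 ⇛ t ≐ 𝟎 ⇛ ff)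
                        (A ‼ x) (B ‼ x) (A ‼ β) (B ‼ β) (T x ‼ β) (Ts x β) a b Aβ z
    ... | yes a | yes b =
      let w , p = uniq (r2 x h) cA cB (van-⊕ vA a) (van-⊕ vB b) Aβ
      in ⊥-elim (Bα (trans (p α) (·-zero w Aα)))

  abstract
    line : ∀ {S} → R 2 S → ¬ R 1 S → Line S
    line = line′

  -- A rank 3 chirotope modulo F: V x y is the oriented intersection of x and y, and it is zero when
  -- they are dependent.
  record Plane (F : Subset n) : Set where
    field
      V      : Fin n → Fin n → SignVec n
    χ : Fin n → Fin n → Fin n → Sign
    χ x y z = V x y ‼ z
    field
      cV     : ∀ x y → C (V x y)
      vV     : ∀ x y → Van (V x y) F
      anti12 : ∀ x y z → χ x y z ≡ - χ y x z
      anti23 : ∀ x y z → χ x y z ≡ - χ x z y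
      nz     : ∀ x y → ¬ InCl F x → ¬ InCl (F ⊕ x) y → ∃ λ z → χ x y z ≢ zer
      rank1  : ∀ x y w → χ x y w ≢ zer → R 1 (F ⊕ x ⊕ y)
    cyc : ∀ x y z → χ x y z ≡ χ y z x
    cyc x y z = trans (anti12 x y z) (trans (cong -_ (anti23 y x z)) (neg-neg _))
    rev : ∀ x y z → χ x y z ≡ - χ z y x
    rev x y z = trans (cyc x y z) (trans (anti12 y z x) refl)
    χ-left : ∀ x y → χ x y x ≡ zer
    χ-left x y = self-opposite (rev x y x)
    χ-right : ∀ x y → χ x y y ≡ zer
    χ-right x y = self-opposite (anti23 x y y)
    point : ∀ {X x y w} → C X → Van X F → X ‼ x ≡ zer → X ‼ y ≡ zer → χ x y w ≢ zer → ∃ λ v → ∀ z → X ‼ z ≡ v · χ x y z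
    point {X} {x} {y} {w} c v p q h = uniq (rank1 x y w h) (cV x y) c
      (van-⊕ (van-⊕ (vV x y) (χ-left x y)) (χ-right x y)) (van-⊕ (van-⊕ v p) q) h

  -- The row of x is a chirotope of the line at x, whose orientation is free. The reference element
  -- x₀ fixes it by [x x₀ z] = -[x₀ x z]; the work lies in deriving antisymmetry in the first two
  -- arguments from this one normalization.
  plane′ : ∀ {F x₀} → R 3 F → ¬ R 2 F → ¬ InCl F x₀ → Plane F
  plane′ {F} {x₀} r3 k x₀∉ = record
    { V = V ; cV = λ x → cR (row x) ; vV = λ x → vR (row x) ; anti12 = anti12 ; anti23 = anti23
    ; nz = λ x → nzR (row x) ; rank1 = rank1 }
    where
    ln : ∀ x → ¬ InCl F x → Line (F ⊕ x)
    ln x h = line (r3 x h) (λ q → k (R-lower 1 h q))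
    L₀ = ln x₀ x₀∉
    T₀ = Line.T L₀
    antiL : ∀ {S} (L : Line S) x y → Line.T L x ‼ y ≡ - (Line.T L y ‼ x)
    antiL = Line.anti
    T₀x₀ : ∀ y → T₀ y ‼ x₀ ≡ zer
    T₀x₀ y = van-⊕ʳ (Line.vT L₀ y)
    record Row (x : Fin n) : Set where
      field
        U     : Fin n → SignVec n
        cR    : ∀ y → C (U y)
        vR    : ∀ y → Van (U y) F
        zR    : ∀ y → U y ‼ x ≡ zer
        antiR : ∀ y z → U y ‼ z ≡ - (U z ‼ y)
        nzR   : ∀ y → ¬ InCl F x → ¬ InCl (F ⊕ x) y → ∃ λ z → U y ‼ z ≢ zer
        baseR : ∀ z → U x₀ ‼ z ≡ - (T₀ x ‼ z)
        parR  : InCl (F ⊕ x₀) x → ∃ λ μ → (∀ y z → U y ‼ z ≡ μ · T₀ y ‼ z) × ∀ X → C X → Van X F → X ‼ x ≡ μ · X ‼ x₀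
    open Row
    scaled-anti : ∀ u {S} (L : Line S) y z → scale u (Line.T L y) ‼ z ≡ - (scale u (Line.T L z) ‼ y)
    scaled-anti u L y z = trans (scale-‼ u (Line.T L y) z) (trans (trans (cong (u ·_) (antiL L y z))
      (prove 2 (λ u a → u ⊗ ⊝ a ≐ ⊝ (u ⊗ a)) u (Line.T L z ‼ y))) (cong -_ (sym (scale-‼ u (Line.T L z) y))))
    scaled-nz : ∀ {u} {X : SignVec n} → u ≢ zer → (∃ λ z → X ‼ z ≢ zer) → ∃ λ z → scale u X ‼ z ≢ zer
    scaled-nz {u} {X} h (z , q) = z , λ p → prove 2 (λ u a → u ≠ 𝟎 ⇛ a ≠ 𝟎 ⇛ u ⊗ a ≐ 𝟎 ⇛ ff) u (X ‼ z) h q (trans (sym (scale-‼ u X z)) p)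
    row : ∀ x → Row x
    row x with cl? (F ⊕ x₀) x
    ... | yes q = record
      { U = λ y → scale μ (T₀ y) ; cR = λ y → C-scale μ (Line.cT L₀ y) ; vR = λ y → van-scale μ (v₀ y)
      ; zR = λ y → trans (scale-‼ μ (T₀ y) x) (·-zero μ (T₀x y))
      ; antiR = scaled-anti μ L₀
      ; nzR = λ y h₁ h₂ → scaled-nz {μ} {T₀ y} (λ z → h₁ λ X c v → trans (m X c v) (cong (_· X ‼ x₀) z))
                (Line.nz L₀ y λ i → h₂ λ X c v → i X c (van-⊕ (van-⊕ˡ v) (back X c v h₁)))
      ; baseR = λ z → trans (scale-‼ μ (T₀ x₀) z) (trans (cong (μ ·_) (trans (antiL L₀ x₀ z) (cong -_ (T₀x₀ z))))
                (trans (·-zeroʳ μ) (sym (cong -_ (trans (antiL L₀ x z) (cong -_ (T₀x z)))))))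
      ; parR = λ _ → μ , (λ y z → scale-‼ μ (T₀ y) z) , m }
      where
      par = parallel q x₀∉
      μ = proj₁ par
      m = proj₂ par
      v₀ = λ y → van-⊕ˡ (Line.vT L₀ y)
      T₀x : ∀ y → T₀ y ‼ x ≡ zer
      T₀x y = trans (m (T₀ y) (Line.cT L₀ y) (v₀ y)) (·-zero μ (T₀x₀ y))
      back : ∀ X → C X → Van X (F ⊕ x) → ¬ InCl F x → X ‼ x₀ ≡ zer
      back X c v h₁ with X ‼ x₀ ≟ₛ zer
      ... | yes z = z
      ... | no z = ⊥-elim (h₁ λ X' c' v' → trans (m X' c' v')
             (cong (_· X' ‼ x₀) (prove 3 (λ μ a b → b ≐ μ ⊗ a ⇛ b ≐ 𝟎 ⇛ a ≠ 𝟎 ⇛ μ ≐ 𝟎) μ (X ‼ x₀) (X ‼ x) (m X c (van-⊕ˡ v)) (van-⊕ʳ v) z)))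
    ... | no q = record
      { U = λ y → scale (- v) (Tx y) ; cR = λ y → C-scale (- v) (Line.cT Lx y) ; vR = λ y → van-scale (- v) (van-⊕ˡ (Line.vT Lx y))
      ; zR = λ y → trans (scale-‼ (- v) (Tx y) x) (·-zero (- v) (van-⊕ʳ (Line.vT Lx y)))
      ; antiR = scaled-anti (- v) Lx
      ; nzR = λ y h₁ h₂ → scaled-nz { - v} {Tx y} (prove 1 (λ v → v ≠ 𝟎 ⇛ ⊝ v ≠ 𝟎) v v≢) (Line.nz Lx y h₂)
      ; baseR = λ z → trans (scale-‼ (- v) (Tx x₀) z) (trans (prove 2 (λ v a → ⊝ v ⊗ a ≐ ⊝ (v ⊗ a)) v (Tx x₀ ‼ z)) (cong -_ (sym (p z))))
      ; parR = λ i → ⊥-elim (q i) }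
      where
      x∉ : ¬ InCl F x
      x∉ i = q λ X c v → i X c (van-⊕ˡ v)
      Lx = ln x x∉
      Tx = Line.T Lx
      x₀∉x : ¬ InCl (F ⊕ x) x₀
      x₀∉x i = q (exch i x₀∉)
      W = uniq-nz (r3 x x∉ x₀ x₀∉x) (Line.cT Lx x₀) (Line.cT L₀ x)
            (van-⊕ (Line.vT Lx x₀) (self-opposite (antiL Lx x₀ x₀)))
            (van-⊕ (van-⊕ (van-⊕ˡ (Line.vT L₀ x)) (self-opposite (antiL L₀ x x))) (T₀x₀ x))
            (proj₂ (Line.nz Lx x₀ x₀∉x)) (proj₂ (Line.nz L₀ x q))
      v = proj₁ W
      v≢ = proj₁ (proj₂ W)
      p = proj₂ (proj₂ W)
    V : Fin n → Fin n → SignVec n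
    V x = U (row x)
    anti23 : ∀ x y z → V x y ‼ z ≡ - (V x z ‼ y)
    anti23 x = antiR (row x)
    base : ∀ x z → V x x₀ ‼ z ≡ - (T₀ x ‼ z)
    base x = baseR (row x)
    at-x₀ : ∀ x y → V x y ‼ x₀ ≡ T₀ x ‼ y
    at-x₀ x y = trans (anti23 x y x₀) (trans (cong -_ (base x y)) (neg-neg _))
    ∉₁ : ∀ x y w → V x y ‼ w ≢ zer → ¬ InCl (F ⊕ x) y
    ∉₁ x y w h i = h (trans (anti23 x y w) (cong -_ (i (V x w) (cR (row x) w) (van-⊕ (vR (row x) w) (zR (row x) w)))))
    both : ∀ x y → Van (V x y) (F ⊕ x ⊕ y)
    both x y = van-⊕ (van-⊕ (vR (row x) y) (zR (row x) y)) (self-opposite (anti23 x y y))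
    both' : ∀ x y → Van (V y x) (F ⊕ x ⊕ y)
    both' x y = van-⊕ (van-⊕ (vR (row y) x) (self-opposite (anti23 y x x))) (zR (row y) x)
    compare : ∀ x y w → ¬ InCl F x → V x y ‼ w ≢ zer → V x y ‼ w ≡ - (V y x ‼ w) → ∀ z → V x y ‼ z ≡ - (V y x ‼ z)
    compare x y w x∉ h q z =
      let v , p = uniq (r3 x x∉ y (∉₁ x y w h)) (cR (row x) y) (cR (row y) x) (both x y) (both' x y) h
      in prove 5 (λ v a b c d → a ≠ 𝟎 ⇛ a ≐ ⊝ b ⇛ b ≐ v ⊗ a ⇛ d ≐ v ⊗ c ⇛ c ≐ ⊝ d) v (V x y ‼ w) (V y x ‼ w) (V x y ‼ z) (V y x ‼ z) h q (p w) (p z)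
    anti-x₀ : ∀ x y → V x y ‼ x₀ ≢ zer → ∀ z → V x y ‼ z ≡ - (V y x ‼ z)
    anti-x₀ x y h = compare x y x₀
      (λ i → h (trans (at-x₀ x y) (trans (antiL L₀ x y) (cong -_ (i (T₀ y) (Line.cT L₀ y) (van-⊕ˡ (Line.vT L₀ y)))))))
      h (trans (at-x₀ x y) (trans (antiL L₀ x y) (cong -_ (sym (at-x₀ y x)))))
    anti-par : ∀ x y → InCl (F ⊕ x₀) x → ∀ z → V x y ‼ z ≡ - (V y x ‼ z)
    anti-par x y i z =
      let μ , U≡ , m = parR (row x) i
      in trans (U≡ y z) (trans (cong (μ ·_) (sym (at-x₀ y z))) (trans (sym (m (V y z) (cR (row y) z) (vR (row y) z))) (anti23 y z x)))
    -- If [x y x₀] = 0, the normalization at x₀ says nothing about the pair x, y. The comparison is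
    -- routed through w, because [x w x₀] and [y w x₀] are then nonzero.
    anti-gen : ∀ x y w → ¬ InCl (F ⊕ x₀) x → ¬ InCl (F ⊕ x₀) y → V x y ‼ w ≢ zer → ∀ z → V x y ‼ z ≡ - (V y x ‼ z)
    anti-gen x y w hx hy h with V x y ‼ x₀ ≟ₛ zer
    ... | no q = anti-x₀ x y q
    ... | yes q = compare x y w x∉ h
        (trans (anti23 x y w) (trans (cong -_ (anti-x₀ x w xw y)) (trans (neg-neg _) (trans (anti23 w x y)
          (cong -_ (trans (sym (neg-neg _)) (trans (cong -_ (sym (anti-x₀ y w yw x))) (sym (anti23 y x w)))))))))
      where
      x∉ : ¬ InCl F x
      x∉ i = hx λ X c v → i X c (van-⊕ˡ v)
      y∉ : ¬ InCl F y
      y∉ i = hy λ X c v → i X c (van-⊕ˡ v)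
      flat : ∀ u → ¬ InCl F u → ¬ InCl (F ⊕ x₀) u → ∀ P → C P → Van P F → P ‼ u ≡ zer → P ‼ x₀ ≡ zer → P ‼ w ≢ zer →
             (∃ λ z → V u w ‼ z ≢ zer) → V u w ‼ x₀ ≢ zer
      flat u u∉ hu P cP vP Pu P₀ Pw (z , q) r =
        let v , p = uniq (r3 u u∉ x₀ (λ i → hu (exch i x₀∉))) cP (cR (row u) w) (van-⊕ (van-⊕ vP Pu) P₀) (van-⊕ (van-⊕ (vR (row u) w) (zR (row u) w)) r) Pw
        in q (trans (p z) (cong (_· P ‼ z) (prove 3 (λ v a b → a ≐ v ⊗ b ⇛ a ≐ 𝟎 ⇛ b ≠ 𝟎 ⇛ v ≐ 𝟎) v (V u w ‼ w) (P ‼ w) (p w) (self-opposite (anti23 u w w)) Pw)))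
      flip≢ : ∀ {a b : Sign} → a ≡ - b → a ≢ zer → b ≢ zer
      flip≢ refl h refl = h refl
      xw : V x w ‼ x₀ ≢ zer
      xw = flat x x∉ hx (V x y) (cR (row x) y) (vR (row x) y) (zR (row x) y) q h (y , flip≢ (anti23 x y w) h)
      yw : V y w ‼ x₀ ≢ zer
      yw = flat y y∉ hy (V x y) (cR (row x) y) (vR (row x) y) (self-opposite (anti23 x y y)) q h
             (nzR (row y) w y∉ λ i → h (i (V x y) (cR (row x) y) (van-⊕ (vR (row x) y) (self-opposite (anti23 x y y)))))
    anti12 : ∀ x y z → V x y ‼ z ≡ - (V y x ‼ z)
    anti12 x y z = go (cl? (F ⊕ x₀) x) (cl? (F ⊕ x₀) y) (V x y ‼ z ≟ₛ zer) (V y x ‼ z ≟ₛ zer)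
      where
      go : Dec (InCl (F ⊕ x₀) x) → Dec (InCl (F ⊕ x₀) y) → Dec (V x y ‼ z ≡ zer) → Dec (V y x ‼ z ≡ zer) → V x y ‼ z ≡ - (V y x ‼ z)
      go (yes i) _ _ _ = anti-par x y i z
      go (no _) (yes i) _ _ = trans (sym (neg-neg _)) (cong -_ (sym (anti-par y x i z)))
      go (no i) (no j) (no h) _ = anti-gen x y z i j h z
      go (no i) (no j) (yes _) (no h) = trans (sym (neg-neg _)) (cong -_ (sym (anti-gen y x z j i h z)))
      go (no i) (no j) (yes a) (yes b) = trans a (cong -_ (sym b))
    rank1 : ∀ x y w → V x y ‼ w ≢ zer → R 1 (F ⊕ x ⊕ y)
    rank1 x y w h = r3 x (λ i → h (trans (anti12 x y w) (cong -_ (trans (anti23 y x w) (cong -_ (i (V y w) (cR (row y) w) (vR (row y) w))))))) y (∉₁ x y w h)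

  abstract
    plane : ∀ {F x₀} → R 3 F → ¬ R 2 F → ¬ InCl F x₀ → Plane F
    plane = plane′

-- Vertices and edges of the extension

lex-first : ∀ {n k} (es : Fin k → Fin n) (Y : SignVec n) t → (∀ u → u <ᶠ t → Y ‼ es u ≡ zer) → Y ‼ es t ≢ zer →
            lexSign es Y ≡ Y ‼ es t
lex-first es Y zero h q with Y ‼ es zero
... | pos = refl
... | neg = refl
... | zer = ⊥-elim (q refl)
lex-first es Y (suc t) h q with Y ‼ es zero | h zero (s≤s z≤n)
... | zer | _ = lex-first (λ i → es (suc i)) Y t (λ u l → h (suc u) (s≤s l)) q

lex-none : ∀ {n k} (es : Fin k → Fin n) (Y : SignVec n) → (∀ t → Y ‼ es t ≡ zer) → lexSign es Y ≡ zer
lex-none {k = zero}  es Y h = refl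
lex-none {k = suc k} es Y h with Y ‼ es zero | h zero
... | zer | _ = lex-none (λ i → es (suc i)) Y (λ t → h (suc t))

first-nonzero : ∀ {k} (v : Fin k → Sign) → (∀ t → v t ≡ zer) ⊎ ∃ λ t → (∀ u → u <ᶠ t → v u ≡ zer) × v t ≢ zer
first-nonzero {zero} v = inj₁ λ ()
first-nonzero {suc k} v with v zero ≟ₛ zer
... | no q = inj₂ (zero , (λ _ ()) , q)
... | yes q with first-nonzero (λ t → v (suc t))
... | inj₁ h = inj₁ λ { zero → q ; (suc t) → h t }
... | inj₂ (t , h , p) = inj₂ (suc t , (λ { zero _ → q ; (suc u) (s≤s l) → h u l }) , p)

tail-‼ : ∀ {n} (X : SignVec (suc n)) i → tail X ‼ i ≡ X ‼ suc i
tail-‼ (x ∷ X) i = refl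

record Extension : Set₁ where
  field
    n   : ℕ
    C   : CovSet n
    om  : IsOM C
    r   : ℕ
    rk  : HasRank C Full Full r
    f g : Fin n
    k   : ℕ
    es  : Fin k → Fin n
    C'  : CovSet (suc n)
    ext' : IsSingleElementExtension C C' (lexSign es)
    C'? : ∀ X → Dec (C' X)
    g-nonloop : ¬ Loop C Full g

module Ext (D : Extension) where
  open Extension D public hiding (r)

  om' : IsOM C'
  om' = proj₁ ext'

  C? : ∀ X → Dec (C X)
  C? X = map′ (λ h → proj₂ (proj₁ (proj₂ ext') X) (lift h)) (λ c → lower (proj₁ (proj₁ (proj₂ ext') X) c))
           (C'? (pos ∷ X) ⊎-dec C'? (neg ∷ X) ⊎-dec C'? (zer ∷ X))
    where
    lift : C' (pos ∷ X) ⊎ C' (neg ∷ X) ⊎ C' (zer ∷ X) → Σ Sign λ s → C' (s ∷ X)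
    lift (inj₁ c) = pos , c
    lift (inj₂ (inj₁ c)) = neg , c
    lift (inj₂ (inj₂ c)) = zer , c
    lower : Σ Sign (λ s → C' (s ∷ X)) → C' (pos ∷ X) ⊎ C' (neg ∷ X) ⊎ C' (zer ∷ X)
    lower (pos , c) = inj₁ c
    lower (neg , c) = inj₂ (inj₁ c)
    lower (zer , c) = inj₂ (inj₂ c)

  module O = OM C om C?
  open OM C' om' C'? public
  open Chirotope C' om' C'? public
  module Pot = Potential C om C?

  p g⁺ f⁺ : Fin (suc n)
  p = zero
  g⁺ = suc g
  f⁺ = suc f

  e⁺ : Fin k → Fin (suc n)
  e⁺ t = suc (es t)

  tail∈ : ∀ {X} → C' X → C (tail X)
  tail∈ {x ∷ X} c = proj₂ (proj₁ (proj₂ ext') X) (x , c)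

  lift∈ : ∀ {X} → C X → ∃ λ s → C' (s ∷ X)
  lift∈ {X} c = proj₁ (proj₁ (proj₂ ext') X) c

  van-tail : ∀ {X : SignVec (suc n)} {S} → Van X (outside ∷ S) → Van (tail X) S
  van-tail {x ∷ X} v = van λ h m → at v (suc h) (there m)

  van-cons : ∀ {s} {X : SignVec n} {S} → Van X S → Van (s ∷ X) (outside ∷ S)
  van-cons v = van λ { (suc h) (there m) → at v h m }

  R-restrict : ∀ d {S} → R d (outside ∷ S) → O.R d S
  R-restrict zero    r X c v e = let s , c' = lift∈ c in r (s ∷ X) c' (van-cons v) (suc e)
  R-restrict (suc d) r e h = R-restrict d (r (suc e) (λ i → h λ X c v → let s , c' = lift∈ c in i (s ∷ X) c' (van-cons v)))

  OldV : SignVec (suc n) → Set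
  OldV X = C' X × O.Coc (tail X)

  old-lex : ∀ {X} → OldV X → X ‼ p ≡ lexSign es (tail X)
  old-lex {x ∷ X} (c , q) = proj₂ (proj₂ (proj₂ ext') X q) x c

  old-first : ∀ {X} → OldV X → ∀ t → (∀ u → u <ᶠ t → X ‼ e⁺ u ≡ zer) → X ‼ e⁺ t ≢ zer → X ‼ p ≡ X ‼ e⁺ t
  old-first {x ∷ X} o t h q = trans (old-lex o) (lex-first es X t h q)

  old-none : ∀ {X} → OldV X → (∀ t → X ‼ e⁺ t ≡ zer) → X ‼ p ≡ zer
  old-none {x ∷ X} o h = trans (old-lex o) (lex-none es X h)

  old-vanish : ∀ {X} → OldV X → X ‼ p ≡ zer → ∀ t → X ‼ e⁺ t ≡ zer
  old-vanish {X} o q t with first-nonzero (λ t → X ‼ e⁺ t)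
  ... | inj₁ h = h t
  ... | inj₂ (t , ft , nz) = ⊥-elim (nz (trans (sym (old-first o t ft nz)) q))

  old-scale : ∀ u {X} → u ≢ zer → OldV X → OldV (scale u X)
  old-scale u {x ∷ X} h (c , q) = C-scale u c , O.R-coc (O.C-scale u (proj₁ q))
    (let e , z = proj₁ (proj₂ q) in e , λ w → nz· h z (trans (sym (scale-‼ u X e)) w)) (van-scale u (van-zset X)) (O.coc-R q)

  -- Composing such a covector and its negative with the lift of a cocircuit Y would put two
  -- different signs of p over Y, against the uniqueness in the localization. A cocircuit Y exists
  -- because g is not a loop.
  p-not-coloop : ∀ {s} → C' (s ∷ zeroV) → s ≡ zer
  p-not-coloop {s} c =
    let X , cX , _ , q = O.∉cl⇒ {S = ∅} {e = g} (λ i → g-nonloop (∈⊤ , λ X c v → i X c (van v)))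
        Y , cY = O.cocircuit-exists {X} cX (g , q)
        σ = lexSign es Y
        y , un = proj₂ (proj₂ ext') Y cY
        z∘ : ∀ {m} (Y : SignVec m) → zeroV ∘ Y ≡ Y
        z∘ = λ Y → ext λ e → trans (∘-‼ zeroV Y e) (cong (_∘ₛ Y ‼ e) (lookup-replicate e zer))
        a = un (s ∘ₛ σ) (subst (λ Z → C' (s ∘ₛ σ ∷ Z)) (z∘ Y) (IsOM.comp∈ om' _ _ c y))
        n∘ : negV (zeroV {n}) ≡ zeroV
        n∘ = ext λ e → trans (neg-‼ zeroV e) (trans (cong -_ (lookup-replicate e zer)) (sym (lookup-replicate e zer)))
        b = un ((- s) ∘ₛ σ) (subst (λ Z → C' ((- s) ∘ₛ σ ∷ Z)) (trans (cong (_∘ Y) n∘) (z∘ Y)) (IsOM.comp∈ om' _ _ (IsOM.neg∈ om' _ c) y))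
    in go s σ a b
    where
    go : ∀ s σ → s ∘ₛ σ ≡ σ → (- s) ∘ₛ σ ≡ σ → s ≡ zer
    go pos pos a ()
    go pos neg ()
    go pos zer ()
    go neg pos ()
    go neg neg a ()
    go neg zer ()
    go zer σ a b = refl

  old-of : ∀ {X S} → C' X → Van X (outside ∷ S) → R 1 (outside ∷ S) → (∃ λ e → X ‼ e ≢ zer) → OldV X
  old-of {x ∷ X} {S} c v r nz with nonzero? X
  ... | yes q = c , O.R-coc (tail∈ c) q (van-tail v) (R-restrict 1 r)
  ... | no q = ⊥-elim (absurd nz)
    where
    X0 : X ≡ zeroV
    X0 = ext λ e → trans (¬nonzero⇒ {X = X} q e) (sym (lookup-replicate e zer))
    absurd : (∃ λ e → (x ∷ X) ‼ e ≢ zer) → ⊥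
    absurd (zero , h) = h (p-not-coloop (subst (λ Z → C' (x ∷ Z)) X0 c))
    absurd (suc e , h) = q (e , h)

  module Lifted {x y : Fin n} {φ : SignVec n → ℕ} (isφ : Pot.IsPotential x y φ) where
    -- A potential speaks about cocircuits that are positive at x; multiplying by the sign at x
    -- makes it apply to both orientations.
    P : SignVec (suc n) → ℕ
    P X = φ (tail (scale (X ‼ suc x) X))

    cmp : ∀ {S X X' T α} → R 2 (outside ∷ S) → OldV X → OldV X' → C' T → Van X (outside ∷ S) → Van X' (outside ∷ S) →
          Van T (outside ∷ S) → X ‼ suc α ≡ zer → X' ‼ suc α ≢ zer → T ‼ suc α ≡ X' ‼ suc x · X' ‼ suc α →
          X ‼ suc x ≢ zer → X' ‼ suc x ≢ zer → T ‼ suc x ≡ zer → Cmp (T ‼ suc y) (P X) (P X')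
    cmp {S} {a ∷ X} {a' ∷ X'} {t ∷ T} {α} r2 o o' cT v v' vT Xα X'α Tα Xx X'x Tx =
      isφ (scale u X) (scale u' X') T record
        { S = S ; r2 = R-restrict 2 r2
        ; cX = proj₂ (old-scale u Xx o) ; cX' = proj₂ (old-scale u' X'x o') ; cT = tail∈ cT
        ; vX = van-scale u (van-tail v) ; vX' = van-scale u' (van-tail v') ; vT = van-tail vT
        ; α = α ; Xα = trans (scale-‼ u X α) (·-zero u Xα)
        ; X'α = λ z → nz· X'x X'α (trans (sym (scale-‼ u' X' α)) z) ; Tα = trans Tα (sym (scale-‼ u' X' α))
        ; Xx = trans (scale-‼ u X x) (square Xx) ; X'x = trans (scale-‼ u' X' x) (square X'x) ; Tx = Tx }
      where
      u = X ‼ x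
      u' = X' ‼ x

    P-≡ : ∀ {X X'} v → v ≢ zer → (∀ h → X' ‼ suc h ≡ v · X ‼ suc h) → P X ≡ P X'
    P-≡ {a ∷ X} {a' ∷ X'} v v≢ q = cong φ (ext {X = scale (X ‼ x) X} {scale (X' ‼ x) X'} λ h → trans (scale-‼ (X ‼ x) X h)
      (trans (prove 5 (λ v a b c d → v ≠ 𝟎 ⇛ c ≐ v ⊗ a ⇛ d ≐ v ⊗ b ⇛ a ⊗ b ≐ c ⊗ d) v (X ‼ x) (X ‼ h) (X' ‼ x) (X' ‼ h) v≢ (q x) (q h))
        (sym (scale-‼ (X' ‼ x) X' h))))

  -- A vertex of the extended program, with the constant sign ε of f along a directed cycle.
  record Vtx (ε : Sign) (W : SignVec (suc n)) : Set where
    field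
      coc : Coc W
      Wg  : W ‼ g⁺ ≡ pos
      Wf  : W ‼ f⁺ ≡ ε
      ε≢  : ε ≢ zer

  data Side : Set where
    𝒈 𝒇 : Side

  elt₀ : Side → Fin n
  elt₀ 𝒈 = g
  elt₀ 𝒇 = f

  elt : Side → Fin (suc n)
  elt σ = suc (elt₀ σ)

  opp : Side → Side
  opp 𝒈 = 𝒇
  opp 𝒇 = 𝒈

  -- In the last case the point Q of the line serves as a substitute for Y.
  data Base (ε : Sign) (S : Subset n) (Y : SignVec (suc n)) : Set where
    fin : Y ‼ g⁺ ≡ pos → Base ε S Y
    inf : Y ‼ g⁺ ≡ zer → Y ‼ f⁺ ≡ ε → Base ε S Y
    common : Y ‼ g⁺ ≡ zer → Y ‼ f⁺ ≡ zer → ∀ Q → OldV Q → Van Q (outside ∷ S) → Q ‼ g⁺ ≡ pos → Base ε S Y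

  -- A vertex W on p that is not a cocircuit of O lies on the line z(W) ∖ p of O, next to the
  -- cocircuit Y where this line meets the first e_i that does not vanish at W.
  record New (ε : Sign) (W : SignVec (suc n)) : Set where
    S : Subset n
    S = tail (zset W)
    field
      Wp    : W ‼ p ≡ zer
      p∉    : ¬ InCl (outside ∷ S) p
      r2    : R 2 (outside ∷ S)
      i     : Fin k
      first : ∀ u → u <ᶠ i → W ‼ e⁺ u ≡ zer
      Wi    : W ‼ e⁺ i ≢ zer
      Y     : SignVec (suc n)
      oY    : OldV Y
      vY    : Van Y (outside ∷ S)
      Yi    : Y ‼ e⁺ i ≡ zer
      Yp    : Y ‼ p ≡ - (W ‼ e⁺ i)
      near  : ∀ h → Y ‼ suc h ≢ zer → Y ‼ suc h ≡ W ‼ suc h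
      G     : Side → SignVec (suc n)
      oG    : ∀ σ → OldV (G σ)
      vG    : ∀ σ → Van (G σ) (outside ∷ S)
      Gσ    : ∀ σ → G σ ‼ elt σ ≡ zer
      Gp    : ∀ σ → G σ ‼ p ≡ pos
      base  : Base ε S Y
    Yp≢ : Y ‼ p ≢ zer
    Yp≢ z = Wi (prove 2 (λ y w → y ≐ ⊝ w ⇛ y ≐ 𝟎 ⇛ w ≐ 𝟎) (Y ‼ p) _ Yp z)

  data Kind (ε : Sign) (W : SignVec (suc n)) : Set where
    old : OldV W → Kind ε W
    new : New ε W → Kind ε W

  ∈tail-zset : ∀ (W : SignVec (suc n)) {h} → W ‼ suc h ≡ zer → h ∈ tail (zset W)
  ∈tail-zset (w ∷ W) q = ∈zset W q

  van-zset⁻ : ∀ {W : SignVec (suc n)} → Van W (outside ∷ tail (zset W))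
  van-zset⁻ {w ∷ W} = van λ { (suc h) (there m) → zset∈ W m }

  van-zset⁺ : ∀ {X W : SignVec (suc n)} → Van X (outside ∷ tail (zset W)) → (W ‼ p ≡ zer → X ‼ p ≡ zer) → Van X (zset W)
  van-zset⁺ {X} {W} v q = van go
    where
    go : ∀ h → h ∈ zset W → X ‼ h ≡ zer
    go zero m = q (zset∈ W m)
    go (suc h) m = at v (suc h) (there (∈tail-zset W (zset∈ W m)))

  old-cocircuit : ∀ {W} → Coc W → (W ‼ p ≡ zer → InCl (outside ∷ tail (zset W)) p) → OldV W
  old-cocircuit {W} c q = old-of (proj₁ c) (van-zset⁻ {W})
    (R-mono 1 (λ X cX v → van-zset⁺ {X} {W} v (λ z → q z X cX v)) (coc-R c)) (proj₁ (proj₂ c))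

  module _ {ε : Sign} {W : SignVec (suc n)} (vt : Vtx ε W) (Wp : W ‼ p ≡ zer) (p∉ : ¬ InCl (outside ∷ tail (zset W)) p) where
    open Vtx vt
    private
      S = tail (zset W)
      cW = proj₁ coc
      vW : Van W (outside ∷ S)
      vW = van-zset⁻ {W}

    private
      r2 : R 2 (outside ∷ S)
      r2 = R-lower 1 p∉ (R-mono 1 (λ X c v → van-zset⁺ {X} {W} (van-⊕ˡ {e = p} v) (λ _ → van-⊕ʳ {S = outside ∷ S} {p} v)) (coc-R coc))

      old-at : ∀ {X} h → C' X → Van X (outside ∷ S) → W ‼ suc h ≢ zer → X ‼ suc h ≡ zer → (∃ λ e → X ‼ e ≢ zer) → OldV X
      old-at h c v q z nz = old-of c (van-⊕ v z) (r2 (suc h) (⇒∉cl cW vW q)) nz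

      E = proj₁ (∉cl⇒ p∉)
      cE = proj₁ (proj₂ (∉cl⇒ p∉))
      vE = proj₁ (proj₂ (proj₂ (∉cl⇒ p∉)))
      Ep = proj₂ (proj₂ (proj₂ (∉cl⇒ p∉)))

      -- E is moved along W until it meets h. As W vanishes at p, the entry at p stays nonzero and
      -- can be scaled to q.
      meet : ∀ h q → q ≢ zer → W ‼ suc h ≢ zer →
             ∃ λ X → OldV X × Van X (outside ∷ S) × X ‼ suc h ≡ zer × X ‼ p ≡ q
      meet h q q≢ Wh =
        let Z , cZ , vZ , z , s = det E W (suc h) cE cW vE vW
            Zp : Z ‼ p ≡ - (W ‼ suc h) · E ‼ p
            Zp = prove 5 (λ eh wh ep wp z → sum (⊝ wh ⊗ ep) (eh ⊗ wp) z ⇛ wp ≐ 𝟎 ⇛ z ≐ ⊝ wh ⊗ ep)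
                   (E ‼ suc h) (W ‼ suc h) (E ‼ p) (W ‼ p) (Z ‼ p) (s p) Wp
            Zp≢ = prove 3 (λ a b z → z ≐ ⊝ a ⊗ b ⇛ a ≠ 𝟎 ⇛ b ≠ 𝟎 ⇛ z ≠ 𝟎) (W ‼ suc h) (E ‼ p) (Z ‼ p) Zp Wh Ep
            u = q · Z ‼ p
        in scale u Z , old-scale u (nz· q≢ Zp≢) (old-at h cZ vZ Wh z (p , Zp≢)) , van-scale u vZ ,
           trans (scale-‼ u Z (suc h)) (·-zero u z) ,
           trans (scale-‼ u Z p) (prove 2 (λ q z → z ≠ 𝟎 ⇛ q ⊗ z ⊗ z ≐ q) q (Z ‼ p) Zp≢)

      Wσ : ∀ σ → W ‼ suc (elt₀ σ) ≢ zer
      Wσ 𝒈 = pos≢ Wg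
      Wσ 𝒇 = λ z → ε≢ (trans (sym Wf) z)

      G : ∀ σ → ∃ λ X → OldV X × Van X (outside ∷ S) × X ‼ suc (elt₀ σ) ≡ zer × X ‼ p ≡ pos
      G σ = meet (elt₀ σ) pos (λ ()) (Wσ σ)

      index : ∃ λ i → (∀ u → u <ᶠ i → W ‼ e⁺ u ≡ zer) × W ‼ e⁺ i ≢ zer
      index with first-nonzero (λ t → W ‼ e⁺ t)
      ... | inj₂ x = x
      -- If all e_t vanished at W, they would vanish on the whole line, and so would p at each of
      -- its old points; but p is positive at G.
      ... | inj₁ h = let X , o , v , _ , Xp = G 𝒈 in
        ⊥-elim (pos≢ Xp (old-none o (λ t → at v (e⁺ t) (there (∈tail-zset W (h t))))))

    new-vertex : New ε W
    new-vertex = record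
      { Wp = Wp ; p∉ = p∉ ; r2 = r2 ; i = i ; first = first ; Wi = Wi
      ; Y = Y ; oY = oY ; vY = vY ; Yi = Yi ; Yp = Yp ; near = near
      ; G = λ σ → proj₁ (G σ) ; oG = λ σ → proj₁ (proj₂ (G σ)) ; vG = λ σ → proj₁ (proj₂ (proj₂ (G σ)))
      ; Gσ = λ σ → proj₁ (proj₂ (proj₂ (proj₂ (G σ))))
      ; Gp = λ σ → proj₂ (proj₂ (proj₂ (proj₂ (G σ)))) ; base = base }
      where
      i = proj₁ index
      first = proj₁ (proj₂ index)
      Wi = proj₂ (proj₂ index)
      -- On this line p is e_i plus terms of smaller order. At W they cancel e_i, and at Y they are
      -- the whole value of p; hence the opposite sign.
      M = meet (es i) (- (W ‼ e⁺ i)) (prove 1 (λ a → a ≠ 𝟎 ⇛ ⊝ a ≠ 𝟎) (W ‼ e⁺ i) Wi) Wi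
      Y = proj₁ M
      oY = proj₁ (proj₂ M)
      vY = proj₁ (proj₂ (proj₂ M))
      Yi = proj₁ (proj₂ (proj₂ (proj₂ M)))
      Yp = proj₂ (proj₂ (proj₂ (proj₂ M)))
      near : ∀ h → Y ‼ suc h ≢ zer → Y ‼ suc h ≡ W ‼ suc h
      near h q with Y ‼ suc h ≟ₛ W ‼ suc h | W ‼ suc h ≟ₛ zer
      ... | yes a | _ = a
      ... | no _ | yes z = ⊥-elim (q (at vY (suc h) (there (∈tail-zset W z))))
      -- Were Y and W opposite at h, eliminating h would give an old Z on the line with Z p = Y p
      -- and Z e_i = W e_i. The lexicographic rule makes these equal, contradicting Y p = - W e_i.
      ... | no a | no Wh =
        let Z , cZ , z , s = add Y W (suc h) (proj₁ oY) cW
              (prove 2 (λ y w → y ≠ 𝟎 ⇛ w ≠ 𝟎 ⇛ y ≠ w ⇛ y ≐ ⊝ w) (Y ‼ suc h) (W ‼ suc h) q Wh a)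
            vZ = van λ x m → trans (proj₁ (s x) (at vY x m)) (at vW x m)
            Zp = proj₁ (proj₂ (s p)) Wp
            Zi = proj₁ (s (e⁺ i)) Yi
            Zi≢ = λ x → Wi (trans (sym Zi) x)
            o = old-at h cZ vZ Wh z (e⁺ i , Zi≢)
            l = old-first o i (λ u q → at vZ (e⁺ u) (there (∈tail-zset W (first u q)))) Zi≢
        in ⊥-elim (Wi (self-opposite (trans (sym Zi) (trans (sym l) (trans Zp Yp)))))
      base : Base ε S Y
      base with Y ‼ g⁺ ≟ₛ zer | Y ‼ f⁺ ≟ₛ zer
      ... | no a | _ = fin (trans (near g a) Wg)
      ... | yes a | no b = inf a (trans (near f b) Wf)
      ... | yes a | yes b with first-nonzero (λ t → Y ‼ e⁺ t)
      ... | inj₁ h = ⊥-elim (Wi (prove 2 (λ y w → y ≐ ⊝ w ⇛ y ≐ 𝟎 ⇛ w ≐ 𝟎) (Y ‼ p) (W ‼ e⁺ i) Yp (old-none oY h)))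
      -- p is nonzero at Y, so some e_j is. Eliminating e_j from Y and W gives a point whose value
      -- at g is Y e_j · W g, which is nonzero.
      ... | inj₂ (j , _ , Yj) =
        let Z , cZ , vZ , z , s = det Y W (e⁺ j) (proj₁ oY) cW vY vW
            Zg = prove 5 (λ yj wj yg wg z → sum (⊝ wj ⊗ yg) (yj ⊗ wg) z ⇛ yg ≐ 𝟎 ⇛ wg ≐ 𝟏 ⇛ z ≐ yj)
                   (Y ‼ e⁺ j) (W ‼ e⁺ j) (Y ‼ g⁺) (W ‼ g⁺) (Z ‼ g⁺) (s g⁺) a Wg
            u = Y ‼ e⁺ j
        in common a b (scale u Z)
             (old-scale u Yj (old-at (es j) cZ vZ (λ q → Yj (trans (near (es j) Yj) q)) z (g⁺ , λ q → Yj (trans (sym Zg) q))))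
             (van-scale u vZ) (trans (scale-‼ u Z g⁺) (prove 2 (λ u z → z ≐ u ⇛ u ≠ 𝟎 ⇛ u ⊗ z ≐ 𝟏) u (Z ‼ g⁺) Zg Yj))

  abstract
    -- Deleting p from the zero set turns the point W into a line exactly if p vanishes at W and is
    -- not in the closure of the other zeros.
    kind : ∀ {ε W} → Vtx ε W → Kind ε W
    kind {ε} {W} vt with W ‼ p ≟ₛ zer
    ... | no q = old (old-cocircuit (Vtx.coc vt) (λ z → ⊥-elim (q z)))
    ... | yes q with cl? (outside ∷ tail (zset W)) p
    ... | yes i = old (old-cocircuit (Vtx.coc vt) (λ _ → i))
    ... | no i = new (new-vertex vt q i)

  -- T is the sign pattern of W' - W at infinity with respect to g.
  record Edge (W W' T : SignVec (suc n)) : Set where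
    field
      F'   : Subset (suc n)
      r2F  : R 2 F'
      vW   : Van W F'
      vW'  : Van W' F'
      F'∋  : ∀ {h} → W ‼ h ≡ zer → W' ‼ h ≡ zer → h ∈ F'
      conf : ∀ h → W ‼ h ≢ zer → W' ‼ h ≢ zer → W ‼ h ≡ W' ‼ h
      cT   : C' T
      Tg   : T ‼ g⁺ ≡ zer
      Ts   : ∀ h → Sum (- (W ‼ h)) (W' ‼ h) (T ‼ h)
      α α' : Fin (suc n)
      Wα   : W ‼ α ≡ zer
      W'α  : W' ‼ α ≢ zer
      Wα'  : W ‼ α' ≢ zer
      W'α' : W' ‼ α' ≡ zer
    vT : Van T F'
    vT = van λ h m → trans (proj₁ (Ts h) (cong -_ (at vW h m))) (at vW' h m)

  edge-sym : ∀ {W W' T} → Edge W W' T → Edge W' W (scale neg T)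
  edge-sym {W} {W'} {T} E = record
    { F' = F' ; r2F = r2F ; vW = vW' ; vW' = vW ; F'∋ = λ a b → F'∋ b a ; conf = λ h a b → sym (conf h b a)
    ; cT = C-scale neg cT ; Tg = trans (scale-‼ neg T g⁺) (cong -_ Tg)
    ; Ts = λ h → subst (Sum _ _) (sym (scale-‼ neg T h)) (prove 3 (λ a b c → sum (⊝ a) b c ⇛ sum (⊝ b) a (⊝ c)) (W ‼ h) (W' ‼ h) (T ‼ h) (Ts h))
    ; α = α' ; α' = α ; Wα = W'α' ; W'α = Wα' ; Wα' = W'α ; W'α' = Wα }
    where open Edge E

  record Flat : Set where
    field
      F₀ : Subset n
      r3 : R 3 (outside ∷ F₀)
      Pl : Plane (outside ∷ F₀)

-- Levels

Wk : Sign → ℕ → ℕ → Set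
Wk D a b = (D ≡ pos → a ≤ b) × (D ≡ zer → a ≡ b) × (D ≡ neg → b ≤ a)

wk-≡ : ∀ {D a b} → a ≡ b → Wk D a b
wk-≡ q = (λ _ → ≤-reflexive q) , (λ _ → q) , λ _ → ≤-reflexive (sym q)

wk-cmp : ∀ {D a b} → Cmp D a b → Wk D a b
wk-cmp (x , y , z) = (λ q → <⇒≤ (x q)) , y , λ q → <⇒≤ (z q)

wk-sym : ∀ {D a b} → Wk D a b → Wk (- D) b a
wk-sym {D} (x , y , z) =
  (λ q → z (prove 1 (λ d → ⊝ d ≐ 𝟏 ⇛ d ≐ con neg) D q)) ,
  (λ q → sym (y (prove 1 (λ d → ⊝ d ≐ 𝟎 ⇛ d ≐ 𝟎) D q))) ,
  (λ q → x (prove 1 (λ d → ⊝ d ≐ con neg ⇛ d ≐ 𝟏) D q))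

-- zp is the first nonzero entry of z, and zer if there is none.
record Lex {k} (zp : Sign) (z : Fin k → Sign) : Set where
  field
    at-first : ∀ t → (∀ u → u <ᶠ t → z u ≡ zer) → z t ≢ zer → zp ≡ z t
    at-none  : (∀ t → z t ≡ zer) → zp ≡ zer
open Lex public

-- Agreement below t makes z u vanish for u < t. So the first nonzero entry, which gives zp, is at
-- t, or it is later and then z t = 0 and the values at t agree.
lex-wk : ∀ {k zp A} {z : Fin k → Sign} {m m' : Fin k → ℕ} → Lex zp z → A ≢ zer → (∀ t → Cmp (A · z t) (m t) (m' t)) →
         ∀ t → (∀ u → u <ᶠ t → m u ≡ m' u) → Wk (A · zp) (m t) (m' t)
lex-wk {zp = zp} {A} {z} {m} {m'} L A≢ c t h with first-nonzero z
... | inj₁ q = wk-≡ (proj₁ (proj₂ (c t)) (·-zero A (q t)))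
... | inj₂ (s , q , zs) with <ᶠ-cmp t s
... | tri< l _ _ = wk-≡ (proj₁ (proj₂ (c t)) (·-zero A (q t l)))
... | tri≈ _ refl _ = wk-cmp (subst (λ y → Cmp (A · y) (m t) (m' t)) (sym (at-first L t q zs)) (c t))
... | tri> _ _ l = ⊥-elim (nz· A≢ zs (cmp-≡ (c s) (h s l)))

lex-eq : ∀ {k zp A} {z : Fin k → Sign} {m m' : Fin k → ℕ} → Lex zp z → A ≢ zer → (∀ t → Cmp (A · z t) (m t) (m' t)) →
         (∀ t → m t ≡ m' t) → ∀ t → z t ≡ zer
lex-eq {A = A} {z} L A≢ c h t = prove 2 (λ a z → a ≠ 𝟎 ⇛ a ⊗ z ≐ 𝟎 ⇛ z ≐ 𝟎) A (z t) A≢ (cmp-≡ (c t) (h t))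

record Setting : Set₁ where
  field Dat : Extension
  open Ext Dat public
  field
    φ   : SignVec n → ℕ
    isφ : Pot.IsPotential g f φ
    ψ   : Side → Fin k → SignVec n → ℕ
    isψ : ∀ σ t → Pot.IsPotential (elt₀ σ) (es t) (ψ σ t)

module Levels (Stg : Setting) (ε : Sign) (ε≢ : ε ≢ zer) where
  open Setting Stg

  Φ : SignVec (suc n) → ℕ
  Φ = Lifted.P isφ

  Ψ : Side → Fin k → SignVec (suc n) → ℕ
  Ψ σ t = Lifted.P (isψ σ t)

  -- nothing stands for the level ε · ∞
  Le : Sign → Maybe ℕ → Maybe ℕ → Set
  Le D (just a) (just b) = Wk D a b
  Le D (just a) nothing  = D ≡ ε
  Le D nothing  (just b) = D ≡ - ε
  Le D nothing  nothing  = ⊤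

  Le! : Sign → Maybe ℕ → Maybe ℕ → Set
  Le! D (just a) (just b) = Cmp D a b
  Le! D (just a) nothing  = D ≡ ε
  Le! D nothing  (just b) = D ≡ - ε
  Le! D nothing  nothing  = D ≡ zer

  le-sym : ∀ {D} a b → Le D a b → Le (- D) b a
  le-sym (just a) (just b) l = wk-sym l
  le-sym (just a) nothing  l = cong -_ l
  le-sym nothing  (just b) l = trans (cong -_ l) (neg-neg ε)
  le-sym nothing  nothing  l = tt

  le!-le : ∀ {D D̂} a b → Le! D̂ a b → (D̂ ≢ zer → D ≡ D̂) → Le D a b
  le!-le {D} {D̂} (just a) (just b) c h with D̂ ≟ₛ zer
  ... | yes z = wk-≡ (proj₁ (proj₂ c) z)
  ... | no z  = wk-cmp (subst (λ d → Cmp d a b) (sym (h z)) c)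
  le!-le (just a) nothing c h = trans (h (λ z → ε≢ (trans (sym c) z))) c
  le!-le nothing (just b) c h = trans (h (λ z → ε≢ (prove 1 (λ e → ⊝ e ≐ 𝟎 ⇛ e ≐ 𝟎) ε (trans (sym c) z)))) c
  le!-le nothing nothing c h = tt

  le!-≡ : ∀ {D} a b → Le! D a b → a ≡ b → D ≡ zer
  le!-≡ (just a) (just b) c q = cmp-≡ c (just-injective q)
  le!-≡ nothing nothing c q = c

  -- The points at which f/g has a level: the finite ones, and those at infinity with respect to g,
  -- oriented by the constant sign of f.
  data Hat (X : SignVec (suc n)) : Set where
    hfin : X ‼ g⁺ ≡ pos → Hat X
    hinf : X ‼ g⁺ ≡ zer → X ‼ f⁺ ≡ ε → Hat X

  level : ∀ {X} → Hat X → Maybe ℕ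
  level {X} (hfin _)   = just (Φ X)
  level     (hinf _ _) = nothing

  levB : ∀ {S Y} → Base ε S Y → Maybe ℕ
  levB {Y = Y} (fin _)           = just (Φ Y)
  levB         (inf _ _)         = nothing
  levB         (common _ _ Q _ _ _) = just (Φ Q)

  lev : ∀ {W} → Kind ε W → Maybe ℕ
  lev {W} (old _) = just (Φ W)
  lev     (new N) = levB (New.base N)

  -- the sign of (f/g)(W) - (f/g)(Y)
  sgn : ∀ {W} → Kind ε W → Sign
  sgn (old _) = zer
  sgn (new N) = - (New.Y N ‼ p) · New.G N 𝒈 ‼ f⁺

  -- σ is the denominator. The slopes e_t/σ are compared at Y, then those over the other element at
  -- G; the second comparison presupposes that the first has been settled for all t.
  record LexFacts (σ : Side) (D : Sign) {W W'} (N : New ε W) (N' : New ε W') : Set where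
    open New N
    open New N' using () renaming (Y to Y'; G to G')
    field
      sameG : G σ ‼ elt (opp σ) ≡ G' σ ‼ elt (opp σ)
      key₁  : ∀ t → (∀ u → u <ᶠ t → Ψ σ u Y ≡ Ψ σ u Y') → Wk (- (G σ ‼ elt (opp σ)) · D) (Ψ σ t Y) (Ψ σ t Y')
      key₂  : (∀ t → Ψ σ t Y ≡ Ψ σ t Y') → ∀ t → (∀ u → u <ᶠ t → Ψ (opp σ) u (G σ) ≡ Ψ (opp σ) u (G' σ)) →
              Wk (W ‼ elt σ · Y ‼ p · D) (Ψ (opp σ) t (G σ)) (Ψ (opp σ) t (G' σ))
      flat  : (∀ t → Ψ σ t Y ≡ Ψ σ t Y') → (∀ t → Ψ (opp σ) t (G σ) ≡ Ψ (opp σ) t (G' σ)) → D ≡ zer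

  -- [f g p] = -[g f p]: exchanging the roles of f and g reverses the sign of an edge.
  η : Side → Sign
  η 𝒈 = pos
  η 𝒇 = neg

  record Deep (D : Sign) {W W'} (N : New ε W) (N' : New ε W') : Set where
    open New N
    open New N' using () renaming (Y to Y')
    field
      sameY : Y ‼ p ≡ Y' ‼ p
      lexf  : ∀ σ → Y ‼ elt σ ≢ zer → Y' ‼ elt σ ≢ zer → LexFacts σ (η σ · D) N N'

  DeepK : Sign → ∀ {W W'} → Kind ε W → Kind ε W' → Set
  DeepK D (new N) (new N') = Deep D N N'
  DeepK D _ _ = ⊥

  -- A lexicographic comparison of the ends of an edge: each entry presupposes that the quantities
  -- compared before it agree.
  record EF (D : Sign) {W W'} (K : Kind ε W) (K' : Kind ε W') : Set where
    field
      le  : Le D (lev K) (lev K')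
      sm  : lev K ≡ lev K' → Sum (sgn K') (- sgn K) D
      dp  : lev K ≡ lev K' → sgn K ≡ sgn K' → sgn K ≢ zer → DeepK D K K'

  deep-sym : ∀ {D W W'} {N : New ε W} {N' : New ε W'} → Vtx ε W → Vtx ε W' → Deep D N N' → Deep (- D) N' N
  deep-sym {D} {W} {W'} {N} {N'} vt vt' d = record { sameY = sym (Deep.sameY d) ; lexf = λ σ y' y → flip σ (Deep.lexf d σ y y') }
    where
    open New N
    open New N' using () renaming (Y to Y'; G to G')
    sameW : ∀ σ → W ‼ elt σ ≡ W' ‼ elt σ
    sameW 𝒈 = trans (Vtx.Wg vt) (sym (Vtx.Wg vt'))
    sameW 𝒇 = trans (Vtx.Wf vt) (sym (Vtx.Wf vt'))
    flip : ∀ σ → LexFacts σ (η σ · D) N N' → LexFacts σ (η σ · - D) N' N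
    flip σ l = record
      { sameG = sym sameG
      ; key₁ = λ t h → subst (λ s → Wk s _ _) (prove 4 (λ e d a b → a ≐ b ⇛ ⊝ (⊝ a ⊗ (e ⊗ d)) ≐ ⊝ b ⊗ (e ⊗ ⊝ d)) (η σ) D _ _ sameG)
                 (wk-sym (key₁ t (λ u q → sym (h u q))))
      ; key₂ = λ e t h → subst (λ s → Wk s _ _)
                 (prove 6 (λ e d w w' y y' → w ≐ w' ⇛ y ≐ y' ⇛ ⊝ (w ⊗ y ⊗ (e ⊗ d)) ≐ w' ⊗ y' ⊗ (e ⊗ ⊝ d)) (η σ) D _ _ _ _ (sameW σ) (Deep.sameY d))
                 (wk-sym (key₂ (λ u → sym (e u)) t (λ u q → sym (h u q))))
      ; flat = λ a b → prove 2 (λ e d → e ⊗ d ≐ 𝟎 ⇛ e ⊗ ⊝ d ≐ 𝟎) (η σ) D (flat (λ t → sym (a t)) (λ t → sym (b t))) }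
      where open LexFacts l

  deepK-sym : ∀ {D W W'} {K : Kind ε W} {K' : Kind ε W'} → Vtx ε W → Vtx ε W' → DeepK D K K' → DeepK (- D) K' K
  deepK-sym {K = new N} {new N'} vt vt' d = deep-sym vt vt' d

  ef-sym : ∀ {D W W'} {K : Kind ε W} {K' : Kind ε W'} → Vtx ε W → Vtx ε W' → EF D K K' → EF (- D) K' K
  ef-sym {D} {K = K} {K'} vt vt' h = record
    { le = le-sym (lev K) (lev K') le
    ; sm = λ q → prove 3 (λ s s' d → sum s' (⊝ s) d ⇛ sum s (⊝ s') (⊝ d)) (sgn K) (sgn K') D (sm (sym q))
    ; dp = λ q s nz → deepK-sym {K = K} {K'} vt vt' (dp (sym q) (sym s) (λ z → nz (trans s z))) }
    where open EF h

  -- All comparisons between the ends of an edge go through old points on a common line of O.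
  ef-hat : ∀ {D D̂ W W'} {K : Kind ε W} {K' : Kind ε W'} {m m'} → lev K ≡ m → lev K' ≡ m' → Le! D̂ m m' →
           (D̂ ≢ zer → D ≡ D̂) → (D̂ ≡ zer → Sum (sgn K') (- sgn K) D) →
           (D̂ ≡ zer → sgn K ≡ sgn K' → sgn K ≢ zer → DeepK D K K') → EF D K K'
  ef-hat {m = m} {m'} refl refl l h s d = record
    { le = le!-le m m' l h ; sm = λ q → s (le!-≡ m m' l q) ; dp = λ q → d (le!-≡ m m' l q) }

  -- f/g is constant on a line through a common zero Y of f and g, because Y itself is the direction
  -- of that line at infinity and f vanishes there.
  apex-level : ∀ {W} (N : New ε W) (let open New N) → Y ‼ g⁺ ≡ zer → Y ‼ f⁺ ≡ zer →
              ∀ {Q Q'} → OldV Q → OldV Q' → Van Q (outside ∷ S) → Van Q' (outside ∷ S) → Q ‼ g⁺ ≡ pos → Q' ‼ g⁺ ≡ pos → Φ Q ≡ Φ Q'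
  apex-level N Yg Yf {Q} {Q'} o o' v v' q q' with any? (λ α → (Q ‼ suc α ≟ₛ zer) ×-dec ¬? (Q' ‼ suc α ≟ₛ zer))
  ... | no h = Lifted.P-≡ isφ {Q} {Q'} v₀ v₀≢ (λ x → trans (sym (tail-‼ Q' x)) (trans (p₀ x) (cong (v₀ ·_) (tail-‼ Q x))))
    where
    u = O.uniq-nz {e = g} {e' = g} (O.coc-R (proj₂ o)) (proj₁ (proj₂ o)) (proj₁ (proj₂ o')) (van-zset (tail Q))
          (van λ x m → trans (tail-‼ Q' x) (decidable-stable (Q' ‼ suc x ≟ₛ zer) (λ z → h (x , trans (sym (tail-‼ Q x)) (zset∈ (tail Q) m) , z))))
          (λ z → pos≢ q (trans (sym (tail-‼ Q g)) z)) (λ z → pos≢ q' (trans (sym (tail-‼ Q' g)) z))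
    v₀ = proj₁ u
    v₀≢ = proj₁ (proj₂ u)
    p₀ = proj₂ (proj₂ u)
  ... | yes (α , Qα , Q'α) = proj₁ (proj₂ c) (trans (scale-‼ w Y f⁺) (·-zero w Yf))
    where
    open New N
    w = Q' ‼ suc α · Y ‼ suc α
    Yα : Y ‼ suc α ≢ zer
    Yα z = let v , h = uniq (r2 (suc α) (⇒∉cl (proj₁ o') v' Q'α)) (proj₁ oY) (proj₁ o) (van-⊕ vY z) (van-⊕ v Qα) Yp≢
           in pos≢ q (trans (h g⁺) (·-zero v Yg))
    c = Lifted.cmp isφ {X = Q} {Q'} {scale w Y} {α} r2 o o' (C-scale w (proj₁ oY)) v v' (van-scale w vY) Qα Q'α
          (trans (scale-‼ w Y (suc α)) (prove 3 (λ a b g → b ≠ 𝟎 ⇛ g ≐ 𝟏 ⇛ a ⊗ b ⊗ b ≐ g ⊗ a) (Q' ‼ suc α) (Y ‼ suc α) (Q' ‼ g⁺) Yα q'))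
          (pos≢ q) (pos≢ q') (trans (scale-‼ w Y g⁺) (·-zero w Yg))

  hat-≡ : ∀ {X X'} v → (∀ h → X' ‼ h ≡ v · X ‼ h) → Hat X → Hat X' → X ≡ X'
  hat-≡ {X} {X'} v e h h' = ext λ x → sym (trans (e x) (cong (_· X ‼ x) (go h h')))
    where
    go : Hat X → Hat X' → v ≡ pos
    go (hfin q) (hfin q') = prove 3 (λ v a b → b ≐ v ⊗ a ⇛ a ≐ 𝟏 ⇛ b ≐ 𝟏 ⇛ v ≐ 𝟏) v _ _ (e g⁺) q q'
    go (hfin q) (hinf q' qf) = ⊥-elim (ε≢ (prove 6 (λ v a b c d ε → b ≐ v ⊗ a ⇛ d ≐ v ⊗ c ⇛ a ≐ 𝟏 ⇛ b ≐ 𝟎 ⇛ d ≐ ε ⇛ ε ≐ 𝟎) v (X ‼ g⁺) (X' ‼ g⁺) (X ‼ f⁺) (X' ‼ f⁺) ε (e g⁺) (e f⁺) q q' qf))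
    go (hinf q qf) (hfin q') = ⊥-elim (prove 3 (λ v a b → b ≐ v ⊗ a ⇛ a ≐ 𝟎 ⇛ b ≐ 𝟏 ⇛ ff) v _ _ (e g⁺) q q')
    go (hinf q qf) (hinf q' qf') = prove 4 (λ v a b ε → b ≐ v ⊗ a ⇛ a ≐ ε ⇛ b ≐ ε ⇛ ε ≠ 𝟎 ⇛ v ≐ 𝟏) v _ _ ε (e f⁺) qf qf' ε≢

  data View {S Y} (b : Base ε S Y) : Set where
    off : (h : Hat Y) → levB b ≡ level h → View b
    apex : Y ‼ g⁺ ≡ zer → Y ‼ f⁺ ≡ zer → ∀ Q → OldV Q → Van Q (outside ∷ S) → Q ‼ g⁺ ≡ pos → levB b ≡ just (Φ Q) → View b

  view : ∀ {S Y} (b : Base ε S Y) → View b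
  view (fin q) = off (hfin q) refl
  view (inf a b) = off (hinf a b) refl
  view (common a b Q o v q) = apex a b Q o v q refl

  any-base : ∀ {W} (N : New ε W) (let open New N) → Y ‼ g⁺ ≡ zer → Y ‼ f⁺ ≡ zer → ∀ {Q} → OldV Q → Van Q (outside ∷ S) → Q ‼ g⁺ ≡ pos →
             lev (new N) ≡ just (Φ Q) → ∀ {Q'} → OldV Q' → Van Q' (outside ∷ S) → Q' ‼ g⁺ ≡ pos → lev (new N) ≡ just (Φ Q')
  any-base N a b o v q L o' v' q' = trans L (cong just (apex-level N a b o o' v v' q q'))

  -- At a common zero Y of f and g the line meets g in Y, so G is a multiple of Y and the correction
  -- term vanishes.
  nonzero-hat : ∀ {W} → Vtx ε W → (N : New ε W) → sgn (new N) ≢ zer → ∃ λ (h : Hat (New.Y N)) → lev (new N) ≡ level h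
  nonzero-hat {W} vt N nz with view (New.base N)
  ... | off h q = h , q
  ... | apex a b _ _ _ _ _ = ⊥-elim (nz (·-zero (- (Y ‼ p)) Gf))
    where
    open New N
    Gf : G 𝒈 ‼ f⁺ ≡ zer
    Gf = let w , e = uniq (r2 g⁺ (⇒∉cl (proj₁ (Vtx.coc vt)) (van-zset⁻ {W}) (pos≢ (Vtx.Wg vt))))
                       (proj₁ oY) (proj₁ (oG 𝒈)) (van-⊕ vY a) (van-⊕ (vG 𝒈) (Gσ 𝒈)) Yp≢
         in trans (e f⁺) (·-zero w b)

-- Adjacent vertices on p

module Planes (Stg : Setting) (ε : Sign) (ε≢ : ε ≢ zer) (Fl : Setting.Flat Stg) where
  open Setting Stg
  open Levels Stg ε ε≢
  open Flat Fl
  open Plane Pl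
  F : Subset (suc n)
  F = outside ∷ F₀

  old-point : ∀ x y {w} → χ (suc x) (suc y) w ≢ zer → OldV (V (suc x) (suc y))
  old-point x y {w} h = old-of (cV (suc x) (suc y))
    (van-⊕ (van-⊕ (vV (suc x) (suc y)) (χ-left (suc x) (suc y))) (χ-right (suc x) (suc y))) (rank1 (suc x) (suc y) w h) (w , h)

  lexχ : ∀ x y → Lex (χ (suc x) (suc y) p) (λ t → χ (suc x) (suc y) (e⁺ t))
  lexχ x y = record
    { at-first = λ t h q → old-first (old-point x y q) t h q
    ; at-none = λ h → none h (χ (suc x) (suc y) p ≟ₛ zer) }
    where
    none : (∀ t → χ (suc x) (suc y) (e⁺ t) ≡ zer) → Dec (χ (suc x) (suc y) p ≡ zer) → χ (suc x) (suc y) p ≡ zer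
    none h (yes q) = q
    none h (no q) = old-none (old-point x y q) h

  -- Opposite in direction to `point`: a known point X on x and y gives the brackets [x y z], all
  -- zero if x and y are dependent.
  dual : ∀ {X x y w} → C' X → Van X F → X ‼ x ≡ zer → X ‼ y ≡ zer → X ‼ w ≢ zer → ∃ λ κ → ∀ z → χ x y z ≡ κ · X ‼ z
  dual {X} {x} {y} {w} c v a b q with nonzero? (V x y)
  ... | no h = zer , λ z → ¬nonzero⇒ {X = V x y} h z
  ... | yes (e , h) =
    let κ , eq = point c v a b h
        κ≢ : κ ≢ zer
        κ≢ z = q (trans (eq w) (cong (_· χ x y w) z))
    in κ , λ z → prove 3 (λ k a b → k ≠ 𝟎 ⇛ a ≐ k ⊗ b ⇛ b ≐ k ⊗ a) κ (X ‼ z) (χ x y z) κ≢ (eq z)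

  -- X is u times the point a ∩ y
  record Pt (a y : Fin (suc n)) (u : Sign) (X : SignVec (suc n)) : Set where
    constructor pt
    field
      o  : OldV X
      v  : Van X F
      eq : ∀ z → X ‼ z ≡ u · χ y z a
  open Pt public

  pt-make : ∀ a₀ y₀ {u w} → u ≢ zer → χ (suc y₀) w (suc a₀) ≢ zer → Pt (suc a₀) (suc y₀) u (scale u (V (suc a₀) (suc y₀)))
  pt-make a₀ y₀ {u} {w} u≢ h = pt
    (old-scale u u≢ (old-point a₀ y₀ {w} (λ z → h (trans (sym (cyc (suc a₀) (suc y₀) w)) z))))
    (van-scale u (vV _ _)) (λ z → trans (scale-‼ u (V (suc a₀) (suc y₀)) z) (cong (u ·_) (cyc (suc a₀) (suc y₀) z)))

  pt-a : ∀ {a y u X} → Pt a y u X → X ‼ a ≡ zer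
  pt-a {a} {y} {u} P = trans (eq P a) (·-zero u (χ-right y a))

  pt-y : ∀ {a y u X} → Pt a y u X → X ‼ y ≡ zer
  pt-y {a} {y} {u} P = trans (eq P y) (·-zero u (self-opposite (anti12 y y a)))

  pt-u : ∀ {a y u X z} → Pt a y u X → X ‼ z ≢ zer → u ≢ zer
  pt-u {a} {y} {u} {z = z} P h q = h (trans (eq P z) (cong (_· χ y z a) q))

  pt-∦ : ∀ {a y u X z} → Pt a y u X → X ‼ z ≢ zer → χ a y z ≢ zer
  pt-∦ {a} {y} {u} {z = z} P h q = h (trans (eq P z) (·-zero u (trans (sym (cyc a y z)) q)))

  same-pt : ∀ {a y y' u u' X X' z} → Pt a y u X → Pt a y' u' X' → χ y y' a ≡ zer → X ‼ z ≢ zer → ∃ λ v → ∀ h → X' ‼ h ≡ v · X ‼ h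
  same-pt {a} {y} {y'} {u} {u'} {X} {X'} {z} P P' q h =
    let w , e = point (proj₁ (o P')) (v P') (pt-a P')
                 (trans (eq P' y) (·-zero u' (trans (anti12 y' y a) (cong -_ q)))) (pt-∦ P h)
    in w · u , λ x → prove 5 (λ w u x x' c → u ≠ 𝟎 ⇛ x' ≐ w ⊗ c ⇛ x ≐ u ⊗ c ⇛ x' ≐ w ⊗ u ⊗ x) w u (X ‼ x) (X' ‼ x) (χ a y x) (pt-u P h) (e x)
                   (trans (eq P x) (cong (u ·_) (sym (cyc a y x))))

  -- For fixed a, [y x][y' q] - [y q][y' x] = [y y'][x q]. Divided by [y x][y' x] this is q/x at X'
  -- minus q/x at X, and u, u', X x, X' x supply the signs of the denominators.
  cmp-line : ∀ {x q φ'} (isφ' : Pot.IsPotential x q φ') a₀ y₀ {y' u u' X X'} → Pt (suc a₀) (suc y₀) u X → Pt (suc a₀) y' u' X' →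
             X ‼ suc x ≢ zer → X' ‼ suc x ≢ zer →
             Cmp (X ‼ suc x · X' ‼ suc x · (u · u' · χ (suc y₀) y' (suc a₀)) · χ (suc x) (suc q) (suc a₀))
                 (Lifted.P isφ' X) (Lifted.P isφ' X')
  cmp-line {x} {q} isφ' a₀ y₀ {y'} {u} {u'} {X} {X'} P P' Xx X'x with χ (suc y₀) y' (suc a₀) ≟ₛ zer
  ... | yes A0 =
    let w , e = same-pt P P' A0 Xx
    in cmp-zer (prove 5 (λ a b u u' c → a ⊗ b ⊗ (u ⊗ u' ⊗ 𝟎) ⊗ c ≐ 𝟎) (X ‼ suc x) (X' ‼ suc x) u u' _ ∙
                 refl) (Lifted.P-≡ isφ' {X} {X'} w (λ z → X'x (trans (e (suc x)) (cong (_· X ‼ suc x) z))) (λ h → e (suc h)))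
    where
    _∙_ : ∀ {b c} → X ‼ suc x · X' ‼ suc x · (u · u' · zer) · b ≡ c → c ≡ zer →
          X ‼ suc x · X' ‼ suc x · (u · u' · χ (suc y₀) y' (suc a₀)) · b ≡ zer
    _∙_ h k rewrite A0 = trans h k
  ... | no A0 = subst (λ s → Cmp s (Lifted.P isφ' X) (Lifted.P isφ' X'))
      (trans (scale-‼ w (V a r) (suc q)) (cong (w ·_) (cyc a r (suc q))))
      (Lifted.cmp isφ' {S = F₀ ⊕ a₀} {X} {X'} {scale w (V a r)} {y₀}
        (r3 a (λ i → pt-∦ P Xx (trans (cyc a y r) (i (V y r) (cV y r) (vV y r)))))
        (o P) (o P') (C-scale w (cV a r)) (van-⊕ (v P) (pt-a P)) (van-⊕ (v P') (pt-a P'))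
        (van-scale w (van-⊕ (vV a r) (χ-left a r))) (pt-y P)
        (λ z → nz· (pt-u P' X'x) (λ k → A0 (trans (anti12 y y' a) (cong -_ k))) (trans (sym (eq P' y)) z))
        (trans (scale-‼ w (V a r) y) (prove 7 (λ xr x'r x'y u u' A c → xr ≠ 𝟎 ⇛ xr ≐ u ⊗ ⊝ c ⇛ x'y ≐ u' ⊗ ⊝ A ⇛ xr ⊗ x'r ⊗ (u ⊗ u' ⊗ A) ⊗ c ≐ x'r ⊗ x'y)
           (X ‼ r) (X' ‼ r) (X' ‼ y) u u' (χ y y' a) (χ a r y) Xx
           (trans (eq P r) (cong (u ·_) (trans (cyc y r a) (trans (cyc r a y) (anti23 a y r)) ))) (trans (eq P' y) (cong (u' ·_) (anti12 y' y a)))))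
        Xx X'x (trans (scale-‼ w (V a r) r) (·-zero w (χ-right a r))))
    where
    a = suc a₀
    y = suc y₀
    r = suc x
    w = X ‼ r · X' ‼ r · (u · u' · χ y y' a)

  pt-swap : ∀ {a y u X} → Pt a y u X → Pt y a (- u) X
  pt-swap {a} {y} {u} P = pt (o P) (v P) λ z → trans (eq P z)
    (prove 3 (λ u a b → a ≐ ⊝ b ⇛ u ⊗ a ≐ ⊝ u ⊗ b) u (χ y z a) (χ a z y) (rev y z a))

  -- The intersection of g and f. `Z a` vanishes if f/g is constant along a.
  Z : Fin (suc n) → Sign
  Z = χ g⁺ f⁺

  -- `cmp-line` for f/g, extended to infinity: a point of a on g determines [a g ·] up to a factor,
  -- and its value ε at f then gives `Z a`.
  hat-line : ∀ a₀ y₀ {y' u u' X X'} → Pt (suc a₀) (suc y₀) u X → Pt (suc a₀) y' u' X' → (h : Hat X) (h' : Hat X') →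
             Le! (u · u' · χ (suc y₀) y' (suc a₀) · Z (suc a₀)) (level h) (level h')
  hat-line a₀ y₀ {y'} {u} {u'} {X} {X'} P P' (hfin q) (hfin q') =
    subst (λ s → Cmp s (Φ X) (Φ X')) (prove 4 (λ a b c d → a ≐ 𝟏 ⇛ b ≐ 𝟏 ⇛ a ⊗ b ⊗ c ⊗ d ≐ c ⊗ d) (X ‼ g⁺) (X' ‼ g⁺) (u · u' · χ (suc y₀) y' (suc a₀)) _ q q')
      (cmp-line isφ a₀ y₀ P P' (pos≢ q) (pos≢ q'))
  hat-line a₀ y₀ {y'} {u} {u'} {X} {X'} P P' (hinf q qf) (hfin q') =
    let a = suc a₀ ; y = suc y₀
        κ , e = dual (proj₁ (o P)) (v P) (pt-a P) q (λ z → ε≢ (trans (sym qf) z))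
    in prove 7 (λ u u' A κ ε B c → u' ⊗ c ≐ 𝟏 ⇛ c ≐ ⊝ (κ ⊗ (u ⊗ A)) ⇛ B ≐ κ ⊗ ε ⇛ u ⊗ u' ⊗ A ⊗ B ≐ ⊝ ε)
         u u' (χ y y' a) κ ε (Z a) (χ y' g⁺ a) (trans (sym (eq P' g⁺)) q')
         (trans (rev y' g⁺ a) (cong -_ (trans (e y') (cong (κ ·_) (eq P y')))))
         (trans (sym (cyc a g⁺ f⁺)) (trans (e f⁺) (cong (κ ·_) qf)))
  hat-line a₀ y₀ {y'} {u} {u'} {X} {X'} P P' (hfin q) (hinf q' qf) =
    let a = suc a₀ ; y = suc y₀
        κ , e = dual (proj₁ (o P')) (v P') (pt-a P') q' (λ z → ε≢ (trans (sym qf) z))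
    in prove 7 (λ u u' A κ ε B c → u ⊗ c ≐ 𝟏 ⇛ c ≐ ⊝ (κ ⊗ (u' ⊗ ⊝ A)) ⇛ B ≐ κ ⊗ ε ⇛ u ⊗ u' ⊗ A ⊗ B ≐ ε)
         u u' (χ y y' a) κ ε (Z a) (χ y g⁺ a) (trans (sym (eq P g⁺)) q)
         (trans (rev y g⁺ a) (cong -_ (trans (e y) (cong (κ ·_) (trans (eq P' y) (cong (u' ·_) (anti12 y' y a)))))))
         (trans (sym (cyc a g⁺ f⁺)) (trans (e f⁺) (cong (κ ·_) qf)))
  hat-line a₀ y₀ {y'} {u} {u'} {X} {X'} P P' (hinf q qf) (hinf q' qf') =
    let a = suc a₀ ; y = suc y₀
        κ , e = dual (proj₁ (o P)) (v P) (pt-a P) q (λ z → ε≢ (trans (sym qf) z))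
        κ' , e' = dual (proj₁ (o P')) (v P') (pt-a P') q' (λ z → ε≢ (trans (sym qf') z))
    in prove 6 (λ u u' A κ ε B → κ ⊗ (u' ⊗ ⊝ A) ≐ 𝟎 ⇛ B ≐ κ ⊗ ε ⇛ u ⊗ u' ⊗ A ⊗ B ≐ 𝟎)
         u u' (χ y y' a) κ' ε (Z a)
         (trans (sym (trans (e' y) (cong (κ' ·_) (trans (eq P' y) (cong (u' ·_) (anti12 y' y a))))))
           (trans (e y) (·-zero κ (pt-y P))))
         (trans (sym (cyc a g⁺ f⁺)) (trans (e' f⁺) (cong (κ' ·_) qf')))

  -- One old zero ℓ of W represents its line, since modulo F every old zero of W depends on ℓ. The
  -- points W, Y and G become intersections of ℓ with p, e_i and g or f, oriented through the single
  -- sign s.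
  record NF {W} (N : New ε W) (s : Sign) (ℓ₀ : Fin n) : Set where
    open New N
    ℓ = suc ℓ₀
    field
      s≢  : s ≢ zer
      Wx  : ∀ x → W ‼ x ≡ s · χ ℓ x p
      PY  : Pt (e⁺ i) ℓ s Y
      PG  : ∀ σ → Pt (elt σ) ℓ (- (s · W ‼ elt σ)) (G σ)
      par : ∀ h → W ‼ suc h ≡ zer → ∀ x → χ ℓ (suc h) x ≡ zer
    on : ∀ {u y X} → Pt y ℓ u X → Van X (outside ∷ S)
    on {u} {y} P = van λ { (suc x) (there m) → trans (eq P (suc x)) (·-zero u (par x (W0 x m) y)) }
      where
      W0 : ∀ x → x ∈ S → W ‼ suc x ≡ zer
      W0 x m = at (van-zset⁻ {W}) (suc x) (there m)

  frame : ∀ {W} (vt : Vtx ε W) (N : New ε W) (ℓ₀ : Fin n) → Van W F → W ‼ suc ℓ₀ ≡ zer → ∀ {w} → χ p (suc ℓ₀) w ≢ zer → ∃ λ s → NF N s ℓ₀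
  frame {W} vt N ℓ₀ vW Wℓ nz = s , record { s≢ = s≢ ; Wx = Wx ; PY = PY ; PG = PG ; par = par }
    where
    open New N
    open Vtx vt hiding (ε≢)
    ℓ = suc ℓ₀
    sp = point (proj₁ coc) vW Wp Wℓ nz
    s = proj₁ sp
    Wx : ∀ x → W ‼ x ≡ s · χ ℓ x p
    Wx x = trans (proj₂ sp x) (cong (s ·_) (cyc p ℓ x))
    s≢ : s ≢ zer
    s≢ z = pos≢ Wg (trans (Wx g⁺) (cong (_· χ ℓ g⁺ p) z))
    toF : ∀ {X} → Van X (outside ∷ S) → Van X F
    toF v = van λ { (suc h) (there m) → at v (suc h) (there (∈tail-zset W (at vW (suc h) (there m)))) }
    toℓ : ∀ {X} → Van X (outside ∷ S) → X ‼ ℓ ≡ zer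
    toℓ v = at v ℓ (there (∈tail-zset W Wℓ))
    Wσ : ∀ σ → W ‼ elt σ ≢ zer
    Wσ 𝒈 = pos≢ Wg
    Wσ 𝒇 z = ε≢ (trans (sym Wf) z)
    par : ∀ h → W ‼ suc h ≡ zer → ∀ x → χ ℓ (suc h) x ≡ zer
    par h q x with χ ℓ (suc h) x ≟ₛ zer
    ... | yes z = z
    -- Two independent old zeros of W would already determine the point W, and p would lie in the
    -- closure of the old zeros.
    ... | no z = ⊥-elim (p∉ λ X c v →
      let w , e = point c (toF v) (toℓ v) (at v (suc h) (there (∈tail-zset W q))) z
      in prove 4 (λ w x c s → s ≠ 𝟎 ⇛ s ⊗ c ≐ 𝟎 ⇛ x ≐ w ⊗ c ⇛ x ≐ 𝟎) w (X ‼ p) (χ ℓ (suc h) p) s s≢ (trans (sym (Wx (suc h))) q) (e p))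
    c = e⁺ i
    PY : Pt c ℓ s Y
    PY =
      let w , e = point {w = p} (proj₁ oY) (toF vY) Yi (toℓ vY)
            (λ z → Wi (prove 4 (λ x s a b → x ≐ s ⊗ a ⇛ b ≐ ⊝ a ⇛ b ≐ 𝟎 ⇛ x ≐ 𝟎) (W ‼ c) s (χ ℓ c p) (χ c ℓ p) (Wx c) (anti12 c ℓ p) z))
          w≡ = prove 6 (λ w s x y a b → x ≐ s ⊗ a ⇛ x ≠ 𝟎 ⇛ y ≐ ⊝ x ⇛ y ≐ w ⊗ b ⇛ b ≐ ⊝ a ⇛ w ≐ s) w s (W ‼ c) (Y ‼ p) (χ ℓ c p) (χ c ℓ p) (Wx c) Wi Yp (e p) (anti12 c ℓ p)
      in pt oY (toF vY) λ z → trans (e z) (cong₂ _·_ w≡ (cyc c ℓ z))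
    PG : ∀ σ → Pt (elt σ) ℓ (- (s · W ‼ elt σ)) (G σ)
    PG σ =
      let r = elt σ
          w , e = point {w = p} (proj₁ (oG σ)) (toF (vG σ)) (Gσ σ) (toℓ (vG σ))
            (λ z → Wσ σ (prove 4 (λ x s a b → x ≐ s ⊗ a ⇛ b ≐ ⊝ a ⇛ b ≐ 𝟎 ⇛ x ≐ 𝟎) (W ‼ r) s (χ ℓ r p) (χ r ℓ p) (Wx r) (anti12 r ℓ p) z))
          w≡ = prove 6 (λ w s x y a b → x ≐ s ⊗ a ⇛ x ≠ 𝟎 ⇛ y ≐ 𝟏 ⇛ y ≐ w ⊗ b ⇛ b ≐ ⊝ a ⇛ w ≐ ⊝ (s ⊗ x)) w s (W ‼ r) (G σ ‼ p) (χ ℓ r p) (χ r ℓ p) (Wx r) (Wσ σ) (Gp σ) (e p) (anti12 r ℓ p)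
      in pt (oG σ) (toF (vG σ)) λ z → trans (e z) (cong₂ _·_ w≡ (cyc r ℓ z))

  Gf : ∀ {W} {N : New ε W} {s ℓ₀} → Vtx ε W → NF N s ℓ₀ → New.G N 𝒈 ‼ f⁺ ≡ s · Z (suc ℓ₀)
  Gf {W} {N} {s} {ℓ₀} vt A = trans (eq (NF.PG A 𝒈) f⁺)
    (prove 4 (λ s w a b → w ≐ 𝟏 ⇛ a ≐ ⊝ b ⇛ ⊝ (s ⊗ w) ⊗ a ≐ s ⊗ b) s (W ‼ g⁺) (χ (suc ℓ₀) f⁺ g⁺) (Z (suc ℓ₀)) (Vtx.Wg vt) (rev (suc ℓ₀) f⁺ g⁺))

  Gg : ∀ {W} {N : New ε W} {s ℓ₀} → Vtx ε W → NF N s ℓ₀ → New.G N 𝒇 ‼ g⁺ ≡ - (ε · New.G N 𝒈 ‼ f⁺)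
  Gg {W} {N} {s} {ℓ₀} vt A = trans (eq (NF.PG A 𝒇) g⁺)
    (prove 6 (λ s w a b e x → w ≐ e ⇛ a ≐ b ⇛ x ≐ s ⊗ b ⇛ ⊝ (s ⊗ w) ⊗ a ≐ ⊝ (e ⊗ x)) s (W ‼ f⁺) (χ (suc ℓ₀) g⁺ f⁺) (Z (suc ℓ₀)) ε (New.G N 𝒈 ‼ f⁺)
      (Vtx.Wf vt) (cyc (suc ℓ₀) g⁺ f⁺) (Gf vt A))

  apex-Z : ∀ {W} {N : New ε W} {s ℓ₀} → NF N s ℓ₀ → New.Y N ‼ g⁺ ≡ zer → New.Y N ‼ f⁺ ≡ zer → ∃ λ κ → ∀ z → Z z ≡ κ · New.Y N ‼ z
  apex-Z {N = N} A a b = dual {w = p} (proj₁ (o (NF.PY A))) (v (NF.PY A)) a b (New.Yp≢ N)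

  apex-sgn : ∀ {W} {N : New ε W} {s ℓ₀} → Vtx ε W → NF N s ℓ₀ → New.Y N ‼ g⁺ ≡ zer → New.Y N ‼ f⁺ ≡ zer → sgn (new N) ≡ zer
  apex-sgn {N = N} {s} {ℓ₀} vt A a b =
    let κ , e = apex-Z A a b
    in prove 6 (λ y x s z k q → x ≐ s ⊗ z ⇛ z ≐ k ⊗ q ⇛ q ≐ 𝟎 ⇛ ⊝ y ⊗ x ≐ 𝟎) (New.Y N ‼ p) (New.G N 𝒈 ‼ f⁺) s (Z (suc ℓ₀)) κ (New.Y N ‼ suc ℓ₀) (Gf vt A) (e (suc ℓ₀)) (pt-y (NF.PY A))

  sameW : ∀ {W W'} → Vtx ε W → Vtx ε W' → ∀ σ → W ‼ elt σ ≡ W' ‼ elt σ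
  sameW vt vt' 𝒈 = trans (Vtx.Wg vt) (sym (Vtx.Wg vt'))
  sameW vt vt' 𝒇 = trans (Vtx.Wf vt) (sym (Vtx.Wf vt'))

  -- Two new vertices in a plane

  module Pair {W W' : SignVec (suc n)} (vt : Vtx ε W) (vt' : Vtx ε W') (N : New ε W) (N' : New ε W') {s s' : Sign} {ℓ₀ ℓ₀' : Fin n}
    (A : NF N s ℓ₀) (A' : NF N' s' ℓ₀') {D : Sign} (Deq : D ≡ s · s' · χ (suc ℓ₀) (suc ℓ₀') p · Z p) where
    open New N
    open New N' using () renaming (Y to Y'; G to G'; i to i')
    ℓ ℓ' : Fin (suc n)
    ℓ = suc ℓ₀
    ℓ' = suc ℓ₀'

    zσ : Side → Fin (suc n) → Sign
    zσ σ = χ (elt σ) (elt (opp σ))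

    ηD : ∀ σ → η σ · D ≡ s · s' · χ ℓ ℓ' p · zσ σ p
    ηD 𝒈 = Deq
    ηD 𝒇 = prove 6 (λ d s s' m z z' → d ≐ s ⊗ s' ⊗ m ⊗ z ⇛ z' ≐ ⊝ z ⇛ ⊝ d ≐ s ⊗ s' ⊗ m ⊗ z') D s s' (χ ℓ ℓ' p) (Z p) (zσ 𝒇 p) Deq (anti12 f⁺ g⁺ p)

    sameG : Y ‼ p ≡ Y' ‼ p → sgn (new N) ≡ sgn (new N') → ∀ σ → G σ ‼ elt (opp σ) ≡ G' σ ‼ elt (opp σ)
    sameG q e 𝒈 = prove 4 (λ y y' a b → y ≐ y' ⇛ y ≠ 𝟎 ⇛ ⊝ y ⊗ a ≐ ⊝ y' ⊗ b ⇛ a ≐ b) (Y ‼ p) (Y' ‼ p) _ _ q (Yp≢) e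
    sameG q e 𝒇 = trans (Gg vt A) (trans (cong (λ x → - (ε · x)) (sameG q e 𝒈)) (sym (Gg vt' A')))

    G≢ : sgn (new N) ≢ zer → ∀ σ → G σ ‼ elt (opp σ) ≢ zer
    G≢ h 𝒈 z = h (·-zero (- (Y ‼ p)) z)
    G≢ h 𝒇 z = G≢ h 𝒈 (prove 2 (λ e x → e ≠ 𝟎 ⇛ ⊝ (e ⊗ x) ≐ 𝟎 ⇛ x ≐ 𝟎) ε (G 𝒈 ‼ f⁺) ε≢ (trans (sym (Gg vt A)) z))

    Y-side : ∀ σ → Y ‼ elt σ ≢ zer → Y ‼ elt σ ≡ W ‼ elt σ
    Y-side σ = near (elt₀ σ)

    cmpG : ∀ σ → sgn (new N) ≢ zer → G σ ‼ elt (opp σ) ≡ G' σ ‼ elt (opp σ) → W ‼ elt σ ≢ zer → ∀ t →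
           Cmp (s · s' · χ ℓ ℓ' (elt σ) · zσ σ (e⁺ t)) (Ψ (opp σ) t (G σ)) (Ψ (opp σ) t (G' σ))
    cmpG σ h q Wr t = subst (λ x → Cmp x (Ψ (opp σ) t (G σ)) (Ψ (opp σ) t (G' σ)))
      (prove 8 (λ a b s s' w m z z' → a ≠ 𝟎 ⇛ a ≐ b ⇛ w ≠ 𝟎 ⇛ z ≐ z' ⇛ a ⊗ b ⊗ (⊝ (s ⊗ w) ⊗ ⊝ (s' ⊗ w) ⊗ m) ⊗ z ≐ s ⊗ s' ⊗ m ⊗ z')
        (G σ ‼ elt (opp σ)) (G' σ ‼ elt (opp σ)) s s' (W ‼ elt σ) (χ ℓ ℓ' (elt σ)) (χ (elt (opp σ)) (e⁺ t) (elt σ)) (zσ σ (e⁺ t))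
        (G≢ h σ) q Wr (sym (cyc (elt σ) (elt (opp σ)) (e⁺ t))))
      (subst (λ w → Cmp (G σ ‼ elt (opp σ) · G' σ ‼ elt (opp σ) · (- (s · W ‼ elt σ) · - (s' · w) · χ ℓ ℓ' (elt σ)) · χ (elt (opp σ)) (e⁺ t) (elt σ)) (Ψ (opp σ) t (G σ)) (Ψ (opp σ) t (G' σ)))
        (sym (sameW vt vt' σ))
        (cmp-line (isψ (opp σ) t) (elt₀ σ) ℓ₀ (NF.PG A σ) (NF.PG A' σ) (G≢ h σ) (λ z → G≢ h σ (trans q z))))

    lexσ : ∀ σ → Lex (zσ σ p) (λ t → zσ σ (e⁺ t))
    lexσ σ = lexχ (elt₀ σ) (elt₀ (opp σ))

    -- Both lines pass through Y, so [ℓ ℓ' ·] is a multiple of Y, and f/g can change only through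
    -- the factor (f/p)(G).
    module SameBase (Y≡ : Y ≡ Y') (Mp : χ ℓ ℓ' p ≢ zer) where
      lam = dual {w = p} (proj₁ (o (NF.PY A))) (v (NF.PY A)) (pt-y (NF.PY A)) (trans (cong (_‼ ℓ') Y≡) (pt-y (NF.PY A'))) (Yp≢)
      λ' = proj₁ lam
      M≡ : ∀ z → χ ℓ ℓ' z ≡ λ' · Y ‼ z
      M≡ = proj₂ lam
      λ≢ : λ' ≢ zer
      λ≢ z = Mp (trans (M≡ p) (cong (_· Y ‼ p) z))

      -- G and G' lie on the same element r and are positive at p, so their difference is the
      -- intersection of p and r up to sign. The sign is read at ℓ, where G vanishes.
      slope : ∀ σ → Y ‼ elt σ ≢ zer → Sum (- (G σ ‼ elt (opp σ))) (G' σ ‼ elt (opp σ)) (- (s · s' · λ' · W ‼ elt σ) · zσ σ p)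
      slope σ Yr =
        let r = elt σ
            ρ = W ‼ r
            U , cU , vU , Up , Us = det (G σ) (G' σ) p (proj₁ (oG σ)) (proj₁ (New.oG N' σ)) (v (NF.PG A σ)) (v (NF.PG A' σ))
            Us' = λ h → subst₂ (λ a b → Sum (- b · G σ ‼ h) (a · G' σ ‼ h) (U ‼ h)) (Gp σ) (New.Gp N' σ) (Us h)
            Yr≡ = Y-side σ Yr
            ρ≢ = λ z → Yr (trans Yr≡ z)
            Ur = trans (proj₁ (Us' r) (cong -_ (Gσ σ))) (New.Gσ N' σ)
            pr : χ p r ℓ ≡ - χ ℓ r p
            pr = rev p r ℓ
            w , e = point {w = ℓ} cU vU Up Ur (λ z → ρ≢ (prove 4 (λ x s a b → x ≐ s ⊗ a ⇛ b ≐ ⊝ a ⇛ b ≐ 𝟎 ⇛ x ≐ 𝟎) ρ s (χ ℓ r p) (χ p r ℓ) (NF.Wx A r) pr z))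
            Uℓ = proj₁ (Us' ℓ) (cong -_ (pt-y (NF.PG A σ)))
            G'ℓ : G' σ ‼ ℓ ≡ - (s' · ρ) · - (λ' · ρ)
            G'ℓ = trans (eq (NF.PG A' σ) ℓ) (cong₂ (λ a b → - (s' · a) · b) (sym (sameW vt vt' σ)) (trans (anti12 ℓ' ℓ r) (cong -_ (trans (M≡ r) (cong (λ' ·_) Yr≡)))))
            w≡ : w ≡ - (s · s' · λ' · ρ)
            w≡ = prove 6 (λ w c s s' l r → w ⊗ ⊝ c ≐ ⊝ (s' ⊗ r) ⊗ ⊝ (l ⊗ r) ⇛ r ≐ s ⊗ c ⇛ r ≠ 𝟎 ⇛ w ≐ ⊝ (s ⊗ s' ⊗ l ⊗ r)) w (χ ℓ r p) s s' λ' ρ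
                   (trans (sym (trans (e ℓ) (cong (w ·_) pr))) (trans Uℓ G'ℓ)) (NF.Wx A r) ρ≢
        in subst (Sum _ _) (trans (e (elt (opp σ))) (cong₂ _·_ w≡ (cyc p r (elt (opp σ))))) (Us' (elt (opp σ)))

      sum-same : Hat Y → Sum (sgn (new N')) (- sgn (new N)) D
      sum-same (hfin q) = subst₂ (λ y d → Sum (- y · G' 𝒈 ‼ f⁺) (- sgn (new N)) d) (cong (_‼ p) Y≡) (sym (trans Deq (cong (λ m → s · s' · m · Z p) (M≡ p))))
        (prove 8 (λ y a a' s s' l z w → y ≠ 𝟎 ⇛ w ≐ 𝟏 ⇛ sum (⊝ a) a' (⊝ (s ⊗ s' ⊗ l ⊗ w) ⊗ z) ⇛ sum (⊝ y ⊗ a') (⊝ (⊝ y ⊗ a)) (s ⊗ s' ⊗ (l ⊗ y) ⊗ z))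
          (Y ‼ p) (G 𝒈 ‼ f⁺) (G' 𝒈 ‼ f⁺) s s' λ' (Z p) (W ‼ g⁺) (Yp≢) (Vtx.Wg vt) (slope 𝒈 (pos≢ q)))
      sum-same (hinf _ q) = subst₂ (λ y d → Sum (- y · G' 𝒈 ‼ f⁺) (- sgn (new N)) d) (cong (_‼ p) Y≡) (sym (trans Deq (cong (λ m → s · s' · m · Z p) (M≡ p))))
        (prove 8 (λ y a a' s s' l z e → y ≠ 𝟎 ⇛ e ≠ 𝟎 ⇛ sum (⊝ (⊝ (e ⊗ a))) (⊝ (e ⊗ a')) (⊝ (s ⊗ s' ⊗ l ⊗ e) ⊗ ⊝ z) ⇛ sum (⊝ y ⊗ a') (⊝ (⊝ y ⊗ a)) (s ⊗ s' ⊗ (l ⊗ y) ⊗ z))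
          (Y ‼ p) (G 𝒈 ‼ f⁺) (G' 𝒈 ‼ f⁺) s s' λ' (Z p) ε (Yp≢) ε≢
          (subst₂ (λ a b → Sum (- a) b (- (s · s' · λ' · ε) · - (Z p))) (Gg vt A) (Gg vt' A')
            (subst₂ (λ w z → Sum (- (G 𝒇 ‼ g⁺)) (G' 𝒇 ‼ g⁺) (- (s · s' · λ' · w) · z)) (Vtx.Wf vt) (anti12 f⁺ g⁺ p) (slope 𝒇 (λ z → ε≢ (trans (sym q) z))))))

      deep-same : sgn (new N) ≡ sgn (new N') → sgn (new N) ≢ zer → Deep D N N'
      deep-same e h = record { sameY = sY ; lexf = λ σ Yr _ → lf σ Yr }
        where
        sY = cong (_‼ p) Y≡
        lf : ∀ σ → Y ‼ elt σ ≢ zer → LexFacts σ (η σ · D) N N'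
        lf σ Yr = record
          { sameG = sG
          ; key₁ = λ t _ → wk-≡ (cong (Ψ σ t) Y≡)
          ; key₂ = λ _ t q → subst (λ x → Wk x _ _)
                     (prove 6 (λ s s' l y z w → y ≠ 𝟎 ⇛ s ⊗ s' ⊗ (l ⊗ w) ⊗ z ≐ w ⊗ y ⊗ (s ⊗ s' ⊗ (l ⊗ y) ⊗ z)) s s' λ' (Y ‼ p) (zσ σ p) (W ‼ elt σ) (Yp≢)
                       ∙ cong (W ‼ elt σ · Y ‼ p ·_) (sym (trans (ηD σ) (cong (λ m → s · s' · m · zσ σ p) (M≡ p)))))
                     (lex-wk (lexσ σ) A≢ cm t q)
          ; flat = λ _ q → trans (ηD σ) (·-zero (s · s' · χ ℓ ℓ' p) (at-none (lexσ σ) (lex-eq (lexσ σ) A≢ cm q))) }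
          where
          _∙_ : ∀ {a b c : Sign} → a ≡ b → b ≡ c → a ≡ c
          _∙_ = trans
          sG = sameG sY e σ
          Wr : W ‼ elt σ ≢ zer
          Wr z = Yr (trans (Y-side σ Yr) z)
          A≢ : s · s' · (λ' · W ‼ elt σ) ≢ zer
          A≢ = nz· (nz· (NF.s≢ A) (NF.s≢ A')) (nz· λ≢ Wr)
          cm : ∀ t → Cmp (s · s' · (λ' · W ‼ elt σ) · zσ σ (e⁺ t)) (Ψ (opp σ) t (G σ)) (Ψ (opp σ) t (G' σ))
          cm t = subst (λ m → Cmp (s · s' · m · zσ σ (e⁺ t)) _ _) (trans (M≡ (elt σ)) (cong (λ' ·_) (Y-side σ Yr))) (cmpG σ h sG Wr t)

  both-sides : ∀ {X X' D} (h : Hat X) (h' : Hat X') → Le! D (level h) (level h') → D ≡ zer → ∃ λ σ → X ‼ elt σ ≢ zer × X' ‼ elt σ ≢ zer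
  both-sides (hfin q) (hfin q') l z = 𝒈 , pos≢ q , pos≢ q'
  both-sides (hinf _ q) (hinf _ q') l z = 𝒇 , (λ z → ε≢ (trans (sym q) z)) , λ z → ε≢ (trans (sym q') z)
  both-sides (hfin q) (hinf _ _) l z = ⊥-elim (ε≢ (trans (sym l) z))
  both-sides (hinf _ _) (hfin q) l z = ⊥-elim (ε≢ (prove 1 (λ e → ⊝ e ≐ 𝟎 ⇛ e ≐ 𝟎) ε (trans (sym l) z)))

  hat-not-zero : ∀ {X} → Hat X → X ‼ g⁺ ≡ zer → X ‼ f⁺ ≡ zer → ⊥
  hat-not-zero (hfin q) a b = pos≢ q a
  hat-not-zero (hinf _ q) a b = ε≢ (trans (sym q) b)

  hat-not-multiple : ∀ {X X' w} v → Hat X → (∀ h → X' ‼ h ≡ v · X ‼ h) → X' ‼ w ≢ zer → X' ‼ g⁺ ≡ zer → X' ‼ f⁺ ≡ zer → ⊥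
  hat-not-multiple {X} {X'} {w} v h e nz a b = hat-not-zero h (z g⁺ a) (z f⁺ b)
    where
    z : ∀ x → X' ‼ x ≡ zer → X ‼ x ≡ zer
    z x q = prove 5 (λ v a b c d → a ≐ v ⊗ b ⇛ c ≐ v ⊗ d ⇛ c ≠ 𝟎 ⇛ a ≐ 𝟎 ⇛ b ≐ 𝟎) v (X' ‼ x) (X ‼ x) (X' ‼ w) (X ‼ w) (e x) (e w) nz q

  module PairCases {W W' : SignVec (suc n)} (vt : Vtx ε W) (vt' : Vtx ε W') (N : New ε W) (N' : New ε W') {s s' : Sign} {ℓ₀ ℓ₀' : Fin n}
    (A : NF N s ℓ₀) (A' : NF N' s' ℓ₀') {D : Sign} (Deq : D ≡ s · s' · χ (suc ℓ₀) (suc ℓ₀') p · Z p) where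
    open Pair vt vt' N N' A A' Deq public
    open New N
    open New N' using () renaming (Y to Y'; G to G'; i to i')
    open NF A using (PY; Wx)

    all-zero : sgn (new N) ≡ zer → sgn (new N') ≡ zer → D ≡ zer → Sum (sgn (new N')) (- sgn (new N)) D
    all-zero a b c = prove 3 (λ s s' d → s ≐ 𝟎 ⇛ s' ≐ 𝟎 ⇛ d ≐ 𝟎 ⇛ sum s' (⊝ s) d) (sgn (new N)) (sgn (new N')) D a b c

    -- Distinct points of a = e_i have equal levels only if [g f a] = 0. Then [g f ·] is a multiple
    -- w of [a g ·], and G has the value -w at f for both vertices, likewise with f and g exchanged.
    -- What distinguishes the ends is e_t/g, or e_t/f, at Y and Y'.
    module DistinctBases (a≡ : e⁺ i' ≡ e⁺ i) (Yp≡ : Y ‼ p ≡ Y' ‼ p) (Ma : χ ℓ ℓ' (e⁺ i) ≢ zer) (Mp≡ : χ ℓ ℓ' p ≡ χ ℓ ℓ' (e⁺ i)) (Za : Z (e⁺ i) ≡ zer) where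
      a = e⁺ i
      PY' : Pt a ℓ' s' Y'
      PY' = subst (λ x → Pt x ℓ' s' Y') a≡ (NF.PY A')

      module _ (σ : Side) (Yr : Y ‼ elt σ ≢ zer) (Y'r : Y' ‼ elt σ ≢ zer) where
        private
          r = elt σ
          r̄ = elt (opp σ)
        zσa : ∀ σ → zσ σ a ≡ zer
        zσa 𝒈 = Za
        zσa 𝒇 = trans (anti12 f⁺ g⁺ a) (cong -_ Za)
        Yr≡ = Y-side σ Yr
        Y'r≡ : Y' ‼ r ≡ W' ‼ r
        Y'r≡ = New.near N' (elt₀ σ) Y'r
        V≡ = point {w = ℓ} (cV r r̄) (vV r r̄) (zσa σ) (χ-left r r̄)
               (λ z → Yr (trans (eq PY r) (·-zero s (trans (rev ℓ r a) (cong -_ z)))))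
        w = proj₁ V≡
        z≡ : ∀ x → zσ σ x ≡ w · χ a r x
        z≡ = proj₂ V≡
        atG : ∀ {t m X Wr Yr'} → Pt a m t X → X ‼ r ≡ Yr' → Yr' ≡ Wr → Yr' ≢ zer → - (t · Wr) · χ m r̄ r ≡ - w
        atG {t} {m} {X} {Wr} {Yr'} P e₁ e₂ nz =
          prove 7 (λ v c s w y zl x → y ≐ w ⇛ y ≠ 𝟎 ⇛ y ≐ s ⊗ ⊝ c ⇛ zl ≐ v ⊗ c ⇛ x ≐ ⊝ zl ⇛ ⊝ (s ⊗ w) ⊗ x ≐ ⊝ v)
            w (χ a r m) t Wr Yr' (zσ σ m) (χ m r̄ r) e₂ nz (trans (sym e₁) (trans (eq P r) (cong (t ·_) (rev m r a)))) (z≡ m) (rev m r̄ r)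
        Gr : G σ ‼ r̄ ≡ - w
        Gr = trans (eq (NF.PG A σ) r̄) (atG PY refl Yr≡ Yr)
        G'r : G' σ ‼ r̄ ≡ - w
        G'r = trans (eq (NF.PG A' σ) r̄) (atG PY' refl Y'r≡ Y'r)
        zp0 : w ≡ zer → zσ σ p ≡ zer
        zp0 q = trans (z≡ p) (cong (_· χ a r p) q)

      Zp-of : ∀ σ → zσ σ p ≡ zer → Z p ≡ zer
      Zp-of 𝒈 q = q
      Zp-of 𝒇 q = trans (anti12 g⁺ f⁺ p) (cong -_ q)

      D0 : Z p ≡ zer → D ≡ zer
      D0 q = trans Deq (·-zero (s · s' · χ ℓ ℓ' p) q)

      -- The correction signs agree. If they are nonzero, `Sum` allows every D; if they vanish, w =
      -- 0, so [g f p] and D vanish.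
      sum-distinct : ∀ σ → Y ‼ elt σ ≢ zer → Y' ‼ elt σ ≢ zer → Sum (sgn (new N')) (- sgn (new N)) D
      sum-distinct σ Yr Y'r = prove 5 (λ y y' a a' d → y ≠ 𝟎 ⇛ y ≐ y' ⇛ a ≐ a' ⇛ (a ≐ 𝟎 ⇛ d ≐ 𝟎) ⇛ sum (⊝ y' ⊗ a') (⊝ (⊝ y ⊗ a)) d)
                        (Y ‼ p) (Y' ‼ p) (G 𝒈 ‼ f⁺) (G' 𝒈 ‼ f⁺) D Yp≢ Yp≡ (same σ Yr Y'r) (λ q → D0 (Zp-of σ (zp0 σ Yr Y'r (w0 σ Yr Y'r q))))
        where
        same : ∀ σ → Y ‼ elt σ ≢ zer → Y' ‼ elt σ ≢ zer → G 𝒈 ‼ f⁺ ≡ G' 𝒈 ‼ f⁺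
        same 𝒈 a b = trans (Gr 𝒈 a b) (sym (G'r 𝒈 a b))
        same 𝒇 a b = prove 3 (λ e x y → e ≠ 𝟎 ⇛ ⊝ (e ⊗ x) ≐ ⊝ (e ⊗ y) ⇛ x ≐ y) ε _ _ ε≢ (trans (sym (Gg vt A)) (trans (trans (Gr 𝒇 a b) (sym (G'r 𝒇 a b))) (Gg vt' A')))
        w0 : ∀ σ (a : Y ‼ elt σ ≢ zer) (b : Y' ‼ elt σ ≢ zer) → G 𝒈 ‼ f⁺ ≡ zer → w σ a b ≡ zer
        w0 𝒈 a b q = prove 2 (λ x w → x ≐ ⊝ w ⇛ x ≐ 𝟎 ⇛ w ≐ 𝟎) _ (w 𝒈 a b) (Gr 𝒈 a b) q
        w0 𝒇 a b q = prove 3 (λ e x w → ⊝ (e ⊗ x) ≐ ⊝ w ⇛ x ≐ 𝟎 ⇛ w ≐ 𝟎) ε (G 𝒈 ‼ f⁺) (w 𝒇 a b) (trans (sym (Gg vt A)) (Gr 𝒇 a b)) q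

      deep-distinct : sgn (new N) ≡ sgn (new N') → sgn (new N) ≢ zer → Deep D N N'
      deep-distinct e h = record { sameY = Yp≡ ; lexf = lf }
        where
        lf : ∀ σ → Y ‼ elt σ ≢ zer → Y' ‼ elt σ ≢ zer → LexFacts σ (η σ · D) N N'
        lf σ Yr Y'r = record
          { sameG = sG
          ; key₁ = λ t q → subst (λ x → Wk x _ _) key-sign (lex-wk (lexσ σ) A≢ cm t q)
          -- Equal slopes at Y and Y' for all t make every [g f e_t] vanish, and this equates the
          -- slopes at G and G' as well.
          ; key₂ = λ q t _ → wk-≡ (proj₁ (proj₂ (cmpG σ h sG Wr t)) (·-zero (s · s' · χ ℓ ℓ' (elt σ)) (z0 q t)))
          ; flat = λ q _ → trans (ηD σ) (·-zero (s · s' · χ ℓ ℓ' p) (at-none (lexσ σ) (z0 q))) }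
          where
          r = elt σ
          ω = w σ Yr Y'r
          sG = trans (Gr σ Yr Y'r) (sym (G'r σ Yr Y'r))
          ω≢ : ω ≢ zer
          ω≢ z = G≢ h σ (trans (Gr σ Yr Y'r) (cong -_ z))
          Wr : W ‼ r ≢ zer
          Wr z = Yr (trans (Y-side σ Yr) z)
          A≢ : s · s' · χ ℓ ℓ' a · ω ≢ zer
          A≢ = nz· (nz· (nz· (NF.s≢ A) (NF.s≢ A')) Ma) ω≢
          cm : ∀ t → Cmp (s · s' · χ ℓ ℓ' a · ω · zσ σ (e⁺ t)) (Ψ σ t Y) (Ψ σ t Y')
          cm t = subst (λ x → Cmp x (Ψ σ t Y) (Ψ σ t Y'))
            (prove 8 (λ y y' s s' m c z v → y ≐ y' ⇛ y ≠ 𝟎 ⇛ v ≠ 𝟎 ⇛ z ≐ v ⊗ c ⇛ y ⊗ y' ⊗ (s ⊗ s' ⊗ m) ⊗ c ≐ s ⊗ s' ⊗ m ⊗ v ⊗ z)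
              (Y ‼ r) (Y' ‼ r) s s' (χ ℓ ℓ' a) (χ r (e⁺ t) a) (zσ σ (e⁺ t)) ω
              (trans (Y-side σ Yr) (trans (sameW vt vt' σ) (sym (Y'r≡ σ Yr Y'r)))) Yr ω≢ (trans (z≡ σ Yr Y'r (e⁺ t)) (cong (ω ·_) (cyc a r (e⁺ t)))))
            (cmp-line (isψ σ t) (es i) ℓ₀ PY PY' Yr Y'r)
          z0 : (∀ t → Ψ σ t Y ≡ Ψ σ t Y') → ∀ t → zσ σ (e⁺ t) ≡ zer
          z0 = lex-eq (lexσ σ) A≢ cm
          key-sign : s · s' · χ ℓ ℓ' a · ω · zσ σ p ≡ - (G σ ‼ elt (opp σ)) · (η σ · D)
          key-sign = trans (prove 6 (λ s s' m v z g → g ≐ ⊝ v ⇛ s ⊗ s' ⊗ m ⊗ v ⊗ z ≐ ⊝ g ⊗ (s ⊗ s' ⊗ m ⊗ z)) s s' (χ ℓ ℓ' a) ω (zσ σ p) (G σ ‼ elt (opp σ)) (Gr σ Yr Y'r))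
            (cong (- (G σ ‼ elt (opp σ)) ·_) (sym (trans (ηD σ) (cong (λ m → s · s' · m · zσ σ p) Mp≡))))

    -- Both vertices lie next to the point where f and g meet; the level there is read off on any e_j missing it.
    apex-apex : Y ‼ g⁺ ≡ zer → Y ‼ f⁺ ≡ zer → Y' ‼ g⁺ ≡ zer → Y' ‼ f⁺ ≡ zer → Y ‼ ℓ' ≡ zer →
              (∀ {Q} → OldV Q → Van Q (outside ∷ S) → Q ‼ g⁺ ≡ pos → lev (new N) ≡ just (Φ Q)) →
              (∀ {Q} → OldV Q → Van Q (outside ∷ New.S N') → Q ‼ g⁺ ≡ pos → lev (new N') ≡ just (Φ Q)) → EF D (new N) (new N')
    apex-apex a b a' b' Yℓ' L L' with first-nonzero (λ t → Y ‼ e⁺ t)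
    ... | inj₁ h = ⊥-elim (Yp≢ (old-none oY h))
    ... | inj₂ (j , _ , Yx) =
      ef-hat {D̂ = v₀ · v₀' · χ ℓ ℓ' x · Z x} (L (o P) (NF.on A P) Qg) (L' (o P') (NF.on A' P') Q'g) (hat-line (es j) ℓ₀ P P' (hfin Qg) (hfin Q'g))
        (λ _ → D≡) (λ q → all-zero (apex-sgn vt A a b) (apex-sgn vt' A' a' b') (trans D≡ q)) (λ _ _ nz → ⊥-elim (nz (apex-sgn vt A a b)))
      where
      x = e⁺ j
      cY = proj₁ oY
      vYF = v PY
      ρ = dual {w = p} cY vYF (pt-y PY) a Yp≢
      ρ' = dual {w = p} cY vYF Yℓ' a Yp≢
      l = dual {w = p} cY vYF (pt-y PY) Yℓ' Yp≢
      κ = apex-Z A a b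
      v₀ = χ ℓ g⁺ x
      v₀' = χ ℓ' g⁺ x
      s1 : s · (proj₁ ρ · Y ‼ p) ≡ pos
      s1 = trans (cong (s ·_) (sym (proj₂ ρ p))) (trans (sym (Wx g⁺)) (Vtx.Wg vt))
      s1' : s' · (proj₁ ρ' · Y ‼ p) ≡ pos
      s1' = trans (cong (s' ·_) (sym (proj₂ ρ' p))) (trans (sym (NF.Wx A' g⁺)) (Vtx.Wg vt'))
      nzv : ∀ s r {c} → s · (r · Y ‼ p) ≡ pos → c ≡ r · Y ‼ x → c ≢ zer
      nzv s r {c} q e z = prove 5 (λ s r c y x → s ⊗ (r ⊗ y) ≐ 𝟏 ⇛ c ≐ r ⊗ x ⇛ x ≠ 𝟎 ⇛ c ≐ 𝟎 ⇛ ff) s r c (Y ‼ p) (Y ‼ x) q e Yx z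
      P = pt-make (es j) ℓ₀ {v₀} {g⁺} (nzv s (proj₁ ρ) s1 (proj₂ ρ x)) (nzv s (proj₁ ρ) s1 (proj₂ ρ x))
      P' = pt-make (es j) ℓ₀' {v₀'} {g⁺} (nzv s' (proj₁ ρ') s1' (proj₂ ρ' x)) (nzv s' (proj₁ ρ') s1' (proj₂ ρ' x))
      Qg = trans (eq P g⁺) (square (nzv s (proj₁ ρ) s1 (proj₂ ρ x)))
      Q'g = trans (eq P' g⁺) (square (nzv s' (proj₁ ρ') s1' (proj₂ ρ' x)))
      D≡ : D ≡ v₀ · v₀' · χ ℓ ℓ' x · Z x
      D≡ = trans Deq (trans (cong₂ (λ m z → s · s' · m · z) (proj₂ l p) (proj₂ κ p))
             (trans (prove 8 (λ s s' r r' l k y x → s ⊗ (r ⊗ y) ≐ 𝟏 ⇛ s' ⊗ (r' ⊗ y) ≐ 𝟏 ⇛ x ≠ 𝟎 ⇛ s ⊗ s' ⊗ (l ⊗ y) ⊗ (k ⊗ y) ≐ (r ⊗ x) ⊗ (r' ⊗ x) ⊗ (l ⊗ x) ⊗ (k ⊗ x))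
               s s' (proj₁ ρ) (proj₁ ρ') (proj₁ l) (proj₁ κ) (Y ‼ p) (Y ‼ x) s1 s1' Yx)
               (sym (cong₂ _·_ (cong₂ _·_ (cong₂ _·_ (proj₂ ρ x) (proj₂ ρ' x)) (proj₂ l x)) (proj₂ κ x)))))

    module Same (a≡ : e⁺ i' ≡ e⁺ i) where
      a = e⁺ i
      PY' : Pt a ℓ' s' Y'
      PY' = subst (λ x → Pt x ℓ' s' Y') a≡ (NF.PY A')

      Y'ℓ≡ : Y' ‼ ℓ ≡ s' · - χ ℓ ℓ' a
      Y'ℓ≡ = trans (eq PY' ℓ) (cong (s' ·_) (anti12 ℓ' ℓ a))

      -- The intersection of ℓ and ℓ' lies on the line of W', so it may replace Y'; it also lies on
      -- ℓ, where it can be compared with Y.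
      off-apex : (h : Hat Y) → lev (new N) ≡ level h → Y' ‼ g⁺ ≡ zer → Y' ‼ f⁺ ≡ zer →
                 (χ ℓ ℓ' a ≢ zer → χ ℓ ℓ' p ≡ χ ℓ ℓ' a) →
                 (∀ {Q} → OldV Q → Van Q (outside ∷ New.S N') → Q ‼ g⁺ ≡ pos → lev (new N') ≡ just (Φ Q)) → EF D (new N) (new N')
      off-apex h L Yg Yf lexM L' =
        ef-hat {D̂ = D̂} L (L' (o P') (NF.on A' P') Q'g) (hat-line ℓ₀ (es i) (pt-swap PY) P' h (hfin Q'g))
          (λ _ → D≡) (λ q → all-zero (s0 q) (apex-sgn vt' A' Yg Yf) (trans D≡ q)) (λ q _ nz → ⊥-elim (nz (s0 q)))
        where
        Ma : χ ℓ ℓ' a ≢ zer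
        Ma z = let u , e = same-pt {z = p} PY PY' z Yp≢ in hat-not-multiple {X' = Y'} {p} u h e (New.Yp≢ N') Yg Yf
        ρ = dual {w = p} (proj₁ (o PY')) (v PY') (pt-y PY') Yg (New.Yp≢ N')
        κ = apex-Z A' Yg Yf
        v₀ = χ ℓ' g⁺ ℓ
        D̂ = - s · v₀ · χ a ℓ' ℓ · Z ℓ
        s1 : s' · (proj₁ ρ · Y' ‼ p) ≡ pos
        s1 = trans (cong (s' ·_) (sym (proj₂ ρ p))) (trans (sym (NF.Wx A' g⁺)) (Vtx.Wg vt'))
        v≢ : v₀ ≢ zer
        v≢ z = prove 6 (λ s r c y x m → s ⊗ (r ⊗ y) ≐ 𝟏 ⇛ c ≐ r ⊗ x ⇛ x ≐ s ⊗ ⊝ m ⇛ m ≠ 𝟎 ⇛ c ≐ 𝟎 ⇛ ff) s' (proj₁ ρ) v₀ (Y' ‼ p) (Y' ‼ ℓ) (χ ℓ ℓ' a) s1 (proj₂ ρ ℓ) Y'ℓ≡ Ma z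
        P' = pt-make ℓ₀ ℓ₀' {v₀} {g⁺} v≢ v≢
        Q'g = trans (eq P' g⁺) (square v≢)
        D≡ : D ≡ D̂
        D≡ = trans Deq (trans (cong₂ (λ m z → s · s' · m · z) (lexM Ma) (proj₂ κ p))
               (trans (prove 7 (λ s s' r k y x m → x ≐ s' ⊗ ⊝ m ⇛ s' ⊗ (r ⊗ y) ≐ 𝟏 ⇛ m ≠ 𝟎 ⇛ s ⊗ s' ⊗ m ⊗ (k ⊗ y) ≐ ⊝ s ⊗ (r ⊗ x) ⊗ ⊝ m ⊗ (k ⊗ x))
                 s s' (proj₁ ρ) (proj₁ κ) (Y' ‼ p) (Y' ‼ ℓ) (χ ℓ ℓ' a) Y'ℓ≡ s1 Ma)
                 (sym (cong₂ _·_ (cong₂ _·_ (cong (- s ·_) (proj₂ ρ ℓ)) (rev a ℓ' ℓ)) (proj₂ κ ℓ)))))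
        s0 : D̂ ≡ zer → sgn (new N) ≡ zer
        s0 q = trans (cong (- (Y ‼ p) ·_) (trans (Gf vt A) (cong (s ·_)
                 (prove 5 (λ s v c m z → s ≠ 𝟎 ⇛ v ≠ 𝟎 ⇛ c ≐ ⊝ m ⇛ m ≠ 𝟎 ⇛ ⊝ s ⊗ v ⊗ c ⊗ z ≐ 𝟎 ⇛ z ≐ 𝟎) s v₀ (χ a ℓ' ℓ) (χ ℓ ℓ' a) (Z ℓ) (NF.s≢ A) v≢ (rev a ℓ' ℓ) Ma q))))
                 (prove 2 (λ y s → ⊝ y ⊗ (s ⊗ 𝟎) ≐ 𝟎) (Y ‼ p) s)

      apex-apex-same : Y ‼ g⁺ ≡ zer → Y ‼ f⁺ ≡ zer → Y' ‼ g⁺ ≡ zer → Y' ‼ f⁺ ≡ zer →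
              (∀ {Q} → OldV Q → Van Q (outside ∷ S) → Q ‼ g⁺ ≡ pos → lev (new N) ≡ just (Φ Q)) →
              (∀ {Q} → OldV Q → Van Q (outside ∷ New.S N') → Q ‼ g⁺ ≡ pos → lev (new N') ≡ just (Φ Q)) → EF D (new N) (new N')
      apex-apex-same Yg Yf Y'g Y'f L L' with χ ℓ ℓ' a ≟ₛ zer
      ... | yes Ma = let u , e = same-pt {z = p} PY PY' Ma Yp≢ in
        apex-apex Yg Yf Y'g Y'f (prove 5 (λ v a b c d → a ≐ v ⊗ b ⇛ c ≐ v ⊗ d ⇛ c ≠ 𝟎 ⇛ a ≐ 𝟎 ⇛ b ≐ 𝟎) u (Y' ‼ ℓ') (Y ‼ ℓ') (Y' ‼ p) (Y ‼ p) (e ℓ') (e p) (New.Yp≢ N') (pt-y PY')) L L'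
      -- f and g vanish at two distinct points of a, so they are dependent and [g f ·] = 0. Both
      -- vertices take their level from the intersection of ℓ and ℓ'.
      ... | no Ma = ef-hat {D̂ = zer} (L (o P) (NF.on A (pt-swap P)) Qg) (L' (o P) (NF.on A' P) Qg) (cmp-zer refl refl)
              (λ h → ⊥-elim (h refl)) (λ _ → all-zero (apex-sgn vt A Yg Yf) (apex-sgn vt' A' Y'g Y'f) D0) (λ _ _ nz → ⊥-elim (nz (apex-sgn vt A Yg Yf)))
        where
        ρ = dual {w = p} (proj₁ (o PY')) (v PY') (pt-y PY') Y'g (New.Yp≢ N')
        κ = apex-Z A Yg Yf
        κ' = apex-Z A' Y'g Y'f
        v₀ = χ ℓ' g⁺ ℓ
        s1 : s' · (proj₁ ρ · Y' ‼ p) ≡ pos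
        s1 = trans (cong (s' ·_) (sym (proj₂ ρ p))) (trans (sym (NF.Wx A' g⁺)) (Vtx.Wg vt'))
        v≢ : v₀ ≢ zer
        v≢ z = prove 6 (λ s r c y x m → s ⊗ (r ⊗ y) ≐ 𝟏 ⇛ c ≐ r ⊗ x ⇛ x ≐ s ⊗ ⊝ m ⇛ m ≠ 𝟎 ⇛ c ≐ 𝟎 ⇛ ff) s' (proj₁ ρ) v₀ (Y' ‼ p) (Y' ‼ ℓ) (χ ℓ ℓ' a) s1 (proj₂ ρ ℓ) Y'ℓ≡ Ma z
        P = pt-make ℓ₀ ℓ₀' {v₀} {g⁺} v≢ v≢
        Qg = trans (eq P g⁺) (square v≢)
        κ0 : proj₁ κ' ≡ zer
        κ0 = prove 5 (λ k x s m z → s ≠ 𝟎 ⇛ z ≐ k ⊗ x ⇛ x ≐ s ⊗ ⊝ m ⇛ m ≠ 𝟎 ⇛ z ≐ 𝟎 ⇛ k ≐ 𝟎) (proj₁ κ') (Y' ‼ ℓ) s' (χ ℓ ℓ' a) (Z ℓ) (NF.s≢ A') (proj₂ κ' ℓ) Y'ℓ≡ Ma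
               (trans (proj₂ κ ℓ) (·-zero (proj₁ κ) (pt-y PY)))
        D0 : D ≡ zer
        D0 = trans Deq (·-zero (s · s' · χ ℓ ℓ' p) (trans (proj₂ κ' p) (cong (_· Y' ‼ p) κ0)))

      off-off : (h : Hat Y) (h' : Hat Y') → lev (new N) ≡ level h → lev (new N') ≡ level h' → χ ℓ ℓ' p ≢ zer → Y ‼ p ≡ Y' ‼ p →
                  (χ ℓ ℓ' a ≢ zer → χ ℓ ℓ' p ≡ χ ℓ ℓ' a) → (Z a ≢ zer → Z p ≡ Z a) → EF D (new N) (new N')
      off-off h h' L L' Mp Yp≡ lexM lexZ = ef-hat {D̂ = D̂} L L' hl conv (λ q → proj₁ (go q)) (λ q → proj₂ (go q))
        where
        D̂ = s · s' · χ ℓ ℓ' a · Z a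
        hl = hat-line (es i) ℓ₀ PY PY' h h'
        conv : D̂ ≢ zer → D ≡ D̂
        conv nz = trans Deq (cong₂ (λ m z → s · s' · m · z)
          (lexM (λ z → nz (trans (cong (λ m → s · s' · m · Z a) z) (prove 3 (λ s s' z → s ⊗ s' ⊗ 𝟎 ⊗ z ≐ 𝟎) s s' (Z a)))))
          (lexZ (λ z → nz (·-zero (s · s' · χ ℓ ℓ' a) z))))
        go : D̂ ≡ zer → Sum (sgn (new N')) (- sgn (new N)) D × (sgn (new N) ≡ sgn (new N') → sgn (new N) ≢ zer → Deep D N N')
        -- Equal levels have two causes: Y and Y' are the same point of a, or f/g is constant along
        -- a.
        go q with χ ℓ ℓ' a ≟ₛ zer
        ... | yes Ma = SB.sum-same h , SB.deep-same
          where
          sp = same-pt {z = p} PY PY' Ma Yp≢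
          module SB = SameBase (hat-≡ (proj₁ sp) (proj₂ sp) h h') Mp
        ... | no Ma = DB.sum-distinct (proj₁ bs) (proj₁ (proj₂ bs)) (proj₂ (proj₂ bs)) , DB.deep-distinct
          where
          bs = both-sides h h' hl q
          module DB = DistinctBases a≡ Yp≡ Ma (lexM Ma)
            (prove 4 (λ s s' m z → s ≠ 𝟎 ⇛ s' ≠ 𝟎 ⇛ m ≠ 𝟎 ⇛ s ⊗ s' ⊗ m ⊗ z ≐ 𝟎 ⇛ z ≐ 𝟎) s s' (χ ℓ ℓ' a) (Z a) (NF.s≢ A) (NF.s≢ A') Ma q)

  swapD : ∀ {D s s' ℓ ℓ'} → D ≡ s · s' · χ ℓ ℓ' p · Z p → - D ≡ s' · s · χ ℓ' ℓ p · Z p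
  swapD {D} {s} {s'} {ℓ} {ℓ'} q = prove 6 (λ d s s' m m' z → d ≐ s ⊗ s' ⊗ m ⊗ z ⇛ m' ≐ ⊝ m ⇛ ⊝ d ≐ s' ⊗ s ⊗ m' ⊗ z) D s s' (χ ℓ ℓ' p) (χ ℓ' ℓ p) (Z p) q (anti12 ℓ' ℓ p)

  case-same : ∀ {W W'} (vt : Vtx ε W) (vt' : Vtx ε W') (N : New ε W) (N' : New ε W') {s s' : Sign} {ℓ₀ ℓ₀' : Fin n}
    (A : NF N s ℓ₀) (A' : NF N' s' ℓ₀') {D} (Deq : D ≡ s · s' · χ (suc ℓ₀) (suc ℓ₀') p · Z p) → New.i N ≡ New.i N' →
    W ‼ e⁺ (New.i N) ≡ W' ‼ e⁺ (New.i N) → (∀ u → u <ᶠ New.i N → ∀ x y → χ x y (e⁺ u) ≡ zer) → χ (suc ℓ₀) (suc ℓ₀') p ≢ zer → EF D (new N) (new N')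
  case-same {W} {W'} vt vt' N N' {s} {s'} {ℓ₀} {ℓ₀'} A A' {D} Deq i≡ conf low Mp = go (view (New.base N)) (view (New.base N'))
    where
    module PC = PairCases vt vt' N N' A A' Deq
    module PC' = PairCases vt' vt N' N A' A (swapD {D} {s} {s'} {suc ℓ₀} {suc ℓ₀'} Deq)
    open New N using (i)
    a≡ : e⁺ (New.i N') ≡ e⁺ i
    a≡ = cong e⁺ (sym i≡)
    module SM = PC.Same a≡
    module SM' = PC'.Same (sym a≡)
    lexM : ∀ x y → χ (suc x) (suc y) (e⁺ i) ≢ zer → χ (suc x) (suc y) p ≡ χ (suc x) (suc y) (e⁺ i)
    lexM x y = at-first (lexχ x y) i (λ u l → low u l (suc x) (suc y))
    Yp≡ : New.Y N ‼ p ≡ New.Y N' ‼ p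
    Yp≡ = trans (New.Yp N) (trans (cong -_ (trans conf (cong (λ x → W' ‼ e⁺ x) i≡))) (sym (New.Yp N')))
    go : View (New.base N) → View (New.base N') → EF D (new N) (new N')
    go (off h L) (off h' L') = SM.off-off h h' L L' Mp Yp≡ (lexM ℓ₀ ℓ₀') (lexM g f)
    go (off h L) (apex a b Q o v q L') = SM.off-apex h L a b (lexM ℓ₀ ℓ₀') (any-base N' a b o v q L')
    go (apex a b Q o v q L) (off h' L') = subst (λ d → EF d (new N) (new N')) (neg-neg D)
      (ef-sym vt' vt (SM'.off-apex h' L' a b (λ nz → subst (λ x → χ (suc ℓ₀') (suc ℓ₀) x ≢ zer → χ (suc ℓ₀') (suc ℓ₀) p ≡ χ (suc ℓ₀') (suc ℓ₀) x) (sym a≡) (lexM ℓ₀' ℓ₀) nz) (any-base N a b o v q L)))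
    go (apex a b Q o v q L) (apex a' b' Q' o' v' q' L') = SM.apex-apex-same a b a' b' (any-base N a b o v q L) (any-base N' a' b' o' v' q' L')

  -- W' lies on the element a next to which W lies.
  module OnA {W W' : SignVec (suc n)} (vt : Vtx ε W) (vt' : Vtx ε W') (N : New ε W) {s s' : Sign} {ℓ₀ : Fin n} (A : NF N s ℓ₀)

    (W'x : ∀ x → W' ‼ x ≡ s' · χ (e⁺ (New.i N)) x p) {D : Sign} (Deq : D ≡ s · s' · χ (suc ℓ₀) (e⁺ (New.i N)) p · Z p)
    (low : ∀ u → u <ᶠ New.i N → ∀ x y → χ x y (e⁺ u) ≡ zer) where
    open New N
    open NF A using (PY; Wx; s≢)
    a₀ : Fin n
    a₀ = es i
    a ℓ : Fin (suc n)
    a = suc a₀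
    ℓ = suc ℓ₀

    s'≢ : s' ≢ zer
    s'≢ z = pos≢ (Vtx.Wg vt') (trans (W'x g⁺) (cong (_· χ a g⁺ p) z))

    Mp≢ : χ ℓ a p ≢ zer
    Mp≢ z = Yp≢ (trans (eq PY p) (·-zero s (trans (anti23 ℓ p a) (cong -_ z))))

    lexZ : Z a ≢ zer → Z p ≡ Z a
    lexZ = at-first (lexχ g f) i (λ u l → low u l g⁺ f⁺)

    -- W' and Y both lie on a, along which f/g is constant, so the change along the edge is the
    -- correction at W with its sign reversed.
    on-a : Hat Y → Z a ≡ zer → D ≡ - sgn (new N)
    on-a h Za = trans Deq (trans
        (prove 8 (λ s s' B v c c' zp zl → s ⊗ ⊝ c' ≐ 𝟏 ⇛ s' ⊗ c ≐ 𝟏 ⇛ zp ≐ v ⊗ c ⇛ zl ≐ v ⊗ c' ⇛ s ⊗ s' ⊗ B ⊗ zp ≐ ⊝ (⊝ (s ⊗ ⊝ B) ⊗ (s ⊗ zl)))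
          s s' (χ ℓ a p) (proj₁ V≡) (χ a g⁺ p) (χ a g⁺ ℓ) (Z p) (Z ℓ)
          (trans (sym (trans (eq PY g⁺) (cong (s ·_) (rev ℓ g⁺ a)))) (Yg h)) s'c (proj₂ V≡ p) (proj₂ V≡ ℓ))
        (cong -_ (sym (cong₂ (λ y x → - y · x) (trans (eq PY p) (cong (s ·_) (anti23 ℓ p a))) (Gf vt A)))))
      where
      s'c : s' · χ a g⁺ p ≡ pos
      s'c = trans (sym (W'x g⁺)) (Vtx.Wg vt')
      c≢ : χ a g⁺ p ≢ zer
      c≢ z = pos≢ s'c (·-zero s' z)
      V≡ = point {w = p} (cV g⁺ f⁺) (vV g⁺ f⁺) Za (χ-left g⁺ f⁺) c≢
      Yg : Hat Y → Y ‼ g⁺ ≡ pos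
      Yg (hfin q) = q
      Yg (hinf q qf) = let w , e = point {w = p} (proj₁ oY) (v PY) (pt-a PY) q c≢
                       in ⊥-elim (ε≢ (trans (sym qf) (trans (e f⁺) (·-zero w (trans (cyc a g⁺ f⁺) Za)))))

    sum-on-a : ∀ {t} → t ≡ zer → D ≡ - sgn (new N) → Sum t (- sgn (new N)) D
    sum-on-a {t} q e = prove 3 (λ t x d → t ≐ 𝟎 ⇛ d ≐ x ⇛ sum t x d) t (- sgn (new N)) D q e

    -- Serves both kinds of W': an old W' is its own point, with q = p; for a new one q is the e_i'
    -- next to which it lies.
    off-off : ∀ {K' : Kind ε W'} {q Y'} → Pt q a s' Y' → (h : Hat Y) (h' : Hat Y') → lev (new N) ≡ level h → lev K' ≡ level h' →
      (χ ℓ a q ≢ zer → χ ℓ a p ≡ χ ℓ a q) → (Z a ≡ zer → sgn K' ≡ zer) →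
      (Y ≡ Y' → Sum (sgn K') (- sgn (new N)) D × (sgn (new N) ≡ sgn K' → sgn (new N) ≢ zer → DeepK D (new N) K')) → EF D (new N) K'
    off-off {K'} {q} {Y'} P' h h' L L' lexq sK' same = ef-hat {D̂ = D̂} L L' (hat-line a₀ ℓ₀ PY (pt-swap P') h h') conv (λ z → proj₁ (go z)) (λ z → proj₂ (go z))
      where
      D̂ = s · - s' · χ ℓ q a · Z a
      conv : D̂ ≢ zer → D ≡ D̂
      conv nz = trans Deq (trans (cong₂ (λ m z → s · s' · m · z)
          (lexq (λ z → nz (prove 5 (λ s s' m m' z → m ≐ ⊝ m' ⇛ m' ≐ 𝟎 ⇛ s ⊗ ⊝ s' ⊗ m ⊗ z ≐ 𝟎) s s' (χ ℓ q a) (χ ℓ a q) (Z a) (anti23 ℓ q a) z)))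
          (lexZ (λ z → nz (·-zero (s · - s' · χ ℓ q a) z))))
        (prove 5 (λ s s' m m' z → m ≐ ⊝ m' ⇛ s ⊗ s' ⊗ m' ⊗ z ≐ s ⊗ ⊝ s' ⊗ m ⊗ z) s s' (χ ℓ q a) (χ ℓ a q) (Z a) (anti23 ℓ q a)))
      go : D̂ ≡ zer → Sum (sgn K') (- sgn (new N)) D × (sgn (new N) ≡ sgn K' → sgn (new N) ≢ zer → DeepK D (new N) K')
      go z with Z a ≟ₛ zer
      ... | yes Za = sum-on-a (sK' Za) (on-a h Za) , λ e nz → ⊥-elim (nz (trans e (sK' Za)))
      ... | no Za = let u , e = same-pt {z = p} PY (pt-swap P')
                          (prove 4 (λ s s' m z → s ≠ 𝟎 ⇛ s' ≠ 𝟎 ⇛ z ≠ 𝟎 ⇛ s ⊗ ⊝ s' ⊗ m ⊗ z ≐ 𝟎 ⇛ m ≐ 𝟎) s s' (χ ℓ q a) (Z a) s≢ s'≢ Za z) Yp≢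
                    in same (hat-≡ u e h h')

    apex-off : ∀ {K' : Kind ε W'} {b₀ Y'} → Pt (suc b₀) a s' Y' → Y ‼ suc b₀ ≢ zer → Y ‼ p ≡ Y ‼ suc b₀ →
      Y ‼ g⁺ ≡ zer → Y ‼ f⁺ ≡ zer → (∀ {Q} → OldV Q → Van Q (outside ∷ S) → Q ‼ g⁺ ≡ pos → lev (new N) ≡ just (Φ Q)) →
      (h' : Hat Y') → lev K' ≡ level h' → (Z a ≡ zer → sgn K' ≡ zer) → EF D (new N) K'
    apex-off {K'} {b₀} {Y'} P' Yb Yp≡ Yg Yf L h' L' sK' =
      ef-hat {D̂ = D̂} (L (o P) (NF.on A P) Qg) L' (hat-line b₀ ℓ₀ P P' (hfin Qg) h') (λ _ → D≡)
        (λ q → prove 3 (λ s s' d → s ≐ 𝟎 ⇛ s' ≐ 𝟎 ⇛ d ≐ 𝟎 ⇛ sum s' (⊝ s) d) (sgn (new N)) (sgn K') D (apex-sgn vt A Yg Yf) (sK' Za) (trans D≡ q))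
        (λ _ _ nz → ⊥-elim (nz (apex-sgn vt A Yg Yf)))
      where
      b = suc b₀
      ρ = dual {w = p} (proj₁ oY) (v PY) (pt-y PY) Yg Yp≢
      κ = apex-Z A Yg Yf
      v₀ = χ ℓ g⁺ b
      D̂ = v₀ · s' · χ ℓ a b · Z b
      Za : Z a ≡ zer
      Za = trans (proj₂ κ a) (·-zero (proj₁ κ) (pt-a PY))
      s1 : s · (proj₁ ρ · Y ‼ p) ≡ pos
      s1 = trans (cong (s ·_) (sym (proj₂ ρ p))) (trans (sym (Wx g⁺)) (Vtx.Wg vt))
      v≢ : v₀ ≢ zer
      v≢ z = prove 5 (λ s r c y x → s ⊗ (r ⊗ y) ≐ 𝟏 ⇛ c ≐ r ⊗ x ⇛ x ≠ 𝟎 ⇛ c ≐ 𝟎 ⇛ ff) s (proj₁ ρ) v₀ (Y ‼ p) (Y ‼ b) s1 (proj₂ ρ b) Yb z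
      P = pt-make b₀ ℓ₀ {v₀} {g⁺} v≢ v≢
      Qg = trans (eq P g⁺) (square v≢)
      M≡ : χ ℓ a p ≡ χ ℓ a b
      M≡ = prove 5 (λ s yp yb m m' → s ≠ 𝟎 ⇛ yp ≐ s ⊗ ⊝ m ⇛ yb ≐ s ⊗ ⊝ m' ⇛ yp ≐ yb ⇛ m ≐ m') s (Y ‼ p) (Y ‼ b) (χ ℓ a p) (χ ℓ a b) s≢
             (trans (eq PY p) (cong (s ·_) (anti23 ℓ p a))) (trans (eq PY b) (cong (s ·_) (anti23 ℓ b a))) Yp≡
      D≡ : D ≡ D̂
      D≡ = trans Deq (trans (cong₂ (λ m z → s · s' · m · z) M≡ (proj₂ κ p))
        (trans (prove 7 (λ s s' r k yp yb m → yp ≐ yb ⇛ yb ≠ 𝟎 ⇛ s ⊗ (r ⊗ yp) ≐ 𝟏 ⇛ s ⊗ s' ⊗ m ⊗ (k ⊗ yp) ≐ (r ⊗ yb) ⊗ s' ⊗ m ⊗ (k ⊗ yb))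
          s s' (proj₁ ρ) (proj₁ κ) (Y ‼ p) (Y ‼ b) (χ ℓ a b) Yp≡ Yb s1)
          (sym (cong₂ (λ x z → x · s' · χ ℓ a b · z) (proj₂ ρ b) (proj₂ κ b)))))

    old-case : (oW' : OldV W') → EF D (new N) (old oW')
    old-case oW' with view base
    ... | off h L = off-off {old oW'} {p} {W'} P' h (hfin (Vtx.Wg vt')) L refl (λ _ → refl) (λ _ → refl)
                       (λ e → ⊥-elim (Yp≢ (trans (cong (_‼ p) e) (pt-a P'))))
      where
      P' : Pt p a s' W'
      P' = pt oW' (van λ x m → trans (W'x x) (·-zero s' (at' x m))) W'x
        where
        at' : ∀ x → _ → χ a x p ≡ zer
        at' x m = trans (sym (cyc p a x)) (at (vV p a) x m)
    ... | apex a' b' Q o₁ v₁ q₁ L with first-nonzero (λ t → Y ‼ e⁺ t)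
    ... | inj₁ h = ⊥-elim (Yp≢ (old-none oY h))
    -- An old vertex on p vanishes at every e_t. So W' is also the intersection of a with e_j, and
    -- e_j carries the substitute for Y.
    ... | inj₂ (j , fj , Yj) = apex-off {old oW'} {es j} {W'} P' Yj Yp≡b a' b' (any-base N a' b' o₁ v₁ q₁ L) (hfin (Vtx.Wg vt')) refl (λ _ → refl)
      where
      b = e⁺ j
      Yp≡b = old-first oY j fj Yj
      vW' : Van W' F
      vW' = van λ x m → trans (W'x x) (·-zero s' (trans (sym (cyc p a x)) (at (vV p a) x m)))
      W'a : W' ‼ a ≡ zer
      W'a = trans (W'x a) (·-zero s' (trans (sym (cyc p a a)) (χ-right p a)))
      W'p : W' ‼ p ≡ zer
      W'p = trans (W'x p) (·-zero s' (χ-right a p))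
      W'b : W' ‼ b ≡ zer
      W'b = old-vanish oW' W'p j
      Yb : Y ‼ b ≡ s · χ a ℓ b
      Yb = trans (eq PY b) (cong (s ·_) (sym (cyc a ℓ b)))
      w≡ = point {w = ℓ} (proj₁ (Vtx.coc vt')) vW' W'b W'a (λ z → Yj (trans Yb (·-zero s (trans (sym (cyc b a ℓ)) z))))
      P' : Pt b a s' W'
      P' = pt oW' vW' λ z → trans (proj₂ w≡ z) (cong₂ _·_
        (prove 8 (λ w s' s m m' yp yb x → yp ≐ s ⊗ m ⇛ yb ≐ s ⊗ m' ⇛ yp ≐ yb ⇛ yb ≠ 𝟎 ⇛ x ≐ s' ⊗ m ⇛ x ≐ w ⊗ m' ⇛ w ≐ s')
          (proj₁ w≡) s' s (χ a ℓ p) (χ a ℓ b) (Y ‼ p) (Y ‼ b) (W' ‼ ℓ)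
          (trans (eq PY p) (cong (s ·_) (sym (cyc a ℓ p)))) Yb Yp≡b Yj (W'x ℓ) (trans (proj₂ w≡ ℓ) (cong (proj₁ w≡ ·_) (cyc b a ℓ))))
        (cyc b a z))

    new-case : (N' : New ε W') → NF N' s' a₀ → EF D (new N) (new N')
    new-case N' A' = go (view base) (view (New.base N'))
      where
      open New N' using () renaming (Y to Y'; i to i')
      module PC = PairCases vt vt' N N' A A' Deq
      PY' = NF.PY A'
      b = e⁺ i'
      sK' : Z a ≡ zer → sgn (new N') ≡ zer
      sK' z = ·-zero (- (Y' ‼ p)) (trans (Gf vt' A') (·-zero s' z))
      lexb : χ ℓ a b ≢ zer → χ ℓ a p ≡ χ ℓ a b
      lexb = at-first (lexχ ℓ₀ a₀) i' (λ u l → trans (cyc ℓ a (e⁺ u)) (NF.par A' (es u) (New.first N' u l) ℓ))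
      go : View base → View (New.base N') → EF D (new N) (new N')
      go (off h L) (off h' L') = off-off {new N'} PY' h h' L L' lexb sK' (λ e → let module T = PC.SameBase e Mp≢ in T.sum-same h , T.deep-same)
      -- Here a represents the line of W', so Y lies on that line and can itself replace Y'; the two
      -- levels coincide.
      go (off h L) (apex Y'g Y'f Q o₁ v₁ q₁ L') =
        ef-hat {D̂ = zer} L (trans (any-base N' Y'g Y'f o₁ v₁ q₁ L' oY onY (Yg h)) (sym (lev≡ h))) (lz h) (λ nz → ⊥-elim (nz refl))
          (λ _ → sum-on-a (sK' Za) (on-a h Za)) (λ _ e nz → ⊥-elim (nz (trans e (sK' Za))))
        where
        κ = apex-Z A' Y'g Y'f
        Za : Z a ≡ zer
        Za = trans (proj₂ κ a) (·-zero (proj₁ κ) (pt-y PY'))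
        onY : Van Y (outside ∷ New.S N')
        onY = NF.on A' (pt-swap PY)
        Yg : Hat Y → Y ‼ g⁺ ≡ pos
        Yg (hfin q) = q
        Yg (hinf q qf) =
          let c≢ = λ z → pos≢ (Vtx.Wg vt') (trans (W'x g⁺) (·-zero s' z))
              w , e = point {w = p} (proj₁ oY) (v PY) (pt-a PY) q c≢
          in ⊥-elim (ε≢ (trans (sym qf) (trans (e f⁺) (·-zero w (trans (cyc a g⁺ f⁺) Za)))))
        lev≡ : (h : Hat Y) → level h ≡ just (Φ Y)
        lev≡ (hfin q) = refl
        lev≡ (hinf q qf) = ⊥-elim (pos≢ (Yg (hinf q qf)) q)
        lz : (h : Hat Y) → Le! zer (level h) (level h)
        lz (hfin q) = cmp-zer refl refl
        lz (hinf _ _) = refl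
      go (apex Yg Yf Q o₁ v₁ q₁ L) (off h' L') = apex-off {new N'} PY' Yb (trans (eq PY p) (trans (cong (s ·_) MM) (sym (eq PY b)))) Yg Yf (any-base N Yg Yf o₁ v₁ q₁ L) h' L' sK'
        where
        Mb : χ ℓ a b ≢ zer
        Mb z = let u , e = same-pt {z = p} PY (pt-swap PY') (trans (anti23 ℓ b a) (cong -_ z)) Yp≢
               in hat-not-zero h' (trans (e g⁺) (·-zero u Yg)) (trans (e f⁺) (·-zero u Yf))
        MM : χ ℓ p a ≡ χ ℓ b a
        MM = trans (anti23 ℓ p a) (trans (cong -_ (lexb Mb)) (sym (anti23 ℓ b a)))
        Yb : Y ‼ b ≢ zer
        Yb z = nz· s≢ (λ k → Mb (trans (anti23 ℓ a b) (cong -_ k))) (trans (sym (eq PY b)) z)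
      go (apex Yg Yf Q o₁ v₁ q₁ L) (apex Y'g Y'f Q' o₂ v₂ q₂ L') =
        PC.apex-apex Yg Yf Y'g Y'f (pt-a PY) (any-base N Yg Yf o₁ v₁ q₁ L) (any-base N' Y'g Y'f o₂ v₂ q₂ L')

  -- Edges with both ends on p, in a plane

  module PlaneEdge {W W' T : SignVec (suc n)} (vt : Vtx ε W) (vt' : Vtx ε W') (E : Edge W W' T) (Wp : W ‼ p ≡ zer) (W'p : W' ‼ p ≡ zer)
    (p∉ : ¬ InCl F p) (vWF : Van W F) (vW'F : Van W' F) (vTF : Van T F)
    (F₀∋ : ∀ {h} → W ‼ suc h ≡ zer → W' ‼ suc h ≡ zer → h ∈ F₀) where
    open Edge E

    low : ∀ u → W ‼ e⁺ u ≡ zer → W' ‼ e⁺ u ≡ zer → ∀ x y → χ x y (e⁺ u) ≡ zer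
    low u a b x y = at (vV x y) (e⁺ u) (there (F₀∋ a b))

    -- T is the intersection of p and g up to sign. At ℓ, where W vanishes, it has the sign of W',
    -- which fixes the factor.
    slope : ∀ {s s' ℓ₀ ℓ₀'} → (∀ x → W ‼ x ≡ s · χ (suc ℓ₀) x p) → (∀ x → W' ‼ x ≡ s' · χ (suc ℓ₀') x p) →
            T ‼ f⁺ ≡ s · s' · χ (suc ℓ₀) (suc ℓ₀') p · Z p
    slope {s} {s'} {ℓ₀} {ℓ₀'} Wx W'x =
      let ℓ = suc ℓ₀ ; ℓ' = suc ℓ₀'
          sc = trans (sym (Wx g⁺)) (Vtx.Wg vt)
          Wℓ = trans (Wx ℓ) (·-zero s (self-opposite (anti12 ℓ ℓ p)))
          w , e = point {w = ℓ} cT vTF (at vT p (F'∋ Wp W'p)) Tg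
                    (λ z → prove 3 (λ s c d → s ⊗ c ≐ 𝟏 ⇛ d ≐ ⊝ c ⇛ d ≐ 𝟎 ⇛ ff) s (χ ℓ g⁺ p) (χ p g⁺ ℓ) sc (rev p g⁺ ℓ) z)
          Tℓ = proj₁ (Ts ℓ) (cong -_ Wℓ)
          w≡ = prove 5 (λ w c s s' m → w ⊗ ⊝ c ≐ s' ⊗ ⊝ m ⇛ s ⊗ c ≐ 𝟏 ⇛ w ≐ s ⊗ s' ⊗ m) w (χ ℓ g⁺ p) s s' (χ ℓ ℓ' p)
                 (trans (sym (trans (e ℓ) (cong (w ·_) (rev p g⁺ ℓ)))) (trans Tℓ (trans (W'x ℓ) (cong (s' ·_) (anti12 ℓ' ℓ p))))) sc
      in trans (e f⁺) (cong₂ _·_ w≡ (cyc p g⁺ f⁺))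

    off-line : ∀ {X h₀} → C' X → Van X (outside ∷ F₀) → X ‼ p ≡ zer → X ‼ suc h₀ ≢ zer → ∃ λ w → χ p (suc h₀) w ≢ zer
    off-line {X} {h₀} c v q h = nz p (suc h₀) p∉ (⇒∉cl c (van-⊕ v q) h)

    α₀ : ∃ λ h → W ‼ suc h ≡ zer × W' ‼ suc h ≢ zer
    α₀ = go α Wα W'α
      where
      go : ∀ h → W ‼ h ≡ zer → W' ‼ h ≢ zer → ∃ λ h → W ‼ suc h ≡ zer × W' ‼ suc h ≢ zer
      go zero a b = ⊥-elim (b W'p)
      go (suc h) a b = h , a , b

    α₀' : ∃ λ h → W ‼ suc h ≢ zer × W' ‼ suc h ≡ zer
    α₀' = go α' Wα' W'α'
      where
      go : ∀ h → W ‼ h ≢ zer → W' ‼ h ≡ zer → ∃ λ h → W ‼ suc h ≢ zer × W' ‼ suc h ≡ zer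
      go zero a b = ⊥-elim (a Wp)
      go (suc h) a b = h , a , b

    cW : C' W
    cW = proj₁ (Vtx.coc vt)
    cW' : C' W'
    cW' = proj₁ (Vtx.coc vt')

    frameW : (N : New ε W) → ∃ λ s → NF N s (proj₁ α₀)
    frameW N = frame vt N (proj₁ α₀) vWF (proj₁ (proj₂ α₀)) (proj₂ (off-line cW' vW'F W'p (proj₂ (proj₂ α₀))))

    new-old : (N : New ε W) (oW' : OldV W') → EF (T ‼ f⁺) (new N) (old oW')
    new-old N oW' =
      let s , A = frameW N
          s' , e = point cW' vW'F W'p (W'e (New.i N)) (proj₂ (off-line cW vWF Wp (New.Wi N)))
          W'x = λ x → trans (e x) (cong (s' ·_) (cyc p (e⁺ (New.i N)) x))
          module OA = OnA vt vt' N {s} {s'} {proj₁ α₀} A W'x (slope {s} {s'} {proj₁ α₀} {es (New.i N)} (NF.Wx A) W'x) (λ u l → low u (New.first N u l) (W'e u))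
      in OA.old-case oW'
      where
      W'e : ∀ t → W' ‼ e⁺ t ≡ zer
      W'e = old-vanish oW' W'p

    new-new-< : (N : New ε W) (N' : New ε W') → New.i N <ᶠ New.i N' → EF (T ‼ f⁺) (new N) (new N')
    new-new-< N N' l =
      let s , A = frameW N
          W'i = New.first N' (New.i N) l
          s' , A' = frame vt' N' (es (New.i N)) vW'F W'i (proj₂ (off-line cW vWF Wp (New.Wi N)))
          module OA = OnA vt vt' N {s} {s'} {proj₁ α₀} A (NF.Wx A') (slope {s} {s'} {proj₁ α₀} {es (New.i N)} (NF.Wx A) (NF.Wx A'))
                        (λ u q → low u (New.first N u q) (New.first N' u (<ᶠ-trans q l)))
      in OA.new-case N' A'

    new-new-≡ : (N : New ε W) (N' : New ε W') → New.i N ≡ New.i N' → EF (T ‼ f⁺) (new N) (new N')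
    new-new-≡ N N' i≡ =
      let s , A = frameW N
          s' , A' = frame vt' N' (proj₁ α₀') vW'F (proj₂ (proj₂ α₀')) (proj₂ (off-line cW vWF Wp (proj₁ (proj₂ α₀'))))
          ℓ = suc (proj₁ α₀) ; ℓ' = suc (proj₁ α₀')
      in case-same vt vt' N N' A A' (slope {s} {s'} {proj₁ α₀} {proj₁ α₀'} (NF.Wx A) (NF.Wx A')) i≡
           (conf _ (New.Wi N) (λ z → New.Wi N' (trans (cong (λ x → W' ‼ e⁺ x) (sym i≡)) z)))
           (λ u l → low u (New.first N u l) (New.first N' u (subst (u <ᶠ_) i≡ l)))
           (λ z → proj₂ (proj₂ α₀) (trans (NF.Wx A' ℓ) (·-zero s' (trans (anti12 ℓ' ℓ p) (cong -_ z)))))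

    -- Old vertices on p vanish at every e_t, so every e_t is in F. Then every bracket of p with two
    -- old elements vanishes, among them the one that expresses W at g.
    not-both-old : OldV W → OldV W' → ⊥
    not-both-old o o' =
      let s , e = point cW vWF Wp (proj₁ (proj₂ α₀)) (proj₂ (off-line cW' vW'F W'p (proj₂ (proj₂ α₀))))
          ℓ₀ = proj₁ α₀
          zero-at : χ (suc ℓ₀) g⁺ p ≡ zer
          zero-at = at-none (lexχ ℓ₀ g) (λ t → low t (old-vanish o Wp t) (old-vanish o' W'p t) (suc ℓ₀) g⁺)
      in pos≢ (Vtx.Wg vt) (trans (e g⁺) (·-zero s (trans (cyc p (suc ℓ₀) g⁺) zero-at)))

-- All edges of the extended program

module Edges (Stg : Setting) (ε : Sign) (ε≢ : ε ≢ zer) where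
  open Setting Stg
  open Levels Stg ε ε≢

  outside-van : ∀ {X : SignVec (suc n)} {S} → Van X S → Van X (outside ∷ tail S)
  outside-van {S = s ∷ S} v = van λ { (suc h) (there m) → at v (suc h) (there m) }

  outside-back : ∀ {X : SignVec (suc n)} {S} → (p ∈ S → X ‼ p ≡ zer) → Van X (outside ∷ tail S) → Van X S
  outside-back {S = s ∷ S} q v = van λ { zero m → q m ; (suc h) (there m) → at v (suc h) (there m) }

  ¬R1-edge : ∀ {W W' T} → Vtx ε W → Vtx ε W' → (E : Edge W W' T) → ∀ {S} → Van W S → Van W' S → ¬ R 1 S
  ¬R1-edge vt vt' E v v' r =
    let open Edge E
        w , e = uniq r (proj₁ (Vtx.coc vt)) (proj₁ (Vtx.coc vt')) v v' (pos≢ (Vtx.Wg vt))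
    in W'α (trans (e α) (·-zero w Wα))

  module _ {W W' T : SignVec (suc n)} (vt : Vtx ε W) (vt' : Vtx ε W') (E : Edge W W' T) (Wp : W ‼ p ≡ zer) (W'p : W' ‼ p ≡ zer)
    (p∉ : ¬ InCl (outside ∷ tail (Edge.F' E)) p) where
    open Edge E
    private
      F₁ : Subset n
      F₁ = tail F'
      r3 : R 3 (outside ∷ F₁)
      r3 = R-lower 2 p∉ (R-mono 2 (λ X c v → outside-back (λ _ → van-⊕ʳ {S = outside ∷ F₁} {p} v) (van-⊕ˡ {S = outside ∷ F₁} {p} v)) r2F)
      ¬r2 : ¬ R 2 (outside ∷ F₁)
      ¬r2 r = ¬R1-edge vt vt' E (van-⊕ (outside-van vW) Wp) (van-⊕ (outside-van vW') W'p) (r p p∉)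
      Fl : Flat
      Fl = record { F₀ = F₁ ; r3 = r3 ; Pl = plane r3 ¬r2 p∉ }
      F₁∋ : ∀ {h} → W ‼ suc h ≡ zer → W' ‼ suc h ≡ zer → h ∈ F₁
      F₁∋ a b = ∈tail (F'∋ a b)
        where
        ∈tail : ∀ {S : Subset (suc n)} {h} → suc h ∈ S → h ∈ tail S
        ∈tail (there m) = m

    not-both-old : OldV W → OldV W' → ⊥
    not-both-old = Planes.PlaneEdge.not-both-old Stg ε ε≢ Fl vt vt' E Wp W'p p∉ (outside-van vW) (outside-van vW') (outside-van vT) F₁∋

    new-old : (N : New ε W) (o' : OldV W') → EF (T ‼ f⁺) (new N) (old o')
    new-old = Planes.PlaneEdge.new-old Stg ε ε≢ Fl vt vt' E Wp W'p p∉ (outside-van vW) (outside-van vW') (outside-van vT) F₁∋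

    new-new-< : (N : New ε W) (N' : New ε W') → New.i N <ᶠ New.i N' → EF (T ‼ f⁺) (new N) (new N')
    new-new-< = Planes.PlaneEdge.new-new-< Stg ε ε≢ Fl vt vt' E Wp W'p p∉ (outside-van vW) (outside-van vW') (outside-van vT) F₁∋

    new-new-≡ : (N : New ε W) (N' : New ε W') → New.i N ≡ New.i N' → EF (T ‼ f⁺) (new N) (new N')
    new-new-≡ = Planes.PlaneEdge.new-new-≡ Stg ε ε≢ Fl vt vt' E Wp W'p p∉ (outside-van vW) (outside-van vW') (outside-van vT) F₁∋

  old-old : ∀ {W W' T} → Vtx ε W → Vtx ε W' → Edge W W' T → (o : OldV W) (o' : OldV W') → EF (T ‼ f⁺) (old o) (old o')
  old-old {W} {W'} {T} vt vt' E o o' = record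
    { le = wk-cmp c ; sm = λ q → subst (Sum zer zer) (sym (cmp-≡ c (just-injective q))) ((λ _ → refl) , (λ _ → refl) , λ _ → refl)
    ; dp = λ _ _ h → ⊥-elim (h refl) }
    where
    open Edge E
    F₀ = tail F'
    pzero : p ∈ F' → ∀ X → C' X → Van X (outside ∷ F₀) → X ‼ p ≡ zer
    pzero m with cl? (outside ∷ F₀) p
    ... | yes i = i
    ... | no q = ⊥-elim (not-both-old vt vt' E (at vW p m) (at vW' p m) q o o')
    rr : R 2 (outside ∷ F₀)
    rr = R-mono 2 (λ X c v → outside-back (λ m → pzero m X c v) v) r2F
    α₀ : ∃ λ h → W ‼ suc h ≡ zer × W' ‼ suc h ≢ zer
    α₀ with any? (λ h → (W ‼ suc h ≟ₛ zer) ×-dec ¬? (W' ‼ suc h ≟ₛ zer))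
    ... | yes x = x
    -- The element telling the ends apart might be p, but equal old parts force equal signs of p.
    ... | no h = ⊥-elim (go α Wα W'α)
      where
      u = O.uniq-nz {e = g} {e' = g} (O.coc-R (proj₂ o)) (proj₁ (proj₂ o)) (proj₁ (proj₂ o')) (van-zset (tail W))
            (van λ x m → trans (tail-‼ W' x) (decidable-stable (W' ‼ suc x ≟ₛ zer) (λ z → h (x , trans (sym (tail-‼ W x)) (zset∈ (tail W) m) , z))))
            (λ z → pos≢ (Vtx.Wg vt) (trans (sym (tail-‼ W g)) z)) (λ z → pos≢ (Vtx.Wg vt') (trans (sym (tail-‼ W' g)) z))
      w≡ : proj₁ u ≡ pos
      w≡ = prove 3 (λ w a b → a ≐ 𝟏 ⇛ b ≐ 𝟏 ⇛ b ≐ w ⊗ a ⇛ w ≐ 𝟏) (proj₁ u) (tail W ‼ g) (tail W' ‼ g) (trans (tail-‼ W g) (Vtx.Wg vt)) (trans (tail-‼ W' g) (Vtx.Wg vt')) (proj₂ (proj₂ u) g)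
      tails : tail W' ≡ tail W
      tails = ext λ x → trans (proj₂ (proj₂ u) x) (cong (_· tail W ‼ x) w≡)
      go : ∀ h → W ‼ h ≡ zer → W' ‼ h ≢ zer → ⊥
      go zero a b = b (trans (old-lex o') (trans (cong (lexSign es) tails) (trans (sym (old-lex o)) a)))
      go (suc x) a b = b (trans (sym (tail-‼ W' x)) (trans (cong (_‼ x) tails) (trans (tail-‼ W x) a)))
    c : Cmp (T ‼ f⁺) (Φ W) (Φ W')
    c = let h , a , b = α₀ in
      Lifted.cmp isφ {F₀} {W} {W'} {T} {h} rr o o' cT (outside-van vW) (outside-van vW') (outside-van vT) a b
        (trans (proj₁ (Ts (suc h)) (cong -_ a)) (cong (_· W' ‼ suc h) (sym (Vtx.Wg vt'))))
        (pos≢ (Vtx.Wg vt)) (pos≢ (Vtx.Wg vt')) Tg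

  -- As p is nonzero at W', it is not a common zero, and W' lies on the line of O that belongs to W.
  -- All comparisons take place on this line.
  line-edge : ∀ {W W' T} → Vtx ε W → Vtx ε W' → Edge W W' T → (N : New ε W) (o' : OldV W') → W' ‼ p ≢ zer → EF (T ‼ f⁺) (new N) (old o')
  line-edge {W} {W'} {T} vt vt' E N o' W'p = go (view base)
    where
    open Edge E hiding (vW)
    open New N
    c = e⁺ i
    cW = proj₁ (Vtx.coc vt)
    Wg = Vtx.Wg vt
    W'g = Vtx.Wg vt'
    SV = outside ∷ S
    vW : Van W SV
    vW = van-zset⁻ {W}
    toF : ∀ {X} → Van X SV → Van X F'
    toF v = van λ { zero m → ⊥-elim (W'p (at vW' p m)) ; (suc h) m → at v (suc h) (there (∈tail-zset W (at (Edge.vW E) (suc h) m))) }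
    vX : Van W' SV
    vX = van λ { (suc h) (there m) → decidable-stable (W' ‼ suc h ≟ₛ zer) (λ q → p∉ λ X cX v →
           let w , e = uniq (r2F (suc h) (⇒∉cl (proj₁ (Vtx.coc vt')) vW' q)) cW cX (van-⊕ (Edge.vW E) (at vW (suc h) (there m))) (van-⊕ (toF v) (at v (suc h) (there m))) (pos≢ Wg)
           in trans (e p) (·-zero w Wp)) }
    vTS : Van T SV
    vTS = van λ h m → trans (proj₁ (Ts h) (cong -_ (at vW h m))) (at vX h m)
    Tp : T ‼ p ≡ W' ‼ p
    Tp = proj₁ (Ts p) (cong -_ Wp)
    Tp≢ = λ z → W'p (trans (sym Tp) z)
    r1g = r2 g⁺ (⇒∉cl cW vW (pos≢ Wg))
    r1c = r2 c (⇒∉cl cW vW Wi)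
    oT : OldV T
    oT = old-of cT (van-⊕ vTS Tg) r1g (p , Tp≢)
    below-i : ∀ {X} → Van X SV → ∀ u → u <ᶠ i → X ‼ e⁺ u ≡ zer
    below-i v u l = at v (e⁺ u) (there (∈tail-zset W (first u l)))
    at-g : ∀ {X} → C' X → Van X SV → X ‼ g⁺ ≡ zer → ∃ λ w → ∀ h → X ‼ h ≡ w · T ‼ h
    at-g cX v q = uniq r1g cT cX (van-⊕ vTS Tg) (van-⊕ v q) Tp≢
    Gf0 : T ‼ f⁺ ≡ zer → sgn (new N) ≡ zer
    Gf0 q = let w , e = at-g (proj₁ (oG 𝒈)) (vG 𝒈) (Gσ 𝒈) in
      ·-zero (- (Y ‼ p)) (trans (e f⁺) (·-zero w q))
    done : T ‼ f⁺ ≡ zer → Sum zer (- sgn (new N)) (T ‼ f⁺)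
    done q = prove 2 (λ s t → s ≐ 𝟎 ⇛ t ≐ 𝟎 ⇛ sum 𝟎 (⊝ s) t) (sgn (new N)) (T ‼ f⁺) (Gf0 q) q
    dead : ∀ {A : Set} → sgn (new N) ≡ zer → sgn (new N) ≢ zer → A
    dead q h = ⊥-elim (h q)
    go : View base → EF (T ‼ f⁺) (new N) (old o')
    go (apex Yg Yf Q o v q L) =
      let w , e = at-g (proj₁ oY) vY Yg
          Tf = prove 5 (λ w y yp t tp → y ≐ w ⊗ t ⇛ yp ≐ w ⊗ tp ⇛ y ≐ 𝟎 ⇛ yp ≠ 𝟎 ⇛ t ≐ 𝟎) w (Y ‼ f⁺) (Y ‼ p) (T ‼ f⁺) (T ‼ p) (e f⁺) (e p) Yf Yp≢
      in ef-hat {D̂ = zer} (any-base N Yg Yf o v q L o' vX W'g) refl (cmp-zer refl refl) (λ h → ⊥-elim (h refl)) (λ _ → done Tf) (λ _ q' → dead q')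
    go (off h L) with W' ‼ c ≟ₛ zer
    ... | yes Xc =
      ef-hat {D̂ = zer} (trans L (lev≡ h)) refl (cmp-zer refl refl) (λ h → ⊥-elim (h refl)) (λ _ → sm) (λ _ q' → dead q')
      where
      pr = uniq r1c (proj₁ oY) (proj₁ o') (van-⊕ vY Yi) (van-⊕ vX Xc) Yp≢
      Y≡ : Y ≡ W'
      Y≡ = hat-≡ (proj₁ pr) (proj₂ pr) h (hfin W'g)
      lev≡ : (h : Hat Y) → level h ≡ just (Φ W')
      lev≡ (hfin q) = cong (λ X → just (Φ X)) Y≡
      lev≡ (hinf q _) = ⊥-elim (pos≢ W'g (trans (cong (_‼ g⁺) (sym Y≡)) q))
      sm : Sum zer (- sgn (new N)) (T ‼ f⁺)
      sm = let w , e = at-g (proj₁ (oG 𝒈)) (vG 𝒈) (Gσ 𝒈) in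
        prove 6 (λ w gp gf tp tf y → gp ≐ 𝟏 ⇛ gp ≐ w ⊗ tp ⇛ gf ≐ w ⊗ tf ⇛ tp ≐ y ⇛ sum 𝟎 (⊝ (⊝ y ⊗ gf)) tf)
          w (G 𝒈 ‼ p) (G 𝒈 ‼ f⁺) (T ‼ p) (T ‼ f⁺) (Y ‼ p) (Gp 𝒈) (e p) (e f⁺) (trans Tp (cong (_‼ p) (sym Y≡)))
    ... | no Xc = split h L
      where
      Xp : W' ‼ p ≡ W' ‼ c
      Xp = old-first o' i (below-i vX) Xc
      split : (h : Hat Y) → levB base ≡ level h → EF (T ‼ f⁺) (new N) (old o')
      split (hfin Yg) L = ef-hat {D̂ = T ‼ f⁺} L refl cm (λ _ → refl) done (λ q _ → dead (Gf0 q))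
        where
        Tc≢ : T ‼ c ≢ zer
        Tc≢ z = let w , e = uniq r1c (proj₁ oY) cT (van-⊕ vY Yi) (van-⊕ vTS z) Yp≢ in
          Tp≢ (prove 5 (λ w tg yg tp yp → tg ≐ w ⊗ yg ⇛ tg ≐ 𝟎 ⇛ yg ≐ 𝟏 ⇛ tp ≐ w ⊗ yp ⇛ tp ≐ 𝟎) w (T ‼ g⁺) (Y ‼ g⁺) (T ‼ p) (Y ‼ p) (e g⁺) Tg Yg (e p))
        Tc : T ‼ c ≡ W' ‼ c
        -- On this line e_i is the first candidate, so for the old points T and W' the sign of p is
        -- that of e_i; T and W' agree at p because W vanishes there.
        Tc = trans (sym (old-first oT i (below-i vTS) Tc≢)) (trans Tp Xp)
        cm : Cmp (T ‼ f⁺) (Φ Y) (Φ W')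
        cm = Lifted.cmp isφ {S} {Y} {W'} {T} {es i} r2 oY o' cT vY vX vTS Yi Xc (trans Tc (cong (_· W' ‼ c) (sym W'g))) (pos≢ Yg) (pos≢ W'g) Tg
      split (hinf Yg Yf) L = ef-hat {D̂ = T ‼ f⁺} L refl Tf (λ _ → refl) done (λ q _ → dead (Gf0 q))
        where
        Tf : T ‼ f⁺ ≡ - ε
        Tf = let w , e = at-g (proj₁ oY) vY Yg in
          prove 8 (λ w yp tp yf tf ε xc wc → yp ≐ w ⊗ tp ⇛ yf ≐ w ⊗ tf ⇛ yf ≐ ε ⇛ yp ≐ ⊝ wc ⇛ wc ≐ xc ⇛ tp ≐ xc ⇛ wc ≠ 𝟎 ⇛ tf ≐ ⊝ ε)
            w (Y ‼ p) (T ‼ p) (Y ‼ f⁺) (T ‼ f⁺) ε (W' ‼ c) (W ‼ c) (e p) (e f⁺) Yf Yp (conf c Wi Xc) (trans Tp Xp) Wi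

  ef-flip : ∀ {W W' T} {K : Kind ε W} {K' : Kind ε W'} → Vtx ε W → Vtx ε W' → EF (scale neg T ‼ f⁺) K' K → EF (T ‼ f⁺) K K'
  ef-flip {T = T} {K} {K'} vt vt' h = subst (λ d → EF d K K') (trans (cong -_ (scale-‼ neg T f⁺)) (neg-neg (T ‼ f⁺))) (ef-sym vt' vt h)

  new-edge : ∀ {W W' T} → Vtx ε W → Vtx ε W' → Edge W W' T → (N : New ε W) (K' : Kind ε W') → EF (T ‼ f⁺) (new N) K'
  new-edge {W} {W'} {T} vt vt' E N = go
    where
    open Edge E
    open New N using (p∉; Wp)
    p∉F : ¬ InCl (outside ∷ tail F') p
    p∉F i = p∉ λ X c v → i X c (van λ { (suc h) (there m) → at v (suc h) (there (∈tail-zset W (at (outside-van vW) (suc h) (there m)))) })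
    go : ∀ K' → EF (T ‼ f⁺) (new N) K'
    go (old o') with W' ‼ p ≟ₛ zer
    ... | yes q = new-old vt vt' E Wp q p∉F N o'
    ... | no q = line-edge vt vt' E N o' q
    go (new N') with <ᶠ-cmp (New.i N) (New.i N')
    ... | tri< l _ _ = new-new-< vt vt' E Wp (New.Wp N') p∉F N N' l
    ... | tri≈ _ q _ = new-new-≡ vt vt' E Wp (New.Wp N') p∉F N N' q
    ... | tri> _ _ l = ef-flip {T = T} vt vt' (new-new-< vt' vt (edge-sym E) (New.Wp N') Wp p∉F N' N l)

  edge-facts : ∀ {W W' T} → Vtx ε W → Vtx ε W' → Edge W W' T → (K : Kind ε W) (K' : Kind ε W') → EF (T ‼ f⁺) K K'
  edge-facts vt vt' E (new N) K' = new-edge vt vt' E N K'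
  edge-facts vt vt' E (old o) (old o') = old-old vt vt' E o o'
  edge-facts {T = T} vt vt' E (old o) (new N') = ef-flip {T = T} vt vt' (new-edge vt' vt (edge-sym E) N' (old o))

-- Directed cycles

ord : Sign → ℕ
ord neg = 0
ord zer = 1
ord pos = 2

ord-injective : ∀ {a b} → ord a ≡ ord b → a ≡ b
ord-injective {pos} {pos} q = refl
ord-injective {neg} {neg} q = refl
ord-injective {zer} {zer} q = refl

ord-mono : ∀ a b {D} → Sum (- a) b D → D ≢ neg → ord a ≤ ord b
ord-mono neg b s h = z≤n
ord-mono pos pos s h = ≤-refl
ord-mono pos neg (_ , _ , s) h = ⊥-elim (h (s refl))
ord-mono pos zer (_ , s , _) h = ⊥-elim (h (s refl))
ord-mono zer pos s h = s≤s z≤n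
ord-mono zer neg (s , _ , _) h = ⊥-elim (h (s refl))
ord-mono zer zer s h = ≤-refl

cycle-≤ : ∀ {t} (q : Fin (suc t) → ℕ) → (∀ i → q i ≤ q (next i)) → ∀ i j → q i ≡ q j
cycle-≤ q h i j = ≤-antisym (c i j) (c j i)
  where c = cycle-const {_⊑_ = _≤_} ≤-refl ≤-trans q h

cycle-≥ : ∀ {t} (q : Fin (suc t) → ℕ) → (∀ i → q (next i) ≤ q i) → ∀ i j → q i ≡ q j
cycle-≥ q h i j = ≤-antisym (c j i) (c i j)
  where c = cycle-const {_⊑_ = λ a b → b ≤ a} ≤-refl (λ a b → ≤-trans b a) q h

cycle-≡ : ∀ {A : Set} {t} (q : Fin (suc t) → A) → (∀ i → q i ≡ q (next i)) → ∀ i j → q i ≡ q j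
cycle-≡ = cycle-const {_⊑_ = _≡_} refl trans

cycle-wk : ∀ {t} (q : Fin (suc t) → ℕ) (D : Fin (suc t) → Sign) τ → (∀ i → D i ≢ neg) →
           (∀ i → Wk (τ · D i) (q i) (q (next i))) → ∀ i j → q i ≡ q j
cycle-wk q D pos h w = cycle-≤ q λ i → up (D i) (h i) (w i)
  where
  up : ∀ d {a b} → d ≢ neg → Wk d a b → a ≤ b
  up pos _ x = proj₁ x refl
  up neg h _ = ⊥-elim (h refl)
  up zer _ x = ≤-reflexive (proj₁ (proj₂ x) refl)
cycle-wk q D neg h w = cycle-≥ q λ i → down (D i) (h i) (w i)
  where
  down : ∀ d {a b} → d ≢ neg → Wk (- d) a b → b ≤ a
  down pos _ x = proj₂ (proj₂ x) refl
  down neg h _ = ⊥-elim (h refl)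
  down zer _ x = ≤-reflexive (sym (proj₁ (proj₂ x) refl))
cycle-wk q D zer h w = cycle-≤ q λ i → ≤-reflexive (proj₁ (proj₂ (w i)) refl)

strong-induction : ∀ {k} (P : Fin k → Set) → (∀ t → (∀ u → u <ᶠ t → P u) → P t) → ∀ t → P t
strong-induction P step t = go (suc (toℕ t)) t ≤-refl
  where
  go : ∀ m t → toℕ t < m → P t
  go (suc m) t (s≤s l) = step t λ u q → go m u (≤-trans q l)

module Acyclic (Stg : Setting) where
  open Setting Stg

  distinguish : ∀ {W W'} → Coc W → Coc W' → W ‼ g⁺ ≡ pos → W' ‼ g⁺ ≡ pos → W ≢ W' → ∃ λ h → W ‼ h ≡ zer × W' ‼ h ≢ zer
  distinguish {W} {W'} c c' q q' ne with any? (λ h → (W ‼ h ≟ₛ zer) ×-dec ¬? (W' ‼ h ≟ₛ zer))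
  ... | yes x = x
  ... | no k =
    let w , e = uniq (coc-R c) (proj₁ c) (proj₁ c') (van-zset W)
                  (van λ h m → decidable-stable (W' ‼ h ≟ₛ zer) (λ z → k (h , zset∈ W m , z))) (pos≢ q)
        w≡ = prove 3 (λ w a b → a ≐ 𝟏 ⇛ b ≐ 𝟏 ⇛ b ≐ w ⊗ a ⇛ w ≐ 𝟏) w (W ‼ g⁺) (W' ‼ g⁺) q q' (e g⁺)
    in ⊥-elim (ne (ext λ h → sym (trans (e h) (cong (_· W ‼ h) w≡))))

  -- The elimination in an edge label only restricts the signs of T to those of -W and W'.
  -- Comparison with `det W W' g⁺`, normalized at α, identifies T with W' - W.
  arc : ∀ {W W' D} → EdgeLabel C' Full g⁺ f⁺ W W' D → ∃ λ T → Edge W W' T × T ‼ f⁺ ≡ D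
  arc {W} {W'} ((c , Wg) , (c' , W'g) , cf , co , T , (cocT , Tg , Th) , Tf) = T , record
    { F' = F' ; r2F = r2F ; vW = vW ; vW' = vW'
    ; F'∋ = λ {h} a b → ∈zset (W ∘ W') (trans (∘-‼ W W' h) (cong₂ _∘ₛ_ a b))
    ; conf = λ h a b → prove 2 (λ a b → a ≠ 𝟎 ⇛ b ≠ 𝟎 ⇛ a ≠ ⊝ b ⇛ a ≐ b) (W ‼ h) (W' ‼ h) a b (λ q → cf h (a , q))
    ; cT = cT ; Tg = Tg ; Ts = λ h → subst (Sum _ _) (trans (proj₂ pr h) (cong (_· T ‼ h) w≡)) (Zs h)
    ; α = α ; α' = proj₁ d' ; Wα = Wα ; W'α = W'α ; Wα' = proj₂ (proj₂ d') ; W'α' = proj₁ (proj₂ d') } , Tf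
    where
    F' = zset (W ∘ W')
    r2F = comodular-R {W} {W'} co
    vW : Van W F'
    vW = van λ h m → ∘ₛ-zeroˡ _ _ (trans (sym (∘-‼ W W' h)) (zset∈ (W ∘ W') m))
    vW' : Van W' F'
    vW' = van λ h m → ∘ₛ-zeroʳ (W ‼ h) _ (trans (sym (∘-‼ W W' h)) (zset∈ (W ∘ W') m))
    W≢ : W ≢ W'
    W≢ = proj₁ (proj₂ (proj₂ co))
    d = distinguish c c' Wg W'g W≢
    d' = distinguish c' c W'g Wg (λ q → W≢ (sym q))
    α = proj₁ d
    Wα = proj₁ (proj₂ d)
    W'α = proj₂ (proj₂ d)
    cT = proj₁ cocT
    value : ∀ h → W ‼ h ≡ zer → T ‼ h ≢ zer → T ‼ h ≡ W' ‼ h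
    value h q nz with Th h nz
    ... | inj₁ e = ⊥-elim (nz (trans e (trans (neg-‼ W h) (cong -_ q))))
    ... | inj₂ e = e
    vT : Van T F'
    vT = van λ h m → decidable-stable (T ‼ h ≟ₛ zer) (λ nz → nz (trans (value h (at vW h m) nz) (at vW' h m)))
    Zd = det W W' g⁺ (proj₁ c) (proj₁ c') vW vW'
    Z₀ = proj₁ Zd
    Zs : ∀ h → Sum (- (W ‼ h)) (W' ‼ h) (Z₀ ‼ h)
    Zs h = subst₂ (λ a b → Sum (- b · W ‼ h) (a · W' ‼ h) (Z₀ ‼ h)) Wg W'g (proj₂ (proj₂ (proj₂ (proj₂ Zd))) h)
    pr = uniq (r2F g⁺ (⇒∉cl (proj₁ c) vW (pos≢ Wg))) cT (proj₁ (proj₂ Zd)) (van-⊕ vT Tg)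
           (van-⊕ (proj₁ (proj₂ (proj₂ Zd))) (proj₁ (proj₂ (proj₂ (proj₂ Zd))))) (proj₂ (proj₁ (proj₂ cocT)))
    Zα : Z₀ ‼ α ≡ W' ‼ α
    Zα = proj₁ (Zs α) (cong -_ Wα)
    Tα≢ : T ‼ α ≢ zer
    Tα≢ z = W'α (trans (sym Zα) (trans (proj₂ pr α) (·-zero (proj₁ pr) z)))
    w≡ : proj₁ pr ≡ pos
    w≡ = prove 3 (λ w t z → z ≐ w ⊗ t ⇛ z ≐ t ⇛ t ≠ 𝟎 ⇛ w ≐ 𝟏) (proj₁ pr) (T ‼ α) (Z₀ ‼ α) (proj₂ pr α) (trans Zα (sym (value α Wα Tα≢))) Tα≢

  module Cycle {t : ℕ} (cyc : Fin (suc t) → SignVec (suc n)) (D : Fin (suc t) → Sign) (D≢ : ∀ i → D i ≢ neg)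
    (T : Fin (suc t) → SignVec (suc n)) (vertex : ∀ i → Vertex C' Full g⁺ f⁺ (cyc i)) (arcs : ∀ i → Edge (cyc i) (cyc (next i)) (T i)) (TD : ∀ i → T i ‼ f⁺ ≡ D i)
    (i₀ : Fin (suc t)) (fw : D i₀ ≡ pos) where

    ε : Sign
    ε = cyc i₀ ‼ f⁺

    step-f : ∀ i → Sum (- (cyc i ‼ f⁺)) (cyc (next i) ‼ f⁺) (D i)
    step-f i = subst (Sum _ _) (TD i) (Edge.Ts (arcs i) f⁺)

    const-f : ∀ i → cyc i ‼ f⁺ ≡ ε
    const-f i = ord-injective (cycle-≤ (λ i → ord (cyc i ‼ f⁺)) (λ i → ord-mono _ _ (step-f i) (D≢ i)) i i₀)

    -- With f zero at both ends, T would vanish at f and the edge at i₀ would not be forward.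
    ε≢ : ε ≢ zer
    ε≢ z = pos≢ fw (trans (proj₁ (step-f i₀) (cong -_ z)) (trans (const-f (next i₀)) z))

    open Levels Stg ε ε≢

    vt : ∀ i → Vtx ε (cyc i)
    vt i = record { coc = proj₁ (vertex i) ; Wg = proj₂ (vertex i) ; Wf = const-f i ; ε≢ = ε≢ }

    K : ∀ i → Kind ε (cyc i)
    K i = kind (vt i)

    facts : ∀ i → EF (D i) (K i) (K (next i))
    facts i = subst (λ d → EF d (K i) (K (next i))) (TD i) (Edges.edge-facts Stg ε ε≢ {T = T i} (vt i) (vt (next i)) (arcs i) (K i) (K (next i)))

    -- Finite levels get 1, the infinite level 0 or 2 according to ε: the order of -∞, finite and
    -- +∞.
    class : Maybe ℕ → ℕ
    class (just _) = 1
    class nothing  = ord ε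

    ε≢1 : ord ε ≢ 1
    ε≢1 q = ε≢ (ord-injective q)

    class-mono : ∀ a b {d} → Le d a b → d ≢ neg → class a ≤ class b
    class-mono (just a) (just b) l h = ≤-refl
    class-mono nothing nothing l h = ≤-refl
    class-mono (just a) nothing l h = go ε (λ q → h (trans l q)) ε≢
      where
      go : ∀ e → e ≢ neg → e ≢ zer → 1 ≤ ord e
      go pos _ _ = s≤s z≤n
      go neg h _ = ⊥-elim (h refl)
      go zer _ h = ⊥-elim (h refl)
    class-mono nothing (just b) l h = go ε (λ q → h (trans l (cong -_ q))) ε≢
      where
      go : ∀ e → e ≢ pos → e ≢ zer → ord e ≤ 1
      go pos h _ = ⊥-elim (h refl)
      go neg _ _ = z≤n
      go zer _ h = ⊥-elim (h refl)

    -- The default 0 is harmless, since values are compared only after the classes are known to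
    -- agree.
    value : Maybe ℕ → ℕ
    value (just a) = a
    value nothing  = 0

    value-mono : ∀ a b {d} → class a ≡ class b → Le d a b → d ≢ neg → value a ≤ value b
    value-mono (just a) (just b) {pos} _ l h = proj₁ l refl
    value-mono (just a) (just b) {zer} _ l h = ≤-reflexive (proj₁ (proj₂ l) refl)
    value-mono (just a) (just b) {neg} _ l h = ⊥-elim (h refl)
    value-mono (just a) nothing q l h = ⊥-elim (ε≢1 (sym q))
    value-mono nothing (just b) q l h = z≤n
    value-mono nothing nothing q l h = z≤n

    level-≡ : ∀ a b → class a ≡ class b → value a ≡ value b → a ≡ b
    level-≡ (just a) (just b) _ q = cong just q
    level-≡ (just a) nothing q _ = ⊥-elim (ε≢1 (sym q))
    level-≡ nothing (just b) q _ = ⊥-elim (ε≢1 q)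
    level-≡ nothing nothing _ _ = refl

    same-class : ∀ i j → class (lev (K i)) ≡ class (lev (K j))
    same-class = cycle-≤ (λ i → class (lev (K i))) (λ i → class-mono (lev (K i)) (lev (K (next i))) (EF.le (facts i)) (D≢ i))

    same-value : ∀ i j → value (lev (K i)) ≡ value (lev (K j))
    same-value = cycle-≤ (λ i → value (lev (K i))) (λ i → value-mono (lev (K i)) (lev (K (next i))) (same-class i (next i)) (EF.le (facts i)) (D≢ i))

    same-lev : ∀ i j → lev (K i) ≡ lev (K j)
    same-lev i j = level-≡ _ _ (same-class i j) (same-value i j)

    sums : ∀ i → Sum (- sgn (K i)) (sgn (K (next i))) (D i)
    sums i = prove 3 (λ a b d → sum b (⊝ a) d ⇛ sum (⊝ a) b d) (sgn (K i)) (sgn (K (next i))) (D i) (EF.sm (facts i) (same-lev i (next i)))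

    same-sgn : ∀ i j → sgn (K i) ≡ sgn (K j)
    same-sgn i j = ord-injective (cycle-≤ (λ i → ord (sgn (K i))) (λ i → ord-mono _ _ (sums i) (D≢ i)) i j)

    sgn≢ : ∀ i → sgn (K i) ≢ zer
    sgn≢ i z = pos≢ fw (trans (proj₁ (sums i₀) (cong -_ (trans (same-sgn i₀ i) z))) (trans (same-sgn (next i₀) i) z))

    extract : ∀ {W} (K : Kind ε W) → sgn K ≢ zer → ∃ λ N → K ≡ new N
    extract (old _) h = ⊥-elim (h refl)
    extract (new N) h = N , refl

    N : ∀ i → New ε (cyc i)
    N i = proj₁ (extract (K i) (sgn≢ i))

    K≡ : ∀ i → K i ≡ new (N i)
    K≡ i = proj₂ (extract (K i) (sgn≢ i))

    deep : ∀ i → Deep (D i) (N i) (N (next i))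
    deep i = subst₂ (DeepK (D i)) (K≡ i) (K≡ (next i)) (EF.dp (facts i) (same-lev i (next i)) (same-sgn i (next i)) (sgn≢ i))

    hat : ∀ i → ∃ λ (h : Hat (New.Y (N i))) → lev (K i) ≡ level h
    hat i = let h , q = nonzero-hat (vt i) (N i) (λ z → sgn≢ i (trans (cong sgn (K≡ i)) z)) in h , trans (cong lev (K≡ i)) q

    side : ∀ {X} → Hat X → Side
    side (hfin _)   = 𝒈
    side (hinf _ _) = 𝒇

    side≢ : ∀ {X X'} (h : Hat X) (h' : Hat X') → level h ≡ level h' → X' ‼ elt (side h) ≢ zer
    side≢ (hfin _)   (hfin q)   _ = pos≢ q
    side≢ (hinf _ _) (hinf _ q) _ z = ε≢ (trans (sym q) z)

    σ : Side
    σ = side (proj₁ (hat i₀))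

    Yσ : ∀ i → New.Y (N i) ‼ elt σ ≢ zer
    Yσ i = side≢ (proj₁ (hat i₀)) (proj₁ (hat i)) (trans (sym (proj₂ (hat i₀))) (trans (same-lev i₀ i) (proj₂ (hat i))))

    lf : ∀ i → LexFacts σ (η σ · D i) (N i) (N (next i))
    lf i = Deep.lexf (deep i) σ (Yσ i) (Yσ (next i))

    y γ w : Fin (suc t) → Sign
    y i = New.Y (N i) ‼ p
    γ i = New.G (N i) σ ‼ elt (opp σ)
    w i = cyc i ‼ elt σ

    same-w : ∀ τ i j → cyc i ‼ elt τ ≡ cyc j ‼ elt τ
    same-w 𝒈 i j = trans (Vtx.Wg (vt i)) (sym (Vtx.Wg (vt j)))
    same-w 𝒇 i j = trans (const-f i) (sym (const-f j))

    same-y : ∀ i j → y i ≡ y j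
    same-y = cycle-≡ y (λ i → Deep.sameY (deep i))

    same-γ : ∀ i j → γ i ≡ γ j
    same-γ = cycle-≡ γ (λ i → LexFacts.sameG (lf i))

    -- Monotonicity round the cycle needs the same factor in front of D at every edge; this is what
    -- the constancy of γ provides. For `const₂` it is that of w and y.
    const₁ : ∀ u i j → Ψ σ u (New.Y (N i)) ≡ Ψ σ u (New.Y (N j))
    const₁ = strong-induction (λ u → ∀ i j → Ψ σ u (New.Y (N i)) ≡ Ψ σ u (New.Y (N j))) λ u ih →
      cycle-wk (λ i → Ψ σ u (New.Y (N i))) D (- γ i₀ · η σ) D≢ λ i →
        subst (λ s → Wk s (Ψ σ u (New.Y (N i))) (Ψ σ u (New.Y (N (next i)))))
          (prove 4 (λ a b e d → a ≐ b ⇛ ⊝ a ⊗ (e ⊗ d) ≐ ⊝ b ⊗ e ⊗ d) (γ i) (γ i₀) (η σ) (D i) (same-γ i i₀))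
          (LexFacts.key₁ (lf i) u (λ v l → ih v l i (next i)))

    const₂ : ∀ u i j → Ψ (opp σ) u (New.G (N i) σ) ≡ Ψ (opp σ) u (New.G (N j) σ)
    const₂ = strong-induction (λ u → ∀ i j → Ψ (opp σ) u (New.G (N i) σ) ≡ Ψ (opp σ) u (New.G (N j) σ)) λ u ih →
      cycle-wk (λ i → Ψ (opp σ) u (New.G (N i) σ)) D (w i₀ · y i₀ · η σ) D≢ λ i →
        subst (λ s → Wk s (Ψ (opp σ) u (New.G (N i) σ)) (Ψ (opp σ) u (New.G (N (next i)) σ)))
          (prove 6 (λ a b a' b' e d → a ≐ a' ⇛ b ≐ b' ⇛ a ⊗ b ⊗ (e ⊗ d) ≐ a' ⊗ b' ⊗ e ⊗ d) (w i) (y i) (w i₀) (y i₀) (η σ) (D i) (same-w σ i i₀) (same-y i i₀))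
          (LexFacts.key₂ (lf i) (λ v → const₁ v i (next i)) u (λ v l → ih v l i (next i)))

    absurd : ⊥
    absurd = pos≢ fw (prove 2 (λ e d → e ≠ 𝟎 ⇛ e ⊗ d ≐ 𝟎 ⇛ d ≐ 𝟎) (η σ) (D i₀) (η≢ σ)
      (LexFacts.flat (lf i₀) (λ v → const₁ v i₀ (next i₀)) (λ v → const₂ v i₀ (next i₀))))
      where
      η≢ : ∀ σ → η σ ≢ zer
      η≢ 𝒈 ()
      η≢ 𝒇 ()

  acyclic : ¬ DirectedCycle C' Full g⁺ f⁺
  acyclic (t , cyc , _ , edges , i₀ , fw) = Cycle.absurd cyc (λ i → proj₁ (L i)) (λ i → proj₁ (proj₂ (L i)))
    (λ i → proj₁ (A i)) (λ i → proj₁ (proj₂ (proj₂ (L i)))) (λ i → proj₁ (proj₂ (A i))) (λ i → proj₂ (proj₂ (A i))) i₀ (label₀ (i₀ ≟ᶠ i₀))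
    where
    Label : Fin (suc t) → Set
    Label i = Σ Sign λ D → D ≢ neg × EdgeLabel C' Full g⁺ f⁺ (cyc i) (cyc (next i)) D
    -- At i₀ the label is taken from the forward witness, as `edges i₀` might present the same pair
    -- as undirected.
    label : ∀ i → Dec (i ≡ i₀) → Label i
    label i (yes refl) = pos , (λ ()) , fw
    label i (no _) with edges i
    ... | inj₁ e = pos , (λ ()) , e
    ... | inj₂ e = zer , (λ ()) , e
    label₀ : ∀ d → proj₁ (label i₀ d) ≡ pos
    label₀ (yes refl) = refl
    label₀ (no h) = ⊥-elim (h refl)
    L : ∀ i → Label i
    L i = label i (i ≟ᶠ i₀)
    A = λ i → arc (proj₂ (proj₂ (L i)))

-- From the Euclidean programs of O to those of the extension

theorem4p42 : (n : ℕ) (C : CovSet n) → IsOM C →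
    (r : ℕ) → HasRank C Full Full r →
    (f g : Fin n) → f ≢ g →
    (k : ℕ) (es : Fin k → Fin n) → k ≤ r →
    (∀ i j → es i ≡ es j → i ≡ j) → Independent C Full (setOf es) →
    (l m : ℕ) → IsFirstClosureIndex C es f l → IsFirstClosureIndex C es g m →
    EuclideanProgram C Full g f →
    (∀ i → EuclideanProgram C Full (es i) f) →
    (∀ i → EuclideanProgram C Full (es i) g) →
    ((l ⊓ m < suc k) ⊎ ¬ GeneralPosition C Full f ⊎ ¬ GeneralPosition C Full g →
    ∀ (i j : Fin k) → toℕ i < (l ⊔ m) ⊓ (k ∸ 1) → toℕ i < toℕ j →
    EuclideanProgram (contract C (prefix es (toℕ i))) (Full ─ prefix es (toℕ i)) (es i) (es j)) →
    (C' : CovSet (suc n)) → IsSingleElementExtension C C' (lexSign es) →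
    EuclideanProgram C' Full (suc g) (suc f)
theorem4p42 n C om r rk f g f≢g k es _ _ _ _ _ _ _ ((g≢f , _ , _ , gl , fc) , ac) ef eg _ C' ex =
  ((λ { refl → g≢f refl }) , ∈⊤ , ∈⊤ ,
   (λ (_ , h) → gl (∈⊤ , λ X c _ → let s , c' = proj₁ (proj₁ (proj₂ ex) X) c in h (s ∷ X) c' (λ _ m → ⊥-elim (∉⊥ m)))) ,
   (λ (_ , h) → fc (∈⊤ , λ (_ , q) → h (∈⊤ , λ { (x ∷ X) c v → q X (proj₂ (proj₁ (proj₂ ex) X) (x , c)) (λ e m → v (suc e) (there m)) })))) ,
  λ cycle →
    ¬¬-∀V (λ X → ¬¬-excluded-middle {A = C' X}) λ C'? →
    let Dat = record { n = n ; C = C ; om = om ; r = r ; rk = rk ; f = f ; g = g ; k = k ; es = es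
                     ; C' = C' ; ext' = ex ; C'? = C'? ; g-nonloop = gl }
        open Ext Dat using (module Pot; 𝒈; 𝒇)
        slopes : ∀ x y → ¬ DirectedCycle C Full x y → ¬ ¬ Pot.HasPotential y x
        slopes x y a k = Pot.euclidean⇒potential rk a λ h → k (Pot.potential-swap h)
    in Pot.euclidean⇒potential rk ac λ (φ , isφ , _) →
       ¬¬-∀F (λ t → slopes (es t) g (proj₂ (eg t))) λ pg →
       ¬¬-∀F (λ t → slopes (es t) f (proj₂ (ef t))) λ pf →
       Acyclic.acyclic (record { Dat = Dat ; φ = φ ; isφ = isφ
         ; ψ = λ { 𝒈 t → proj₁ (pg t) ; 𝒇 t → proj₁ (pf t) }
         ; isψ = λ { 𝒈 t → proj₁ (proj₂ (pg t)) ; 𝒇 t → proj₁ (proj₂ (pf t)) } }) cycle
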